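{- Let $m,n$ be positive integers. Then: (i) $\bigcup_{\boldsymbol{\gamma}\in[0,1)^{m}}\Omega^{\boldsymbol{\gamma}}(m,n)=[0,1)^{m\times n}\setminus\mathbf{Bad}^{\boldsymbol{0}}(m,n)$; equivalently, for $A\in[0,1)^{m\times n}$, $\Omega_A(m,n)=\emptyset$ if and only if $A\in\mathbf{Bad}^{\boldsymbol{0}}(m,n)$. (ii) For every $\boldsymbol{\gamma}\in[0,1)^{m}$, $\mu_{mn}(\Omega^{\boldsymbol{\gamma}}(m,n))=0$. (iii) For every $A\in[0,1)^{m\times n}$, $\mu_{m}(\Omega_{A}(m,n))=0$.
   Context: $[0,1)^{m\times n}$ is the set of real $m\times n$ matrices with entries in $[0,1)$. For $\boldsymbol{x}\in\mathbb{R}^n$, $\|\boldsymbol{x}\|=\max_i|x_i|$; for $\boldsymbol{y}\in\mathbb{R}^m$, $\langle\boldsymbol{y}\rangle=\min_{\boldsymbol{p}\in\mathbb{Z}^m}\|\boldsymbol{y}-\boldsymbol{p}\|$. For $\psi:\mathbb{N}\to[0,\infty)$, $W_{m,n}(\psi)$ is the set of pairs $(A,\boldsymbol{\gamma})\in[0,1)^{m\times n}\times[0,1)^m$ such that $\langle A\boldsymbol{q}-\boldsymbol{\gamma}\rangle<\psi(\|\boldsymbol{q}\|)$ for infinitely many $\boldsymbol{q}\in\mathbb{Z}^n$. "Decreasing" means non-increasing. $\mathcal{D}$ is the set of decreasing $\psi:\mathbb{N}\to[0,\infty)$ with $\sum_{q\ge1}q^{n-1}\psi(q)^m=\infty$.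 $\Omega(m,n)=\bigcap_{\psi\in\mathcal{D}}W_{m,n}(\psi)$, $\Omega^{\boldsymbol{\gamma}}(m,n)=\{A:(A,\boldsymbol{\gamma})\in\Omega(m,n)\}$, $\Omega_A(m,n)=\{\boldsymbol{\gamma}\in[0,1)^m:(A,\boldsymbol{\gamma})\in\Omega(m,n)\}$. $\mathbf{Bad}^{\boldsymbol{0}}(m,n)=\{A\in[0,1)^{m\times n}:\liminf_{\boldsymbol{q}\in\mathbb{Z}^n,\|\boldsymbol{q}\|\to\infty}\|\boldsymbol{q}\|^n\langle A\boldsymbol{q}\rangle^m>0\}$. $\mu_l$ denotes $l$-dimensional Lebesgue measure. -}

module Defs where

open import Algebra.Bundles using (CommutativeRing; Semiring)
import Algebra.Construct.NaturalChoice.Max as Max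
import Algebra.Definitions.RawSemiring as RawSemiringDefs
open import Data.Fin.Base using (toℕ; combine)
open import Data.Integer.Base as ℤ using (ℤ; +_; -[1+_])
open import Data.List.Base using (List)
open import Data.List.Membership.Propositional using () renaming (_∉_ to _∉ᴸ_)
open import Data.Nat.Base as ℕ using (ℕ; suc; pred)
open import Data.Product.Base using (∃; ∃-syntax; Σ-syntax; _×_; _,_)
open import Data.Vec.Base as Vec using (Vec)
open import Data.Vec.Functional as Vector using (Vector)
open import Function.Base using (flip; _∘_)
open import Level using (0ℓ)
open import Relation.Binary.Bundles using (TotalOrder)
import Relation.Binary.Construct.Add.Supremum.Equality as AddSupEquality
import Relation.Binary.Construct.Add.Supremum.NonStrict as AddSupNonStrict
import Relation.Binary.Construct.Add.Supremum.Strict as AddSupStrict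
import Relation.Binary.Construct.NonStrictToStrict as ToStrict
open import Relation.Binary.Core using (Rel)
open import Relation.Binary.Structures using (IsTotalOrder)
open import Relation.Nullary.Construct.Add.Supremum using (_⁺; [_]; ⊤⁺)
open import Relation.Nullary.Negation.Core using (¬_)
open import Relation.Unary using (Pred; _∈_; _∩_; _∖_)

module _ {A : Set} (_≤_ : Rel A 0ℓ) (P : Pred A 0ℓ) where

  IsUpperBound : Pred A 0ℓ
  IsUpperBound u = ∀ x → x ∈ P → x ≤ u

  IsSup : Pred A 0ℓ
  IsSup s = IsUpperBound s × (∀ u → IsUpperBound u → s ≤ u)

  IsMin : Pred A 0ℓ
  IsMin d = d ∈ P × (∀ x → x ∈ P → d ≤ x)

IsInf : {A : Set} → Rel A 0ℓ → Pred A 0ℓ → Pred A 0ℓ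
IsInf _≤_ = IsSup (flip _≤_)

-- The standard library has no real numbers.  They are taken, up to the
-- isomorphism that determines them, as a Dedekind-complete totally
-- ordered field; equality is the setoid equality _≈_.
record RealNumbers : Set₁ where
  infix 4 _≤_
  field
    commutativeRing : CommutativeRing 0ℓ 0ℓ

  open CommutativeRing commutativeRing public
    renaming (Carrier to ℝ)

  field
    _≤_          : Rel ℝ 0ℓ
    isTotalOrder : IsTotalOrder _≈_ _≤_
    0≉1          : ¬ (0# ≈ 1#)
    inverse      : ∀ x → ¬ (x ≈ 0#) → ∃[ y ] x * y ≈ 1#
    +-monoʳ-≤    : ∀ z {x y} → x ≤ y → z + x ≤ z + y
    *-nonNeg     : ∀ {x y} → 0# ≤ x → 0# ≤ y → 0# ≤ x * y
    complete     : (P : Pred ℝ 0ℓ) → ∃ P → ∃ (IsUpperBound _≤_ P) →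
                   ∃ (IsSup _≤_ P)

  totalOrder : TotalOrder 0ℓ 0ℓ 0ℓ
  totalOrder = record { isTotalOrder = isTotalOrder }

  open ToStrict _≈_ _≤_ public using (_<_)
  open Max totalOrder public using (_⊔_)
  open RawSemiringDefs (Semiring.rawSemiring semiring) public
    using (sum; product; _^_) renaming (_×_ to _·_)

  ∣_∣ : ℝ → ℝ
  ∣ x ∣ = x ⊔ - x

  fromℕ : ℕ → ℝ
  fromℕ k = k · 1#

  fromℤ : ℤ → ℝ
  fromℤ (+ k)    = fromℕ k
  fromℤ -[1+ k ] = - fromℕ (suc k)

  -- ⊤⁺ is +∞.
  ℝ⁺ : Set
  ℝ⁺ = ℝ ⁺

  open AddSupEquality _≈_ public using (_≈⁺_)
  open AddSupNonStrict _≤_ public using (_≤⁺_)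
  open AddSupStrict _<_ public using (_<⁺_)

  infixl 6 _+⁺_
  _+⁺_ : ℝ⁺ → ℝ⁺ → ℝ⁺
  [ x ] +⁺ [ y ] = [ x + y ]
  ⊤⁺    +⁺ _     = ⊤⁺
  [ _ ] +⁺ ⊤⁺    = ⊤⁺

  -- For a series of nonnegative terms a 0 + a 1 + …, its sum in [0,∞].
  IsSeriesSum : (ℕ → ℝ) → Pred ℝ⁺ 0ℓ
  IsSeriesSum a = IsSup _≤⁺_ λ x → ∃[ N ] x ≈⁺ [ sum {N} (a ∘ toℕ) ]

-- Lebesgue measure on ℝˡ: countable covers by boxes give the outer measure,
-- and measurability is Carathéodory's condition.
module Lebesgue (R : RealNumbers) {l : ℕ} where
  open RealNumbers R

  record Box : Set where
    field
      lower upper : Vector ℝ l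
      lower≤upper : ∀ i → lower i ≤ upper i

    volume : ℝ
    volume = product (λ i → upper i - lower i)

    Points : Pred (Vector ℝ l) 0ℓ
    Points x = ∀ i → lower i ≤ x i × x i ≤ upper i

  open Box

  Covers : (ℕ → Box) → Pred (Vector ℝ l) 0ℓ → Set
  Covers B E = ∀ x → x ∈ E → ∃[ k ] x ∈ Points (B k)

  IsOuterMeasure : Pred (Vector ℝ l) 0ℓ → Pred ℝ⁺ 0ℓ
  IsOuterMeasure E = IsInf _≤⁺_ λ v →
    ∃[ B ] Covers B E × IsSeriesSum (volume ∘ B) v

  Measurable : Pred (Vector ℝ l) 0ℓ → Set₁
  Measurable E = (T : Pred (Vector ℝ l) 0ℓ) → ∀ {t a b} →
    IsOuterMeasure T t → IsOuterMeasure (T ∩ E) a → IsOuterMeasure (T ∖ E) b →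
    t ≈⁺ a +⁺ b

  -- E is measurable and μ_l(E) = v.
  IsMeasure : Pred (Vector ℝ l) 0ℓ → ℝ⁺ → Set₁
  IsMeasure E v = Measurable E × IsOuterMeasure E v

module Approximation (R : RealNumbers) (m n : ℕ) where
  open RealNumbers R
  open Lebesgue R

  Matrix : Set
  Matrix = Vector (Vector ℝ n) m

  [0,1⟩ : Pred ℝ 0ℓ
  [0,1⟩ x = 0# ≤ x × x < 1#

  [0,1⟩ᵐ : Pred (Vector ℝ m) 0ℓ
  [0,1⟩ᵐ γ = ∀ i → γ i ∈ [0,1⟩

  [0,1⟩ᵐˣⁿ : Pred Matrix 0ℓ
  [0,1⟩ᵐˣⁿ A = ∀ i j → A i j ∈ [0,1⟩

  -- Starting the maximum at 0 is harmless as the entries are nonnegative.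
  ‖_‖ : Vector ℝ m → ℝ
  ‖ x ‖ = Vector.foldr _⊔_ 0# (Vector.map ∣_∣ x)

  ‖_‖ℤ : Vec ℤ n → ℕ
  ‖ q ‖ℤ = Vec.foldr′ ℕ._⊔_ 0 (Vec.map ℤ.∣_∣ q)

  infixl 7 _*ᵥ_
  _*ᵥ_ : Matrix → Vec ℤ n → Vector ℝ m
  (A *ᵥ q) i = sum (λ j → A i j * fromℤ (Vec.lookup q j))

  infixl 6 _-ᵥ_
  _-ᵥ_ : Vector ℝ m → Vector ℝ m → Vector ℝ m
  _-ᵥ_ = Vector.zipWith _-_

  -- IsDist y d says that d = ⟨y⟩; such a d is unique up to _≈_.
  IsDist : Vector ℝ m → Pred ℝ 0ℓ
  IsDist y = IsMin _≤_ λ x →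
    Σ[ p ∈ Vector ℤ m ] x ≈ ‖ y -ᵥ Vector.map fromℤ p ‖

  InfinitelyMany : Pred (Vec ℤ n) 0ℓ → Set
  InfinitelyMany P = (F : List (Vec ℤ n)) → ∃[ q ] q ∈ P × q ∉ᴸ F

  -- ψ is also given a value at 0, used only at the single point q = 0.
  W : (ℕ → ℝ) → Pred (Matrix × Vector ℝ m) 0ℓ
  W ψ (A , γ) = A ∈ [0,1⟩ᵐˣⁿ × γ ∈ [0,1⟩ᵐ ×
    InfinitelyMany λ q → ∃[ d ] IsDist (A *ᵥ q -ᵥ γ) d × d < ψ ‖ q ‖ℤ

  Decreasing : Pred (ℕ → ℝ) 0ℓ
  Decreasing ψ = ∀ {q r} → q ℕ.≤ r → ψ r ≤ ψ q

  -- The series runs over q = 1 + k.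
  𝒟 : Pred (ℕ → ℝ) 0ℓ
  𝒟 ψ = (∀ q → 0# ≤ ψ q) × Decreasing ψ ×
    IsSeriesSum (λ k → fromℕ (suc k) ^ pred n * ψ (suc k) ^ m) ⊤⁺

  Ω : Pred (Matrix × Vector ℝ m) 0ℓ
  Ω Aγ = ∀ ψ → ψ ∈ 𝒟 → Aγ ∈ W ψ

  Ω^ : Vector ℝ m → Pred Matrix 0ℓ
  Ω^ γ A = (A , γ) ∈ Ω

  Ω₍_₎ : Matrix → Pred (Vector ℝ m) 0ℓ
  Ω₍ A ₎ γ = (A , γ) ∈ Ω

  -- The limit inferior as ‖q‖ → ∞ of a function bounded below, in (-∞,∞],
  -- as the supremum of its tail infima; F q x says that x is the value at q.
  IsLiminf : (Vec ℤ n → Pred ℝ 0ℓ) → Pred ℝ⁺ 0ℓ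
  IsLiminf F = IsSup _≤⁺_ λ s →
    ∃[ N ] IsInf _≤⁺_ (λ x → ∃[ q ] ∃[ y ] N ℕ.≤ ‖ q ‖ℤ × y ∈ F q × x ≈⁺ [ y ]) s

  Bad⁰ : Pred Matrix 0ℓ
  Bad⁰ A = A ∈ [0,1⟩ᵐˣⁿ × ∃[ ℓ ] IsLiminf value ℓ × [ 0# ] <⁺ ℓ
    where
    value : Vec ℤ n → Pred ℝ 0ℓ
    value q x = ∃[ d ] IsDist (A *ᵥ q) d × x ≈ fromℕ ‖ q ‖ℤ ^ n * d ^ m

  -- Lebesgue measure on m × n matrices, identified with ℝᵐⁿ by listing entries.
  IsMatrixMeasure : Pred Matrix 0ℓ → ℝ⁺ → Set₁
  IsMatrixMeasure E = IsMeasure {m ℕ.* n} λ x → (λ i j → x (combine i j)) ∈ E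

{-# OPTIONS --safe #-}
-- By recurrence of a pair (A , γ) from a scale T on we mean that for all h ≥ T and
-- sᵐ ≤ C hⁿ some q with T ≤ ‖q‖ ≤ 2h satisfies ⟨A q - γ⟩ ≤ 1/s.  If (A , γ) is
-- recurrent from no scale, glue windows [T , 2h] without solutions together and let
-- ψ be 1/s on each: ψ lies in 𝒟, since every window adds at least a constant to the
-- series, while (A , γ) ∉ W ψ.  So every pair in Ω is recurrent from some scale on.
--
-- If A is badly approximable, the points A q are so well separated that the solutions
-- at consecutive scales coincide.  Hence a single q solves at all scales, and so does
-- another one of larger norm; separation rules this out, and no γ is possible.
--
-- Otherwise choose q₁, q₂, … sparse with ‖qₖ‖ⁿ⟨A qₖ⟩ᵐ summable, and γ = Σ A qₖ mod 1.
-- If only finitely many of the sums Qₖ = q₁ + … + qₖ were solutions for ψ ∈ 𝒟, then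
-- ψ(‖Qₖ‖) would be at most about ⟨A qₖ₊₁⟩ for all large k, and the series of ψ would
-- converge.  Moreover, the points A q with ‖q‖ ≤ 2h cluster along the multiples of a
-- good q*, so that the recurrent γ are covered by few cubes.
--
-- For fixed γ, the matrices recurrent from T on fill at most half of every grid cube,
-- at a scale h large in terms of the cube; refining the grid again and again, they
-- form a null set.
module Submission where

open import Defs
import Algebra.Construct.NaturalChoice.Max as Max
import Algebra.Properties.CommutativeMonoid.Sum
import Algebra.Properties.CommutativeSemiring.Exp
import Algebra.Properties.Ring
import Algebra.Properties.Semiring.Exp
import Algebra.Properties.Semiring.Mult
import Algebra.Properties.Semiring.Sum
import Algebra.Solver.Ring
open import Algebra.Solver.Ring.AlmostCommutativeRing using (fromCommutativeRing; _-Raw-AlmostCommutative⟶_)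
open import Axiom.ExcludedMiddle using (ExcludedMiddle)
open import Data.Empty using (⊥; ⊥-elim; ⊥-elim-irr)
open import Data.Fin.Base using (Fin; zero; suc; toℕ; combine; remQuot)
import Data.Fin.Properties as FinP
open import Data.Integer.Base as ℤ using (ℤ; +_; -[1+_])
open import Data.Integer.DivMod using (_/ℕ_; _%ℕ_; a≡a%ℕn+[a/ℕn]*n; n%ℕd<d)
import Data.Integer.Properties as ℤP
import Data.Integer.Tactic.RingSolver as ℤ-Solver
open import Data.List.Base as List using (List; []; _∷_; length; _++_; concatMap; upTo)
open import Data.List.Membership.Propositional using () renaming (_∈_ to _∈ᴸ_)
open import Data.List.Membership.Propositional.Properties using (∈-upTo⁺; ∈-map⁺; ∈-++⁺ˡ; ∈-++⁺ʳ)
open import Data.List.Properties using (length-++; length-map; length-upTo)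
open import Data.List.Relation.Unary.Any as Any using (Any; here; there)
import Data.List.Relation.Unary.Any.Properties as AnyP
open import Data.Maybe.Base as Maybe using (Maybe)
open import Data.Nat.Base as ℕ using (ℕ; zero; suc; NonZero)
import Data.Nat.Properties as ℕP
import Data.Nat.Tactic.RingSolver as ℕ-Solver
open import Data.Product.Base using (∃; ∃-syntax; Σ; _×_; _,_; proj₁; proj₂)
open import Data.Sum.Base using (_⊎_; inj₁; inj₂)
open import Data.Vec.Base as Vec using (Vec; []; _∷_; lookup)
open import Data.Vec.Functional as Vector using (Vector)
open import Data.Vec.Functional.Properties using (updateAt-updates; updateAt-minimal)
import Data.Vec.Properties as VecP
open import Function.Base using (_∘_; const)
open import Function.Bundles using (_⇔_; mk⇔)
open import Level using (0ℓ)
open import Relation.Binary.Bundles using (TotalOrder)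
import Relation.Binary.Construct.Add.Supremum.Equality as AddSupEquality
import Relation.Binary.Construct.Add.Supremum.NonStrict as AddSupNonStrict
import Relation.Binary.Construct.Add.Supremum.Strict as AddSupStrict
open import Relation.Binary.PropositionalEquality as ≡ using (_≡_)
import Relation.Binary.Reasoning.PartialOrder
import Relation.Binary.Reasoning.Setoid
open import Relation.Binary.Structures using (IsTotalOrder)
open import Relation.Nullary.Construct.Add.Supremum using ([_]; ⊤⁺)
open import Relation.Nullary.Decidable using (Dec; yes; no; dec⇒maybe)
open import Relation.Nullary.Negation using (¬_; contradiction)
open import Relation.Unary using (Pred; _∈_; _∖_; _≐_; ⋃; Empty)

-- Recurrence replaces the quantifier over all of `𝒟` by one inequality between natural numbers, so
-- what follows it is mostly counting. The factor 2 in ‖q‖ ≤ 2h is what makes the series diverge: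
-- there are h arguments in (h , 2h], each contributes at least h^(n-1)/s^m, and s^m ≤ C h^n bounds
-- their sum from below in terms of C alone. The constant C is free, and each part picks its own.
-- For a fixed C, a plain count gives no null sets: about h^n points q, each with a cube of volume
-- about 1/(C h^n), have total volume of order 1/C whatever h is. For the fibres, the missing small
-- factor comes from the approximability of A, through the clusters. For the slices, no A is given;
-- instead the bound of order 1/C is localised to a single grid cell, where it can be iterated. The
-- price of localising is that a q of small norm is spread unevenly over a small cell; such q are
-- counted separately and are beaten by a large s. Reciprocals are kept out of the counting by
-- stating ⟨y⟩ ≤ 1/s as s⟨y⟩ ≤ 1, and scales are often of the form h = τ^m, s = c τ^n, for which s^m
-- = c^m h^n holds exactly.

module Combinatorics where

  open import Data.Nat.Base using (_+_; _*_; _^_; _≤_; _<_; z≤n; s≤s; _/_; _%_)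
  open import Data.Nat.DivMod using (m/n*n≤m; m≡m%n+[m/n]*n; m%n<n)
  open import Data.Nat.Properties
  open import Relation.Binary.PropositionalEquality
  open import Algebra.Properties.CommutativeSemigroup *-commutativeSemigroup using (x∙yz≈y∙xz)

  private variable
    A B : Set

  -- Integer roots and the sizes of lists of choices

  root : ∀ d N → ∃[ s ] s ^ suc d ≤ N × N < suc s ^ suc d
  root d zero = 0 , z≤n , ≤-trans (s≤s z≤n) (≤-reflexive (sym (^-zeroˡ (suc d))))
  root d (suc N) with root d N
  ... | s , p , q with suc s ^ suc d ≤? suc N
  ...   | yes r = suc s , r , ≤-<-trans q (^-monoˡ-< (suc d) (n<1+n (suc s)))
  ...   | no ¬r = s , ≤-trans p (n≤1+n N) , ≰⇒> ¬r

  ^-cancelˡ-≤ : ∀ d {a b} → a ^ suc d ≤ b ^ suc d → a ≤ b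
  ^-cancelˡ-≤ d {a} {b} p with a ≤? b
  ... | yes q = q
  ... | no ¬q = ⊥-elim (<⇒≱ (^-monoˡ-< (suc d) (≰⇒> ¬q)) p)

  n+n≡2*n : ∀ n → n + n ≡ 2 * n
  n+n≡2*n n = cong (λ z → n + z) (sym (+-identityʳ n))

  1≤n^d : ∀ d {n} → 1 ≤ n → 1 ≤ n ^ d
  1≤n^d d {n} p = m^n>0 n {{ℕ.>-nonZero p}} d

  n≤n^[1+d] : ∀ n d → n ≤ n ^ suc d
  n≤n^[1+d] zero d = z≤n
  n≤n^[1+d] (suc n) d = m≤m*n (suc n) (suc n ^ d) {{m^n≢0 (suc n) d}}

  length-concatMap-≤ : ∀ (f : A → List B) xs {b} → (∀ x → length (f x) ≤ b) → length (concatMap f xs) ≤ length xs * b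
  length-concatMap-≤ f [] h = z≤n
  length-concatMap-≤ f (x ∷ xs) h =
    ≤-trans (≤-reflexive (length-++ (f x))) (+-mono-≤ (h x) (length-concatMap-≤ f xs h))

  *-length-concatMap-≤ : ∀ c (f : A → List B) xs {b} → (∀ x → c * length (f x) ≤ b) → c * length (concatMap f xs) ≤ length xs * b
  *-length-concatMap-≤ c f [] h = ≤-reflexive (*-zeroʳ c)
  *-length-concatMap-≤ c f (x ∷ xs) h =
    ≤-trans (≤-reflexive (trans (cong (c *_) (length-++ (f x))) (*-distribˡ-+ c (length (f x)) (length (concatMap f xs)))))
      (+-mono-≤ (h x) (*-length-concatMap-≤ c f xs h))

  concatMap-Any : ∀ {P : B → Set} {Q : A → Set} (f : A → List B) {xs} →
    (∀ {x} → Q x → Any P (f x)) → Any Q xs → Any P (concatMap f xs)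
  concatMap-Any f h q = AnyP.concatMap⁺ f (Any.map h q)

  choices : ∀ {n} → (Fin n → List A) → List (Vector A n)
  choices {n = zero} Ls = (λ ()) ∷ []
  choices {n = suc n} Ls = concatMap (λ a → List.map (a Vector.∷_) (choices (Ls ∘ suc))) (Ls zero)

  length-choices-suc : ∀ {n} (Ls : Fin (suc n) → List A) {b c} → length (Ls zero) ≤ b →
    length (choices (Ls ∘ suc)) ≤ c → length (choices Ls) ≤ b * c
  length-choices-suc Ls {b} {c} p q = ≤-trans
    (length-concatMap-≤ (λ a → List.map (a Vector.∷_) (choices (Ls ∘ suc))) (Ls zero)
      (λ a → ≤-trans (≤-reflexive (length-map (a Vector.∷_) (choices (Ls ∘ suc)))) q)) (*-monoˡ-≤ c p)

  length-choices-≤ : ∀ {n} (Ls : Fin n → List A) {b} → (∀ i → length (Ls i) ≤ b) → length (choices Ls) ≤ b ^ n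
  length-choices-≤ {n = zero} Ls h = ≤-refl
  length-choices-≤ {n = suc n} Ls h = length-choices-suc Ls (h zero) (length-choices-≤ (Ls ∘ suc) (h ∘ suc))

  -- In both counts below, one coordinate, where |q| is largest, has a list shorter than the others;
  -- this is where the saving comes from.
  length-choices-at-≤ : ∀ {n} (Ls : Fin (suc n) → List A) j {b c} → length (Ls j) ≤ c →
    (∀ i → i ≢ j → length (Ls i) ≤ b) → length (choices Ls) ≤ c * b ^ n
  length-choices-at-≤ Ls zero p h = length-choices-suc Ls p (length-choices-≤ (Ls ∘ suc) (λ i → h (suc i) (λ ())))
  length-choices-at-≤ {n = suc n} Ls (suc j) {b} {c} p h = ≤-trans
    (length-choices-suc Ls (h zero (λ ())) (length-choices-at-≤ (Ls ∘ suc) j p (λ i i≢j → h (suc i) (i≢j ∘ FinP.suc-injective))))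
    (≤-reflexive (x∙yz≈y∙xz b c (b ^ n)))

  choices-Any : ∀ {n} (Ls : Fin n → List A) (P : Fin n → A → Set) → (∀ i → Any (P i) (Ls i)) →
    Any (λ v → ∀ i → P i (v i)) (choices Ls)
  choices-Any {n = zero} Ls P h = here (λ ())
  choices-Any {n = suc n} Ls P h = concatMap-Any (λ a → List.map (a Vector.∷_) (choices (Ls ∘ suc)))
    (λ p₀ → AnyP.map⁺ (Any.map (λ { p zero → p₀ ; p (suc i) → p i }) (choices-Any (Ls ∘ suc) (P ∘ suc) (h ∘ suc))))
    (h zero)

  intRange : ℕ → List ℤ
  intRange N = List.map +_ (upTo (suc N)) ++ List.map -[1+_] (upTo N)

  length-intRange : ∀ N → length (intRange N) ≡ suc (N + N)
  length-intRange N = trans (length-++ (List.map +_ (upTo (suc N)))) (cong₂ _+_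
    (trans (length-map +_ (upTo (suc N))) (length-upTo (suc N)))
    (trans (length-map -[1+_] (upTo N)) (length-upTo N)))

  ∈-intRange : ∀ {N z} → ℤ.∣ z ∣ ≤ N → z ∈ᴸ intRange N
  ∈-intRange {N} {+ k} p = ∈-++⁺ˡ (∈-map⁺ +_ (∈-upTo⁺ (s≤s p)))
  ∈-intRange {N} { -[1+ k ]} p = ∈-++⁺ʳ (List.map +_ (upTo (suc N))) (∈-map⁺ -[1+_] (∈-upTo⁺ p))

  -- Integers whose multiples lie in an interval

  ℤ-by-diff : ∀ {d x y} → + 0 ℤ.≤ d → d ≡ y ℤ.- x → x ℤ.≤ y
  ℤ-by-diff p refl = ℤP.0≤i-j⇒j≤i p

  ℤ-lin₂ : ∀ {x y u v a b} → x ℤ.≤ y → u ℤ.≤ v → (y ℤ.- x) ℤ.+ (v ℤ.- u) ≡ b ℤ.- a → a ℤ.≤ b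
  ℤ-lin₂ p q = ℤ-by-diff (ℤP.+-mono-≤ (ℤP.i≤j⇒0≤j-i p) (ℤP.i≤j⇒0≤j-i q))

  ℤ-lin₁ : ∀ {x y a b} → x ℤ.≤ y → y ℤ.- x ≡ b ℤ.- a → a ℤ.≤ b
  ℤ-lin₁ p = ℤ-by-diff (ℤP.i≤j⇒0≤j-i p)

  ∣∣≤⁻ : ∀ {z D} → ℤ.∣ z ∣ ≤ D → z ℤ.≤ + D × ℤ.- z ℤ.≤ + D
  ∣∣≤⁻ {+ zero} p = ℤ.+≤+ p , ℤ.+≤+ z≤n
  ∣∣≤⁻ {+ suc k} p = ℤ.+≤+ p , ℤ.-≤+
  ∣∣≤⁻ { -[1+ k ]} p = ℤ.-≤+ , ℤ.+≤+ p

  -- A superset of the x with lo ≤ d x ≤ lo + W. Rounding lo / d and rounding W / d each cost at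
  -- most one, whence the 2 in the length.
  multiplesIn : (d : ℕ) .{{_ : NonZero d}} → ℤ → ℕ → List ℤ
  multiplesIn d lo W = List.map (λ k → lo /ℕ d ℤ.+ + k) (upTo (2 + W / d))

  length-multiplesIn : ∀ d .{{_ : NonZero d}} lo W → length (multiplesIn d lo W) ≡ 2 + W / d
  length-multiplesIn d lo W = trans (length-map _ (upTo (2 + W / d))) (length-upTo (2 + W / d))

  ∈-multiplesIn : ∀ d .{{_ : NonZero d}} {lo W x} → lo ℤ.≤ + d ℤ.* x → + d ℤ.* x ℤ.≤ lo ℤ.+ + W → x ∈ᴸ multiplesIn d lo W
  ∈-multiplesIn d {lo} {W} {x} p q = subst (_∈ᴸ multiplesIn d lo W) x≡ (∈-map⁺ _ (∈-upTo⁺ {n = 2 + W / d} k<))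
    where
    x₀ = lo /ℕ d
    k = ℤ.∣ x ℤ.- x₀ ∣
    lo≡ : lo ≡ + (lo %ℕ d) ℤ.+ x₀ ℤ.* + d
    lo≡ = a≡a%ℕn+[a/ℕn]*n lo d
    x₀≤x : x₀ ℤ.≤ x
    x₀≤x = ℤP.*-cancelʳ-≤-pos x₀ x (+ d) {{ℤ.positive (ℤ.+<+ (ℕ.>-nonZero⁻¹ d))}}
      (ℤP.≤-trans (ℤP.≤-trans (ℤP.i≤j+i (x₀ ℤ.* + d) (+ (lo %ℕ d))) (ℤP.≤-reflexive (sym lo≡)))
        (ℤP.≤-trans p (ℤP.≤-reflexive (ℤP.*-comm (+ d) x))))
    k≡ : + k ≡ x ℤ.- x₀
    k≡ = ℤP.0≤i⇒+∣i∣≡i (ℤP.i≤j⇒0≤j-i x₀≤x)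
    x≡ : x₀ ℤ.+ + k ≡ x
    x≡ = trans (cong (λ z → x₀ ℤ.+ z) k≡) (lemma x₀ x)
      where
      lemma : ∀ a b → a ℤ.+ (b ℤ.- a) ≡ b
      lemma = ℤ-Solver.solve-∀
    kd≤ : + (k * d) ℤ.≤ + (lo %ℕ d + W)
    kd≤ = ℤ-lin₁ q (begin
      lo ℤ.+ + W ℤ.- + d ℤ.* x ≡⟨ cong (λ z → z ℤ.+ + W ℤ.- + d ℤ.* x) lo≡ ⟩
      + (lo %ℕ d) ℤ.+ x₀ ℤ.* + d ℤ.+ + W ℤ.- + d ℤ.* x ≡⟨ lemma (+ (lo %ℕ d)) x₀ (+ d) (+ W) x ⟩
      (+ (lo %ℕ d) ℤ.+ + W) ℤ.- (x ℤ.- x₀) ℤ.* + d ≡⟨ cong (λ z → (+ (lo %ℕ d) ℤ.+ + W) ℤ.- z ℤ.* + d) k≡ ⟨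
      + (lo %ℕ d + W) ℤ.- + k ℤ.* + d ≡⟨ cong (λ z → + (lo %ℕ d + W) ℤ.- z) (ℤP.pos-* k d) ⟨
      + (lo %ℕ d + W) ℤ.- + (k * d) ∎)
      where
      open ≡-Reasoning
      lemma : ∀ r a d w x → r ℤ.+ a ℤ.* d ℤ.+ w ℤ.- d ℤ.* x ≡ (r ℤ.+ w) ℤ.- (x ℤ.- a) ℤ.* d
      lemma = ℤ-Solver.solve-∀
    k< : k < 2 + W / d
    k< = *-cancelʳ-< d k (2 + W / d) (begin-strict
      k * d ≤⟨ ℤP.drop‿+≤+ kd≤ ⟩
      lo %ℕ d + W ≡⟨ cong (λ z → lo %ℕ d + z) (m≡m%n+[m/n]*n W d) ⟩
      lo %ℕ d + (W % d + W / d * d) <⟨ +-mono-<-≤ (n%ℕd<d lo d) (+-monoˡ-≤ _ (<⇒≤ (m%n<n W d))) ⟩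
      d + (d + W / d * d) ∎)
      where open ≤-Reasoning

  -- The w in [w₀ , w₀ + g] for which β + w q is within D of a multiple of M.
  module Hits (M : ℕ) .{{_ : NonZero M}} (D w₀ g : ℕ) where

    module _ (K : ℕ) .{{_ : NonZero K}} where

      quotients : ℤ → List ℤ
      quotients β = multiplesIn M (β ℤ.+ + (w₀ * K) ℤ.- + D) (g * K + (D + D))

      near : ℤ → ℤ → List ℕ
      near β p = List.map ℤ.∣_∣ (multiplesIn K (+ M ℤ.* p ℤ.- β ℤ.- + D) (D + D))

      hits⁺ : ℤ → List ℕ
      hits⁺ β = concatMap (near β) (quotients β)

      -- The first factor counts the multiples M p that β + w K can approach as w runs through its
      -- interval, the second the w that come within D of one of them.
      length-hits⁺ : ∀ β → length (hits⁺ β) ≤ (2 + (g * K + (D + D)) / M) * (2 + (D + D) / K)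
      length-hits⁺ β = ≤-trans (length-concatMap-≤ (near β) (quotients β) (λ p → ≤-reflexive (trans
          (length-map ℤ.∣_∣ (multiplesIn K (+ M ℤ.* p ℤ.- β ℤ.- + D) (D + D))) (length-multiplesIn K (+ M ℤ.* p ℤ.- β ℤ.- + D) (D + D)))))
        (≤-reflexive (cong (_* (2 + (D + D) / K)) (length-multiplesIn M (β ℤ.+ + (w₀ * K) ℤ.- + D) (g * K + (D + D)))))

      ∈-hits⁺ : ∀ {β w} p → w₀ ≤ w → w ≤ w₀ + g →
        ℤ.∣ β ℤ.+ + w ℤ.* + K ℤ.- + M ℤ.* p ∣ ≤ D → w ∈ᴸ hits⁺ β
      ∈-hits⁺ {β} {w} p w₀≤w w≤ close = concatMap-Any (near β)
          (λ { {p′} refl → ∈-map⁺ ℤ.∣_∣ {x = + w} (∈-multiplesIn K {+ M ℤ.* p ℤ.- β ℤ.- + D} {D + D} {+ w} w-lo w-hi) })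
          (∈-multiplesIn M {β ℤ.+ + (w₀ * K) ℤ.- + D} {g * K + (D + D)} {p} p-lo p-hi)
        where
        hi : β ℤ.+ + w ℤ.* + K ℤ.- + M ℤ.* p ℤ.≤ + D
        hi = proj₁ (∣∣≤⁻ close)
        lo : ℤ.- (β ℤ.+ + w ℤ.* + K ℤ.- + M ℤ.* p) ℤ.≤ + D
        lo = proj₂ (∣∣≤⁻ {β ℤ.+ + w ℤ.* + K ℤ.- + M ℤ.* p} close)
        w-lo : + M ℤ.* p ℤ.- β ℤ.- + D ℤ.≤ + K ℤ.* + w
        w-lo = ℤ-lin₁ lo (lemma β (+ w) (+ K) (+ M) p (+ D))
          where
          lemma : ∀ β w K M p D → D ℤ.- ℤ.- (β ℤ.+ w ℤ.* K ℤ.- M ℤ.* p) ≡ K ℤ.* w ℤ.- (M ℤ.* p ℤ.- β ℤ.- D)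
          lemma = ℤ-Solver.solve-∀
        w-hi : + K ℤ.* + w ℤ.≤ + M ℤ.* p ℤ.- β ℤ.- + D ℤ.+ (+ D ℤ.+ + D)
        w-hi = ℤ-lin₁ hi (lemma β (+ w) (+ K) (+ M) p (+ D))
          where
          lemma : ∀ β w K M p D → D ℤ.- (β ℤ.+ w ℤ.* K ℤ.- M ℤ.* p) ≡ M ℤ.* p ℤ.- β ℤ.- D ℤ.+ (D ℤ.+ D) ℤ.- K ℤ.* w
          lemma = ℤ-Solver.solve-∀
        wK≥ : + (w₀ * K) ℤ.≤ + w ℤ.* + K
        wK≥ = ℤP.≤-trans (ℤ.+≤+ (*-monoˡ-≤ K w₀≤w)) (ℤP.≤-reflexive (ℤP.pos-* w K))
        wK≤ : + w ℤ.* + K ℤ.≤ + (w₀ * K) ℤ.+ + (g * K)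
        wK≤ = ℤP.≤-trans (ℤP.≤-reflexive (sym (ℤP.pos-* w K)))
          (ℤ.+≤+ (≤-trans (*-monoˡ-≤ K w≤) (≤-reflexive (*-distribʳ-+ K w₀ g))))
        p-lo : β ℤ.+ + (w₀ * K) ℤ.- + D ℤ.≤ + M ℤ.* p
        p-lo = ℤ-lin₂ hi wK≥ (lemma β (+ w ℤ.* + K) (+ (w₀ * K)) (+ M ℤ.* p) (+ D))
          where
          lemma : ∀ β x y z D → (D ℤ.- (β ℤ.+ x ℤ.- z)) ℤ.+ (x ℤ.- y) ≡ z ℤ.- (β ℤ.+ y ℤ.- D)
          lemma = ℤ-Solver.solve-∀
        p-hi : + M ℤ.* p ℤ.≤ β ℤ.+ + (w₀ * K) ℤ.- + D ℤ.+ (+ (g * K) ℤ.+ (+ D ℤ.+ + D))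
        p-hi = ℤ-lin₂ lo wK≤ (lemma β (+ w ℤ.* + K) (+ (w₀ * K)) (+ M ℤ.* p) (+ D) (+ (g * K)))
          where
          lemma : ∀ β x y z D u → (D ℤ.- ℤ.- (β ℤ.+ x ℤ.- z)) ℤ.+ (y ℤ.+ u ℤ.- x) ≡ β ℤ.+ y ℤ.- D ℤ.+ (u ℤ.+ (D ℤ.+ D)) ℤ.- z
          lemma = ℤ-Solver.solve-∀

    -- Negation preserves the multiples of M, so a negative q reduces to |q| with β negated. For q =
    -- 0 the empty list is a mere default: the lemmas about `hits` assume q nonzero.
    hits : ℤ → ℤ → List ℕ
    hits (+ zero) β = []
    hits (+ suc K) β = hits⁺ (suc K) β
    hits -[1+ K ] β = hits⁺ (suc K) (ℤ.- β)

    length-hits : ∀ q β .{{_ : NonZero ℤ.∣ q ∣}} →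
      length (hits q β) ≤ (2 + (g * ℤ.∣ q ∣ + (D + D)) / M) * (2 + (D + D) / ℤ.∣ q ∣)
    length-hits (+ suc K) β = length-hits⁺ (suc K) β
    length-hits -[1+ K ] β = length-hits⁺ (suc K) (ℤ.- β)

    ∈-hits : ∀ q {β w} p .{{_ : NonZero ℤ.∣ q ∣}} → w₀ ≤ w → w ≤ w₀ + g →
      ℤ.∣ β ℤ.+ + w ℤ.* q ℤ.- + M ℤ.* p ∣ ≤ D → w ∈ᴸ hits q β
    ∈-hits (+ suc K) p = ∈-hits⁺ (suc K) p
    ∈-hits -[1+ K ] {β} {w} p w₀≤w w≤ close = ∈-hits⁺ (suc K) (ℤ.- p) w₀≤w w≤
      (≤-trans (≤-reflexive (trans (cong ℤ.∣_∣ (lemma β (+ w) (+ suc K) (+ M) p)) (ℤP.∣-i∣≡∣i∣ (β ℤ.+ + w ℤ.* -[1+ K ] ℤ.- + M ℤ.* p)))) close)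
      where
      lemma : ∀ β w K M p → ℤ.- β ℤ.+ w ℤ.* K ℤ.- M ℤ.* (ℤ.- p) ≡ ℤ.- (β ℤ.+ w ℤ.* (ℤ.- K) ℤ.- M ℤ.* p)
      lemma = ℤ-Solver.solve-∀

  -- The progression of step K over an interval of length s g meets about K / R multiples of R s g,
  -- and each is approached by about R g / K of its members: of order g hits in all as soon as K ≥
  -- R. The term 3 R keeps the bound valid for small K. The hypothesis 4 ≤ s absorbs the error D + D
  -- = 4 R g into one period R s g, and K ≤ g absorbs the rounding in the second factor.
  hits-bound : ∀ R s g K .{{_ : NonZero R}} .{{_ : NonZero (R * (s * g))}} .{{_ : NonZero K}} → 4 ≤ s → 1 ≤ g → K ≤ g →
    let D = 2 * (R * g) in
    (2 + (s * g * K + (D + D)) / (R * (s * g))) * (2 + (D + D) / K) * K ≤ 6 * g * (K + 3 * R)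
  hits-bound R s g K 4≤s 1≤g K≤g = *-cancelʳ-≤ _ _ R (begin
    (2 + x) * (2 + y) * K * R ≡⟨ regroup₁ x y K R ⟩
    (2 + x) * R * ((2 + y) * K) ≤⟨ *-mono-≤ x-bound y-bound ⟩
    (K + 3 * R) * (6 * (R * g)) ≡⟨ regroup₂ K R g ⟩
    6 * g * (K + 3 * R) * R ∎)
    where
    open ≤-Reasoning
    D = 2 * (R * g)
    x = (s * g * K + (D + D)) / (R * (s * g))
    y = (D + D) / K
    regroup₁ : ∀ x y K R → (2 + x) * (2 + y) * K * R ≡ (2 + x) * R * ((2 + y) * K)
    regroup₁ = ℕ-Solver.solve-∀
    regroup₂ : ∀ K R g → (K + 3 * R) * (6 * (R * g)) ≡ 6 * g * (K + 3 * R) * R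
    regroup₂ = ℕ-Solver.solve-∀
    instance
      sg≢0 : NonZero (s * g)
      sg≢0 = m*n≢0 s g {{ℕ.>-nonZero (≤-trans (s≤s z≤n) 4≤s)}} {{ℕ.>-nonZero 1≤g}}
    xR≤ : x * R ≤ K + R
    xR≤ = *-cancelʳ-≤ _ _ (s * g) (begin
      x * R * (s * g) ≡⟨ *-assoc x R (s * g) ⟩
      x * (R * (s * g)) ≤⟨ m/n*n≤m _ (R * (s * g)) ⟩
      s * g * K + (D + D) ≡⟨ eq₁ s g K R ⟩
      s * g * K + 4 * (R * g) ≤⟨ +-monoʳ-≤ (s * g * K) (*-monoˡ-≤ (R * g) 4≤s) ⟩
      s * g * K + s * (R * g) ≡⟨ eq₂ s g K R ⟩
      (K + R) * (s * g) ∎)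
      where
      eq₁ : ∀ s g K R → s * g * K + (2 * (R * g) + 2 * (R * g)) ≡ s * g * K + 4 * (R * g)
      eq₁ = ℕ-Solver.solve-∀
      eq₂ : ∀ s g K R → s * g * K + s * (R * g) ≡ (K + R) * (s * g)
      eq₂ = ℕ-Solver.solve-∀
    x-bound : (2 + x) * R ≤ K + 3 * R
    x-bound = begin
      (2 + x) * R ≡⟨ *-distribʳ-+ R 2 x ⟩
      2 * R + x * R ≤⟨ +-monoʳ-≤ (2 * R) xR≤ ⟩
      2 * R + (K + R) ≡⟨ eq K R ⟩
      K + 3 * R ∎
      where
      eq : ∀ K R → 2 * R + (K + R) ≡ K + 3 * R
      eq = ℕ-Solver.solve-∀
    y-bound : (2 + y) * K ≤ 6 * (R * g)
    y-bound = begin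
      (2 + y) * K ≡⟨ *-distribʳ-+ K 2 y ⟩
      2 * K + y * K ≤⟨ +-mono-≤ (*-monoʳ-≤ 2 (≤-trans K≤g (m≤n*m g R))) (m/n*n≤m (D + D) K) ⟩
      2 * (R * g) + (D + D) ≡⟨ eq (R * g) ⟩
      6 * (R * g) ∎
      where
      eq : ∀ x → 2 * x + (2 * x + 2 * x) ≡ 6 * x
      eq = ℕ-Solver.solve-∀

  -- Counting the grid matrices that nearly solve the inequality

  ^-distribʳ-* : ∀ d a b → (a * b) ^ d ≡ a ^ d * b ^ d
  ^-distribʳ-* zero a b = refl
  ^-distribʳ-* (suc d) a b = trans (cong (a * b *_) (^-distribʳ-* d a b)) ([m*n]*[o*p]≡[m*o]*[n*p] a b (a ^ d) (b ^ d))

  argmax : ∀ {n} (v : Fin (suc n) → ℤ) → ∃[ j ] (∀ i → ℤ.∣ v i ∣ ≤ ℤ.∣ v j ∣)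
  argmax {zero} v = zero , λ { zero → ≤-refl }
  argmax {suc n} v with argmax (v ∘ suc)
  ... | j , h with ≤-total ℤ.∣ v zero ∣ ℤ.∣ v (suc j) ∣
  ...   | inj₁ p = suc j , λ { zero → p ; (suc i) → h i }
  ...   | inj₂ p = zero , λ { zero → ≤-refl ; (suc i) → ≤-trans (h i) p }

  dot : ∀ {n} → (Fin n → ℕ) → (Fin n → ℤ) → ℤ
  dot {zero} w q = + 0
  dot {suc n} w q = + w zero ℤ.* q zero ℤ.+ dot (w ∘ suc) (q ∘ suc)

  dot-cong : ∀ {n} {w w′ : Fin n → ℕ} {q q′ : Fin n → ℤ} → (∀ i → w i ≡ w′ i) → (∀ i → q i ≡ q′ i) → dot w q ≡ dot w′ q′
  dot-cong {zero} _ _ = refl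
  dot-cong {suc n} e f = cong₂ ℤ._+_ (cong₂ (λ x y → + x ℤ.* y) (e zero) (f zero)) (dot-cong (e ∘ suc) (f ∘ suc))

  -- With the other entries of a row fixed, the linear form is an arithmetic progression in `w j`
  -- with step `q j`, which is the situation of `Hits`.
  dot-split : ∀ {n} (v w : Fin n → ℕ) q j → v j ≡ 0 → (∀ i → i ≢ j → v i ≡ w i) →
    dot w q ≡ dot v q ℤ.+ + w j ℤ.* q j
  dot-split v w q zero e h = trans (lemma (+ w zero) (q zero) (dot (w ∘ suc) (q ∘ suc)))
    (cong₂ (λ x y → + x ℤ.* q zero ℤ.+ y ℤ.+ + w zero ℤ.* q zero) (sym e) (dot-cong (λ i → sym (h (suc i) (λ ()))) (λ _ → refl)))
    where
    lemma : ∀ w q d → w ℤ.* q ℤ.+ d ≡ + 0 ℤ.* q ℤ.+ d ℤ.+ w ℤ.* q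
    lemma = ℤ-Solver.solve-∀
  dot-split v w q (suc j) e h = trans
    (cong₂ (λ x y → + x ℤ.* q zero ℤ.+ y) (sym (h zero (λ ()))) (dot-split (v ∘ suc) (w ∘ suc) (q ∘ suc) j e (λ i i≢j → h (suc i) (i≢j ∘ FinP.suc-injective))))
    (sym (ℤP.+-assoc (+ v zero ℤ.* q zero) _ _))

  interval : ℕ → ℕ → List ℕ
  interval a g = List.map (λ k → a + k) (upTo g)

  ∈-interval : ∀ {a g w} → a ≤ w → w < a + g → w ∈ᴸ interval a g
  ∈-interval {a} {g} {w} p q = subst (_∈ᴸ interval a g) (m+[n∸m]≡n p)
    (∈-map⁺ (λ k → a + k) (∈-upTo⁺ (+-cancelˡ-< a _ _ (subst (_< a + g) (sym (m+[n∸m]≡n p)) q))))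

  length-interval : ∀ a g → length (interval a g) ≡ g
  length-interval a g = trans (length-map (λ k → a + k) (upTo g)) (length-upTo g)

  -- A grid of mesh 1/R is refined to mesh 1/M, each side of a cell being cut into g pieces.
  -- Multiplied by M, the condition ⟨A q - γ⟩ ≤ 1/s asks for distance at most M / s = R g′ from a
  -- multiple of M. The factor 2 in D leaves room for rounding A and γ to the fine grid.
  module Survivors (m n R s g′ : ℕ) .{{_ : NonZero R}} .{{_ : NonZero s}} .{{_ : NonZero g′}} where

    g M D : ℕ
    g = s * g′
    M = R * g
    D = 2 * (R * g′)

    instance
      g≢0 : NonZero g
      g≢0 = m*n≢0 s g′
      M≢0 : NonZero M
      M≢0 = m*n≢0 R g

    module _ (q : Fin (suc n) → ℤ) (j : Fin (suc n)) (a : Fin (suc n) → ℕ) (b : ℤ) where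

      open Hits M D (a j * g) g

      -- The value 0 at j is a placeholder, overwritten in `column` by the entries that `hits`
      -- allows.
      others : Fin (suc n) → List ℕ
      others i with i FinP.≟ j
      ... | yes _ = 0 ∷ []
      ... | no _ = interval (a i * g) g

      column : (Fin (suc n) → ℕ) → List (Fin (suc n) → ℕ)
      column v = List.map (λ x → Vector.updateAt v j (const x)) (hits (q j) (dot v q ℤ.- b))

      rows : List (Fin (suc n) → ℕ)
      rows = concatMap column (choices others)

      length-rows : ∀ {N} .{{_ : NonZero ℤ.∣ q j ∣}} →
        (2 + (g * ℤ.∣ q j ∣ + (D + D)) / M) * (2 + (D + D) / ℤ.∣ q j ∣) ≤ N → length rows ≤ g ^ n * N
      length-rows {N} h = ≤-trans
        (length-concatMap-≤ column (choices others) (λ v → ≤-trans (≤-reflexive (length-map _ (hits (q j) (dot v q ℤ.- b))))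
          (≤-trans (length-hits (q j) (dot v q ℤ.- b)) h)))
        (*-monoˡ-≤ N (≤-trans (length-choices-at-≤ others j at-j away) (≤-reflexive (*-identityˡ (g ^ n)))))
        where
        at-j : length (others j) ≤ 1
        at-j with j FinP.≟ j
        ... | yes _ = ≤-refl
        ... | no ¬p = contradiction refl ¬p
        away : ∀ i → i ≢ j → length (others i) ≤ g
        away i i≢j with i FinP.≟ j
        ... | yes p = contradiction p i≢j
        ... | no _ = ≤-reflexive (length-interval (a i * g) g)

      rows-∋ : ∀ w p .{{_ : NonZero ℤ.∣ q j ∣}} → (∀ i → a i * g ≤ w i × w i < a i * g + g) →
        ℤ.∣ dot w q ℤ.- b ℤ.- + M ℤ.* p ∣ ≤ D → Any (λ v → ∀ i → v i ≡ w i) rows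
      rows-∋ w p cell close = concatMap-Any column in-column
          (choices-Any others (λ i x → (i ≡ j → x ≡ 0) × (i ≢ j → x ≡ w i)) fill)
        where
        fill : ∀ i → Any (λ x → (i ≡ j → x ≡ 0) × (i ≢ j → x ≡ w i)) (others i)
        fill i with i FinP.≟ j
        ... | yes i≡j = here ((λ _ → refl) , λ i≢j → contradiction i≡j i≢j)
        ... | no i≢j = Any.map (λ { refl → (λ i≡j → contradiction i≡j i≢j) , λ _ → refl })
                         (∈-interval (proj₁ (cell i)) (proj₂ (cell i)))
        in-column : ∀ {v} → (∀ i → (i ≡ j → v i ≡ 0) × (i ≢ j → v i ≡ w i)) → Any (λ v → ∀ i → v i ≡ w i) (column v)
        in-column {v} h = AnyP.map⁺ (Any.map set (∈-hits (q j) p (proj₁ (cell j)) (<⇒≤ (proj₂ (cell j)))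
            (subst (λ z → ℤ.∣ z ∣ ≤ D) (trans (cong (λ z → z ℤ.- b ℤ.- + M ℤ.* p)
                (dot-split v w q j (proj₁ (h j) refl) (λ i → proj₂ (h i))))
              (lemma (dot v q) (+ w j ℤ.* q j) b (+ M ℤ.* p))) close)))
          where
          lemma : ∀ d x b y → d ℤ.+ x ℤ.- b ℤ.- y ≡ d ℤ.- b ℤ.+ x ℤ.- y
          lemma = ℤ-Solver.solve-∀
          set : ∀ {x} → w j ≡ x → ∀ i → Vector.updateAt v j (const x) i ≡ w i
          set {x} e i with i FinP.≟ j
          ... | yes refl = trans (updateAt-updates j v) (sym e)
          ... | no i≢j = trans (updateAt-minimal i j v i≢j) (proj₂ (h i) i≢j)

    module _ (a : Fin m → Fin (suc n) → ℕ) (b : Fin m → ℤ) where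

      -- The sup norm, written through `argmax` because the same coordinate is the one for which
      -- `matrices` solves.
      ‖_‖ : (Fin (suc n) → ℤ) → ℕ
      ‖ q ‖ = ℤ.∣ q (proj₁ (argmax q)) ∣

      matrices : (Fin (suc n) → ℤ) → List (Fin m → Fin (suc n) → ℕ)
      matrices q = choices (λ i → rows q (proj₁ (argmax q)) (a i) (b i))

      -- `pool` enumerates a whole box of q. Those of norm below L must contribute nothing, because
      -- the number of hits is badly bounded for small norms; those above g′ are outside the reach
      -- of `hits-bound`.
      candidates : ℕ → (Fin (suc n) → ℤ) → List (Fin m → Fin (suc n) → ℕ)
      candidates L q with L ≤? ‖ q ‖ | ‖ q ‖ ≤? g′
      ... | yes _ | yes _ = matrices q
      ... | _ | _ = []

      length-candidates : ∀ L N q → (∀ K .{{_ : NonZero K}} → L ≤ K → K ≤ g′ →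
        (2 + (g * K + (D + D)) / M) * (2 + (D + D) / K) ≤ N) → 1 ≤ L → length (candidates L q) ≤ (g ^ n * N) ^ m
      length-candidates L N q h 1≤L with L ≤? ‖ q ‖ | ‖ q ‖ ≤? g′
      ... | no _ | _ = z≤n
      ... | yes _ | no _ = z≤n
      ... | yes p | yes p′ = length-choices-≤ _ (λ i → length-rows q (proj₁ (argmax q)) (a i) (b i) {{nz}} (h ‖ q ‖ {{nz}} p p′))
        where
        nz : NonZero ‖ q ‖
        nz = ℕ.>-nonZero (≤-trans 1≤L p)

      pool : ℕ → ℕ → List (Fin m → Fin (suc n) → ℕ)
      pool L X = concatMap (candidates L) (choices (λ _ → intRange X))

      Close : (Fin (suc n) → ℤ) → (Fin m → Fin (suc n) → ℕ) → Set
      Close q w = ∀ i → ∃[ p ] ℤ.∣ dot (w i) q ℤ.- b i ℤ.- + M ℤ.* p ∣ ≤ D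

      module _ (w : Fin m → Fin (suc n) → ℕ) (cell : ∀ i j → a i j * g ≤ w i j × w i j < a i j * g + g) where

        candidates-∋ : ∀ L q → 1 ≤ L → L ≤ ‖ q ‖ → ‖ q ‖ ≤ g′ → Close q w →
          Any (λ v → ∀ i j → v i j ≡ w i j) (candidates L q)
        candidates-∋ L q 1≤L p p′ close with L ≤? ‖ q ‖ | ‖ q ‖ ≤? g′
        ... | no ¬p | _ = contradiction p ¬p
        ... | yes _ | no ¬p = contradiction p′ ¬p
        ... | yes _ | yes _ = choices-Any (λ i → rows q (proj₁ (argmax q)) (a i) (b i)) (λ i v → ∀ j → v j ≡ w i j)
                (λ i → rows-∋ q (proj₁ (argmax q)) (a i) (b i) (w i) (proj₁ (close i))
                         {{ℕ.>-nonZero (≤-trans 1≤L p)}} (cell i) (proj₂ (close i)))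

        pool-∋ : ∀ L X q → 1 ≤ L → X ≤ g′ → L ≤ ‖ q ‖ → ‖ q ‖ ≤ X → Close q w →
          Any (λ v → ∀ i j → v i j ≡ w i j) (pool L X)
        pool-∋ L X q 1≤L X≤ lo hi close = concatMap-Any (candidates L) transfer
          (choices-Any (λ _ → intRange X) (λ i x → q i ≡ x) (λ i → ∈-intRange (≤-trans (proj₂ (argmax q) i) hi)))
          where
          -- The enumerated v agrees with q only pointwise, so norm and closeness have to be carried
          -- over by hand.
          transfer : ∀ {v} → (∀ i → q i ≡ v i) → Any (λ v → ∀ i j → v i j ≡ w i j) (candidates L v)
          transfer {v} e = candidates-∋ L v 1≤L (subst (L ≤_) same lo) (subst (_≤ g′) same (≤-trans hi X≤))
            (λ i → proj₁ (close i) , subst (λ z → ℤ.∣ z ℤ.- b i ℤ.- + M ℤ.* proj₁ (close i) ∣ ≤ D)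
                                       (dot-cong {w = w i} (λ _ → refl) e) (proj₂ (close i)))
            where
            same : ‖ q ‖ ≡ ‖ v ‖
            same = ≤-antisym
              (≤-trans (≤-reflexive (cong ℤ.∣_∣ (e _))) (proj₂ (argmax v) (proj₁ (argmax q))))
              (≤-trans (≤-reflexive (cong ℤ.∣_∣ (sym (e _)))) (proj₂ (argmax q) (proj₁ (argmax v))))

      -- The large q are many, but each is close on few cells; the small q are few.
      survivors : ℕ → List (Fin m → Fin (suc n) → ℕ)
      survivors h = pool R (2 * h) ++ pool 1 R

      survivors-∋ : ∀ h w q → 2 * h ≤ g′ → R ≤ g′ → (∀ i j → a i j * g ≤ w i j × w i j < a i j * g + g) →
        1 ≤ ‖ q ‖ → ‖ q ‖ ≤ 2 * h → Close q w → Any (λ v → ∀ i j → v i j ≡ w i j) (survivors h)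
      survivors-∋ h w q 2h≤ R≤ cell lo hi close with R ≤? ‖ q ‖
      ... | yes p = AnyP.++⁺ˡ (pool-∋ w cell R (2 * h) q (ℕ.>-nonZero⁻¹ R) 2h≤ p hi close)
      ... | no ¬p = AnyP.++⁺ʳ (pool R (2 * h)) (pool-∋ w cell 1 R q ≤-refl R≤ lo (<⇒≤ (≰⇒> ¬p)) close)

      window-bound : 4 ≤ s → ∀ c K .{{_ : NonZero K}} → K ≤ g′ → K + 3 * R ≤ 4 * c * K →
        (2 + (g * K + (D + D)) / M) * (2 + (D + D) / K) ≤ 24 * g′ * c
      window-bound 4≤s c K K≤ h = *-cancelʳ-≤ _ _ K (begin
        _ ≤⟨ hits-bound R s g′ K 4≤s (ℕ.>-nonZero⁻¹ g′) K≤ ⟩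
        6 * g′ * (K + 3 * R) ≤⟨ *-monoʳ-≤ (6 * g′) h ⟩
        6 * g′ * (4 * c * K) ≡⟨ lemma g′ c K ⟩
        24 * g′ * c * K ∎)
        where
        open ≤-Reasoning
        lemma : ∀ g c K → 6 * g * (4 * c * K) ≡ 24 * g * c * K
        lemma = ℕ-Solver.solve-∀

      length-pool : ∀ L X c → 4 ≤ s → 1 ≤ L → (∀ K .{{_ : NonZero K}} → L ≤ K → K + 3 * R ≤ 4 * c * K) →
        length (pool L X) ≤ suc (X + X) ^ suc n * ((24 * c) ^ m * (g ^ n * g′) ^ m)
      length-pool L X c 4≤s 1≤L h = ≤-trans
        (length-concatMap-≤ (candidates L) (choices (λ _ → intRange X))
          (λ q → length-candidates L (24 * g′ * c) q (λ K L≤K K≤ → window-bound 4≤s c K K≤ (h K L≤K)) 1≤L))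
        (*-mono-≤ (length-choices-≤ {n = suc n} (λ _ → intRange X) (λ _ → ≤-reflexive (length-intRange X)))
          (≤-reflexive (trans (cong (_^ m) (lemma (g ^ n) g′ c)) (^-distribʳ-* m (24 * c) (g ^ n * g′)))))
        where
        lemma : ∀ x g c → x * (24 * g * c) ≡ 24 * c * (x * g)
        lemma = ℕ-Solver.solve-∀

      -- A cell contains s^m u grid matrices, with u as below. Each of the last two hypotheses
      -- limits one of the two pools to a quarter of them.
      length-survivors : ∀ h → 4 ≤ s → 1 ≤ h →
        4 * (5 * h) ^ suc n * 24 ^ m ≤ s ^ m → 4 * (3 * R) ^ suc n * (24 * R) ^ m ≤ s ^ m →
        2 * length (survivors h) ≤ (g ^ suc n) ^ m
      length-survivors h 4≤s 1≤h big small = begin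
        2 * length (survivors h) ≡⟨ cong (2 *_) (length-++ (pool R (2 * h))) ⟩
        2 * (length (pool R (2 * h)) + length (pool 1 R)) ≤⟨ *-monoʳ-≤ 2 (+-mono-≤
              (length-pool R (2 * h) 1 4≤s (ℕ.>-nonZero⁻¹ R) (λ K R≤K → ≤-trans (+-monoʳ-≤ K (*-monoʳ-≤ 3 R≤K)) (≤-reflexive (eq₁ K))))
              (length-pool 1 R R 4≤s ≤-refl (λ K _ → ≤-trans (+-mono-≤ (m≤n*m K R) (*-monoʳ-≤ 3 (m≤m*n R K))) (≤-reflexive (eq₂ K R))))) ⟩
        2 * (suc (2 * h + 2 * h) ^ suc n * (24 ^ m * u) + suc (R + R) ^ suc n * ((24 * R) ^ m * u))
          ≤⟨ *-monoʳ-≤ 2 (+-mono-≤ (*-monoˡ-≤ (24 ^ m * u) (^-monoˡ-≤ (suc n) h-bound)) (*-monoˡ-≤ ((24 * R) ^ m * u) (^-monoˡ-≤ (suc n) R-bound))) ⟩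
        2 * ((5 * h) ^ suc n * (24 ^ m * u) + (3 * R) ^ suc n * ((24 * R) ^ m * u))
          ≤⟨ *-cancelˡ-≤ 2 (begin
            2 * (2 * ((5 * h) ^ suc n * (24 ^ m * u) + (3 * R) ^ suc n * ((24 * R) ^ m * u)))
              ≡⟨ eq₃ ((5 * h) ^ suc n) (24 ^ m) ((3 * R) ^ suc n) ((24 * R) ^ m) u ⟩
            (4 * (5 * h) ^ suc n * 24 ^ m) * u + (4 * (3 * R) ^ suc n * (24 * R) ^ m) * u
              ≤⟨ +-mono-≤ (*-monoˡ-≤ u big) (*-monoˡ-≤ u small) ⟩
            s ^ m * u + s ^ m * u
              ≡⟨ n+n≡2*n (s ^ m * u) ⟩
            2 * (s ^ m * u) ∎) ⟩
        s ^ m * u ≡⟨ ^-distribʳ-* m s (g ^ n * g′) ⟨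
        (s * (g ^ n * g′)) ^ m ≡⟨ cong (_^ m) (eq₄ s (g ^ n) g′) ⟩
        (g ^ suc n) ^ m ∎
        where
        open ≤-Reasoning
        u = (g ^ n * g′) ^ m
        eq₁ : ∀ K → K + 3 * K ≡ 4 * 1 * K
        eq₁ = ℕ-Solver.solve-∀
        eq₂ : ∀ K R → R * K + 3 * (R * K) ≡ 4 * R * K
        eq₂ = ℕ-Solver.solve-∀
        eq₃ : ∀ a b c d u → 2 * (2 * (a * (b * u) + c * (d * u))) ≡ (4 * a * b) * u + (4 * c * d) * u
        eq₃ = ℕ-Solver.solve-∀
        eq₄ : ∀ s x g → s * (x * g) ≡ (s * g) * x
        eq₄ = ℕ-Solver.solve-∀
        h-bound : suc (2 * h + 2 * h) ≤ 5 * h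
        h-bound = ≤-trans (+-monoˡ-≤ (2 * h + 2 * h) 1≤h) (≤-reflexive (eq h))
          where
          eq : ∀ h → h + (2 * h + 2 * h) ≡ 5 * h
          eq = ℕ-Solver.solve-∀
        R-bound : suc (R + R) ≤ 3 * R
        R-bound = ≤-trans (+-monoˡ-≤ (R + R) (ℕ.>-nonZero⁻¹ R)) (≤-reflexive (eq R))
          where
          eq : ∀ R → R + (R + R) ≡ 3 * R
          eq = ℕ-Solver.solve-∀

-- Arithmetic, order, integer parts and absolute values in the reals

module OrderedField (em : ExcludedMiddle 0ℓ) (R : RealNumbers) where

  open RealNumbers R hiding (zero)
  open IsTotalOrder isTotalOrder using () renaming
    (refl to ≤-refl; trans to ≤-trans; antisym to ≤-antisym; total to ≤-total; reflexive to ≤-reflexive)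
  open Max totalOrder using (x≤x⊔y; x≤y⊔x; ⊔-lub)
  open Algebra.Properties.Ring ring using (-0#≈0#; -‿distribˡ-*; -‿distribʳ-*; -‿involutive; -‿+-comm)
  open Algebra.Properties.Semiring.Mult semiring using (×-homo-+; ×1-homo-*)

  module ≈-R = Relation.Binary.Reasoning.Setoid setoid
  module ≤-R = Relation.Binary.Reasoning.PartialOrder (TotalOrder.poset totalOrder)

  -- Existence being a Σ-type, this also provides choice functions.
  by-contra : {P : Set} → ¬ ¬ P → P
  by-contra {P} ¬¬p with em {P}
  ... | yes p = p
  ... | no ¬p = ⊥-elim (¬¬p ¬p)

  ¬∀⇒∃ : {A : Set} {P : A → Set} → ¬ (∀ x → P x) → ∃[ x ] ¬ P x
  ¬∀⇒∃ ¬∀ = by-contra λ ¬∃ → ¬∀ λ x → by-contra λ ¬p → ¬∃ (x , ¬p)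

  fromℕ-+ : ∀ a b → fromℕ (a ℕ.+ b) ≈ fromℕ a + fromℕ b
  fromℕ-+ = ×-homo-+ 1#

  fromℕ-* : ∀ a b → fromℕ (a ℕ.* b) ≈ fromℕ a * fromℕ b
  fromℕ-* = ×1-homo-*

  fromℕ-1 : fromℕ 1 ≈ 1#
  fromℕ-1 = +-identityʳ 1#

  fromℕ-^ : ∀ a k → fromℕ (a ℕ.^ k) ≈ fromℕ a ^ k
  fromℕ-^ a zero = fromℕ-1
  fromℕ-^ a (suc k) = trans (fromℕ-* a (a ℕ.^ k)) (*-congˡ (fromℕ-^ a k))

  fromℤ-cong : ∀ {i j} → i ≡ j → fromℤ i ≈ fromℤ j
  fromℤ-cong ≡.refl = refl

  fromℤ-⊖ : ∀ a b → fromℤ (a ℤ.⊖ b) ≈ fromℕ a - fromℕ b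
  fromℤ-⊖ zero zero = sym (-‿inverseʳ 0#)
  fromℤ-⊖ zero (suc b) = sym (+-identityˡ _)
  fromℤ-⊖ (suc a) zero = sym (trans (+-congˡ -0#≈0#) (+-identityʳ _))
  fromℤ-⊖ (suc a) (suc b) = begin
    fromℤ (suc a ℤ.⊖ suc b) ≈⟨ fromℤ-cong (ℤP.[1+m]⊖[1+n]≡m⊖n a b) ⟩
    fromℤ (a ℤ.⊖ b) ≈⟨ fromℤ-⊖ a b ⟩
    fromℕ a - fromℕ b ≈⟨ +-identityˡ _ ⟨
    0# + (fromℕ a - fromℕ b) ≈⟨ +-congʳ (-‿inverseʳ 1#) ⟨
    (1# - 1#) + (fromℕ a - fromℕ b) ≈⟨ +-assoc 1# (- 1#) _ ⟩
    1# + (- 1# + (fromℕ a - fromℕ b)) ≈⟨ +-congˡ (+-assoc _ _ _) ⟨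
    1# + (- 1# + fromℕ a - fromℕ b) ≈⟨ +-congˡ (+-congʳ (+-comm _ _)) ⟩
    1# + (fromℕ a - 1# - fromℕ b) ≈⟨ +-congˡ (+-assoc _ _ _) ⟩
    1# + (fromℕ a + (- 1# - fromℕ b)) ≈⟨ +-assoc _ _ _ ⟨
    (1# + fromℕ a) + (- 1# - fromℕ b) ≈⟨ +-congˡ (-‿+-comm _ _) ⟩
    (1# + fromℕ a) - (1# + fromℕ b) ∎
    where open ≈-R

  fromℤ-neg : ∀ i → fromℤ (ℤ.- i) ≈ - fromℤ i
  fromℤ-neg (+ zero)  = sym -0#≈0#
  fromℤ-neg (+ suc a) = refl
  fromℤ-neg -[1+ a ]  = sym (-‿involutive _)

  fromℤ-+ : ∀ i j → fromℤ (i ℤ.+ j) ≈ fromℤ i + fromℤ j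
  fromℤ-+ (+ a) (+ b) = fromℕ-+ a b
  fromℤ-+ (+ a) -[1+ b ] = fromℤ-⊖ a (suc b)
  fromℤ-+ -[1+ a ] (+ b) = trans (fromℤ-⊖ b (suc a)) (+-comm _ _)
  fromℤ-+ -[1+ a ] -[1+ b ] = begin
    - fromℕ (suc (suc (a ℕ.+ b))) ≡⟨ ≡.cong (λ k → - fromℕ k) (≡.sym (ℕP.+-suc (suc a) b)) ⟩
    - fromℕ (suc a ℕ.+ suc b) ≈⟨ -‿cong (fromℕ-+ (suc a) (suc b)) ⟩
    - (fromℕ (suc a) + fromℕ (suc b)) ≈⟨ -‿+-comm _ _ ⟨
    - fromℕ (suc a) - fromℕ (suc b) ∎
    where open ≈-R

  fromℤ-*⁺ : ∀ a j → fromℤ (+ a ℤ.* j) ≈ fromℕ a * fromℤ j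
  fromℤ-*⁺ a (+ b) = trans (fromℤ-cong (≡.sym (ℤP.pos-* a b))) (fromℕ-* a b)
  fromℤ-*⁺ a -[1+ b ] = begin
    fromℤ (+ a ℤ.* ℤ.- (+ suc b)) ≈⟨ fromℤ-cong (ℤP.neg-distribʳ-* (+ a) (+ suc b)) ⟨
    fromℤ (ℤ.- (+ a ℤ.* + suc b)) ≈⟨ fromℤ-neg (+ a ℤ.* + suc b) ⟩
    - fromℤ (+ a ℤ.* + suc b) ≈⟨ -‿cong (fromℤ-*⁺ a (+ suc b)) ⟩
    - (fromℕ a * fromℕ (suc b)) ≈⟨ -‿distribʳ-* _ _ ⟩
    fromℕ a * - fromℕ (suc b) ∎
    where open ≈-R

  fromℤ-* : ∀ i j → fromℤ (i ℤ.* j) ≈ fromℤ i * fromℤ j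
  fromℤ-* (+ a) j = fromℤ-*⁺ a j
  fromℤ-* -[1+ a ] j = begin
    fromℤ (ℤ.- (+ suc a) ℤ.* j) ≈⟨ fromℤ-cong (ℤP.neg-distribˡ-* (+ suc a) j) ⟨
    fromℤ (ℤ.- (+ suc a ℤ.* j)) ≈⟨ fromℤ-neg (+ suc a ℤ.* j) ⟩
    - fromℤ (+ suc a ℤ.* j) ≈⟨ -‿cong (fromℤ-*⁺ (suc a) j) ⟩
    - (fromℕ (suc a) * fromℤ j) ≈⟨ -‿distribˡ-* _ _ ⟩
    - fromℕ (suc a) * fromℤ j ∎
    where open ≈-R

  -- fromℤ up to _≈_, arranged so that the literal 1 denotes 1# itself.
  coeff⁺ : ℕ → ℝ
  coeff⁺ zero          = 0#
  coeff⁺ (suc zero)    = 1#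
  coeff⁺ (suc (suc k)) = fromℕ (suc (suc k))

  coeff : ℤ → ℝ
  coeff (+ k)    = coeff⁺ k
  coeff -[1+ k ] = - coeff⁺ (suc k)

  coeff≈fromℤ : ∀ i → coeff i ≈ fromℤ i
  coeff≈fromℤ (+ zero)         = refl
  coeff≈fromℤ (+ suc zero)     = sym fromℕ-1
  coeff≈fromℤ (+ suc (suc k))  = refl
  coeff≈fromℤ -[1+ zero ]      = -‿cong (sym fromℕ-1)
  coeff≈fromℤ -[1+ suc k ]     = refl

  ℤ⟶ℝ : ℤ.+-*-rawRing -Raw-AlmostCommutative⟶ fromCommutativeRing commutativeRing
  ℤ⟶ℝ = record
    { ⟦_⟧ = coeff
    ; +-homo = λ i j → trans (coeff≈fromℤ (i ℤ.+ j))
        (trans (fromℤ-+ i j) (sym (+-cong (coeff≈fromℤ i) (coeff≈fromℤ j))))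
    ; *-homo = λ i j → trans (coeff≈fromℤ (i ℤ.* j))
        (trans (fromℤ-* i j) (sym (*-cong (coeff≈fromℤ i) (coeff≈fromℤ j))))
    ; -‿homo = λ i → trans (coeff≈fromℤ (ℤ.- i))
        (trans (fromℤ-neg i) (sym (-‿cong (coeff≈fromℤ i))))
    ; 0-homo = refl
    ; 1-homo = refl
    }

  coeff≟ : ∀ i j → Maybe (coeff i ≈ coeff j)
  coeff≟ i j = Maybe.map (λ { ≡.refl → refl }) (dec⇒maybe (i ℤP.≟ j))

  open Algebra.Solver.Ring ℤ.+-*-rawRing (fromCommutativeRing commutativeRing) ℤ⟶ℝ coeff≟
    using (solve; _:=_; _:+_; _:*_; _:-_; :-_; con) public

  x+x≈2x : ∀ x → x + x ≈ fromℕ 2 * x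
  x+x≈2x = solve 1 (λ x → x :+ x := con (+ 2) :* x) refl

  by-diff : ∀ {d x y} → 0# ≤ d → d ≈ y - x → x ≤ y
  by-diff {d} {x} {y} 0≤d eq = begin
    x ≈⟨ +-identityʳ x ⟨
    x + 0# ≤⟨ +-monoʳ-≤ x 0≤d ⟩
    x + d ≈⟨ +-congˡ eq ⟩
    x + (y - x) ≈⟨ solve 2 (λ x y → x :+ (y :- x) := y) refl x y ⟩
    y ∎
    where open ≤-R

  diff : ∀ {x y} → x ≤ y → 0# ≤ y - x
  diff {x} {y} x≤y = begin
    0# ≈⟨ -‿inverseˡ x ⟨
    - x + x ≤⟨ +-monoʳ-≤ (- x) x≤y ⟩
    - x + y ≈⟨ +-comm _ _ ⟩
    y - x ∎
    where open ≤-R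

  +-mono-≤ : ∀ {x y u v} → x ≤ y → u ≤ v → x + u ≤ y + v
  +-mono-≤ {x} {y} {u} {v} p q = ≤-trans (+-monoʳ-≤ x q)
    (≤-trans (≤-reflexive (+-comm _ _)) (≤-trans (+-monoʳ-≤ v p) (≤-reflexive (+-comm _ _))))

  +-nonNeg : ∀ {x y} → 0# ≤ x → 0# ≤ y → 0# ≤ x + y
  +-nonNeg p q = ≤-trans (≤-reflexive (sym (+-identityʳ 0#))) (+-mono-≤ p q)

  -- The certificate style of linear arithmetic: the conclusion follows since
  -- its difference is the sum of the differences of the hypotheses.
  lin₂ : ∀ {x y u v a b} → x ≤ y → u ≤ v → (y - x) + (v - u) ≈ b - a → a ≤ b
  lin₂ p q = by-diff (+-nonNeg (diff p) (diff q))

  lin₃ : ∀ {x y u v s t a b} → x ≤ y → u ≤ v → s ≤ t → (y - x) + (v - u) + (t - s) ≈ b - a → a ≤ b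
  lin₃ p q r = by-diff (+-nonNeg (+-nonNeg (diff p) (diff q)) (diff r))

  lin₁ : ∀ {x y a b} → x ≤ y → y - x ≈ b - a → a ≤ b
  lin₁ p = by-diff (diff p)

  ≤-respʳ : ∀ {x y z} → y ≈ z → x ≤ y → x ≤ z
  ≤-respʳ e p = ≤-trans p (≤-reflexive e)

  ≤-respˡ : ∀ {x y z} → x ≈ y → x ≤ z → y ≤ z
  ≤-respˡ e p = ≤-trans (≤-reflexive (sym e)) p

  -‿mono-≤ : ∀ {x y} → x ≤ y → - y ≤ - x
  -‿mono-≤ {x} {y} p = lin₁ p (solve 2 (λ x y → y :- x := (:- x) :- (:- y)) refl x y)

  *-monoˡ-≤ : ∀ {c x y} → 0# ≤ c → x ≤ y → c * x ≤ c * y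
  *-monoˡ-≤ {c} {x} {y} 0≤c p = by-diff (*-nonNeg 0≤c (diff p))
    (solve 3 (λ c x y → c :* (y :- x) := c :* y :- c :* x) refl c x y)

  *-monoʳ-≤ : ∀ {c x y} → 0# ≤ c → x ≤ y → x * c ≤ y * c
  *-monoʳ-≤ {c} {x} {y} 0≤c p = ≤-respˡ (*-comm c x) (≤-respʳ (*-comm c y) (*-monoˡ-≤ 0≤c p))

  *-mono-≤ : ∀ {x y u v} → 0# ≤ x → 0# ≤ v → x ≤ y → u ≤ v → x * u ≤ y * v
  *-mono-≤ {x} {y} {u} {v} 0≤x 0≤v p q = by-diff
    (+-nonNeg (*-nonNeg 0≤v (diff p)) (*-nonNeg 0≤x (diff q)))
    (solve 4 (λ x y u v → v :* (y :- x) :+ x :* (v :- u) := y :* v :- x :* u) refl x y u v)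

  0≤1 : 0# ≤ 1#
  0≤1 with ≤-total 0# 1#
  ... | inj₁ p = p
  ... | inj₂ q = ≤-respʳ (solve 0 (:- con (+ 1) :* :- con (+ 1) := con (+ 1)) refl) (*-nonNeg 0≤-1 0≤-1)
    where
    0≤-1 : 0# ≤ - 1#
    0≤-1 = ≤-respˡ -0#≈0# (-‿mono-≤ q)

  1≰0 : ¬ 1# ≤ 0#
  1≰0 p = 0≉1 (≤-antisym 0≤1 p)

  ≰⇒< : ∀ {x y} → ¬ x ≤ y → y < x
  ≰⇒< {x} {y} ¬p with ≤-total x y
  ... | inj₁ p = ⊥-elim (¬p p)
  ... | inj₂ q = q , λ e → ¬p (≤-reflexive (sym e))

  <⇒≱ : ∀ {x y} → x < y → ¬ y ≤ x
  <⇒≱ (p , ne) q = ne (≤-antisym p q)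

  ≤-or-< : ∀ x y → x ≤ y ⊎ y < x
  ≤-or-< x y with em {x ≤ y}
  ... | yes p = inj₁ p
  ... | no ¬p = inj₂ (≰⇒< ¬p)

  0<1 : 0# < 1#
  0<1 = 0≤1 , 0≉1

  <-≤-trans : ∀ {x y z} → x < y → y ≤ z → x < z
  <-≤-trans p q = ≤-trans (proj₁ p) q , λ e → <⇒≱ p (≤-respʳ (sym e) q)

  ≤-<-trans : ∀ {x y z} → x ≤ y → y < z → x < z
  ≤-<-trans p q = ≤-trans p (proj₁ q) , λ e → <⇒≱ q (≤-respˡ e p)

  -- The order axioms give only nonnegativity. If x y were 0, multiplying by the inverse of x would
  -- give y = 0.
  *-pos : ∀ {x y} → 0# < x → 0# < y → 0# < x * y
  *-pos {x} {y} (p , ne) q with inverse x (λ e → ne (sym e))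
  ... | x⁻¹ , e = *-nonNeg p (proj₁ q) , λ 0≈xy → proj₂ q (begin
    0# ≈⟨ zeroˡ x⁻¹ ⟨
    0# * x⁻¹ ≈⟨ *-congʳ 0≈xy ⟩
    (x * y) * x⁻¹ ≈⟨ solve 3 (λ x y z → x :* y :* z := x :* z :* y) refl x y x⁻¹ ⟩
    (x * x⁻¹) * y ≈⟨ *-congʳ e ⟩
    1# * y ≈⟨ *-identityˡ y ⟩
    y ∎)
    where open ≈-R

  *-cancelˡ-≤ : ∀ {c x y} → 0# < c → c * x ≤ c * y → x ≤ y
  *-cancelˡ-≤ {c} {x} {y} 0<c p with ≤-or-< x y
  ... | inj₁ q = q
  ... | inj₂ q = ⊥-elim (<⇒≱ (*-pos 0<c (proj₁ 0<x-y , proj₂ 0<x-y))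
    (lin₁ p (solve 3 (λ c x y → c :* y :- c :* x := con (+ 0) :- c :* (x :- y)) refl c x y)))
    where
    0<x-y : 0# < x - y
    0<x-y = diff (proj₁ q) , λ e → <⇒≱ q (lin₁ (≤-reflexive (sym e))
      (solve 2 (λ x y → con (+ 0) :- (x :- y) := y :- x) refl x y))

  abstract
    recip : ∀ {x} → 0# < x → ∃[ y ] (x * y ≈ 1# × 0# < y)
    recip {x} (p , ne) with inverse x (λ e → ne (sym e))
    ... | y , e = y , e , ≰⇒< λ y≤0 → 1≰0 (begin
      1# ≈⟨ e ⟨
      x * y ≤⟨ *-monoˡ-≤ p y≤0 ⟩
      x * 0# ≈⟨ zeroʳ x ⟩
      0# ∎)
      where open ≤-R

  fromℕ-nonNeg : ∀ a → 0# ≤ fromℕ a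
  fromℕ-nonNeg zero = ≤-refl
  fromℕ-nonNeg (suc a) = +-nonNeg 0≤1 (fromℕ-nonNeg a)

  fromℕ-mono : ∀ {a b} → a ℕ.≤ b → fromℕ a ≤ fromℕ b
  fromℕ-mono {b = b} ℕ.z≤n = fromℕ-nonNeg b
  fromℕ-mono (ℕ.s≤s p) = +-monoʳ-≤ 1# (fromℕ-mono p)

  fromℕ-pos : ∀ {a} → 1 ℕ.≤ a → 0# < fromℕ a
  fromℕ-pos p = <-≤-trans 0<1 (≤-respˡ fromℕ-1 (fromℕ-mono p))

  fromℕ-cancel-≤ : ∀ {a b} → fromℕ a ≤ fromℕ b → a ℕ.≤ b
  fromℕ-cancel-≤ {a} {b} p with a ℕP.≤? b
  ... | yes q = q
  ... | no ¬q = ⊥-elim (1≰0 (lin₂ (fromℕ-mono (ℕP.≰⇒> ¬q)) p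
    (solve 2 (λ a b → (a :- (con (+ 1) :+ b)) :+ (b :- a) := con (+ 0) :- con (+ 1)) refl (fromℕ a) (fromℕ b))))

  fromℤ-mono : ∀ {i j} → i ℤ.≤ j → fromℤ i ≤ fromℤ j
  fromℤ-mono {i} {j} p with j ℤ.- i in eq | ℤP.i≤j⇒0≤j-i p
  ... | + k | _ = by-diff (fromℕ-nonNeg k) (begin
    fromℕ k ≡⟨ ≡.cong fromℤ (≡.sym eq) ⟩
    fromℤ (j ℤ.- i) ≈⟨ fromℤ-+ j (ℤ.- i) ⟩
    fromℤ j + fromℤ (ℤ.- i) ≈⟨ +-congˡ (fromℤ-neg i) ⟩
    fromℤ j - fromℤ i ∎)
    where open ≈-R

  ^-nonNeg : ∀ {x} k → 0# ≤ x → 0# ≤ x ^ k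
  ^-nonNeg zero _ = 0≤1
  ^-nonNeg (suc k) p = *-nonNeg p (^-nonNeg k p)

  ^-pos : ∀ {x} k → 0# < x → 0# < x ^ k
  ^-pos zero _ = 0<1
  ^-pos (suc k) p = *-pos p (^-pos k p)

  ^-mono-≤ : ∀ {x y} k → 0# ≤ x → x ≤ y → x ^ k ≤ y ^ k
  ^-mono-≤ zero _ _ = ≤-refl
  ^-mono-≤ (suc k) 0≤x p = *-mono-≤ 0≤x (^-nonNeg k (≤-trans 0≤x p)) p (^-mono-≤ k 0≤x p)

  abstract
    -- If x bounded all natural numbers, they would have a supremum s, and s - 1 would be a smaller
    -- upper bound.
    archimedean : ∀ x → ∃[ k ] x ≤ fromℕ k
    archimedean x with em {∃[ k ] x ≤ fromℕ k}
    ... | yes p = p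
    ... | no ¬p = ⊥-elim (bounded (complete (λ y → ∃[ k ] y ≈ fromℕ k) (0# , 0 , refl)
        (x , λ { y (k , e) → ≤-respˡ (sym e) (below k) })))
      where
      below : ∀ k → fromℕ k ≤ x
      below k with ≤-total (fromℕ k) x
      ... | inj₁ q = q
      ... | inj₂ q = ⊥-elim (¬p (k , q))
      bounded : ∃ (IsSup _≤_ (λ y → ∃[ k ] y ≈ fromℕ k)) → ⊥
      bounded (s , ub , lub) = 1≰0 (lin₁ (lub (s - 1#) λ { y (k , e) →
          lin₂ (ub _ (suc k , refl)) (≤-reflexive e)
            (solve 3 (λ s k y → (s :- (con (+ 1) :+ k)) :+ (k :- y) := (s :- con (+ 1)) :- y)
              refl s (fromℕ k) y) })
        (solve 1 (λ s → (s :- con (+ 1)) :- s := con (+ 0) :- con (+ 1)) refl s))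

  _IsFloorOf_ : ℤ → ℝ → Set
  i IsFloorOf x = fromℤ i ≤ x × x < fromℤ i + 1#

  -- The bound b is the fuel of a downward search.
  floorℕ : ∀ b {x} → 0# ≤ x → x ≤ fromℕ b → ∃[ a ] fromℕ a ≤ x × x < fromℕ a + 1#
  floorℕ zero p q = 0 , p , ≤-<-trans q (<-≤-trans 0<1 (≤-reflexive (sym (+-identityˡ 1#))))
  floorℕ (suc b) {x} p q with ≤-or-< (fromℕ (suc b)) x
  ... | inj₁ r = suc b , r , ≤-<-trans q (x<x+1 _)
    where
    x<x+1 : ∀ x → x < x + 1#
    x<x+1 x = by-diff 0≤1 (solve 1 (λ x → con (+ 1) := (x :+ con (+ 1)) :- x) refl x) ,
      λ e → 1≰0 (lin₁ (≤-reflexive (sym e)) (solve 1 (λ x → x :- (x :+ con (+ 1)) := con (+ 0) :- con (+ 1)) refl x))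
  ... | inj₂ r with ≤-or-< x (fromℕ b)
  ...   | inj₁ r′ = floorℕ b p r′
  ...   | inj₂ r′ = b , proj₁ r′ , <-≤-trans r (≤-reflexive (+-comm _ _))

  abstract
    ℕ-floor : ∀ {x} → 0# ≤ x → ∃[ a ] fromℕ a ≤ x × x < fromℕ a + 1#
    ℕ-floor {x} p = floorℕ (proj₁ (archimedean x)) p (proj₂ (archimedean x))

  abstract
    floor : ∀ x → ∃[ i ] i IsFloorOf x
    floor x with archimedean (- x)
    ... | k , p with ℕ-floor {x + fromℕ k} (lin₁ p (solve 2 (λ x k → k :- (:- x) := (x :+ k) :- con (+ 0)) refl x (fromℕ k)))
    ...   | a , q , r = + a ℤ.- + k , ≤-respˡ (sym e) q′ , <-≤-trans r′ (≤-reflexive (+-congʳ (sym e)))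
      where
      e : fromℤ (+ a ℤ.- + k) ≈ fromℕ a - fromℕ k
      e = trans (fromℤ-+ (+ a) (ℤ.- + k)) (+-congˡ (fromℤ-neg (+ k)))
      q′ : fromℕ a - fromℕ k ≤ x
      q′ = lin₁ q (solve 3 (λ x k a → (x :+ k) :- a := x :- (a :- k)) refl x (fromℕ k) (fromℕ a))
      r′ : x < fromℕ a - fromℕ k + 1#
      r′ = lin₁ (proj₁ r) (solve 3 (λ x k a → (a :+ con (+ 1)) :- (x :+ k) := (a :- k :+ con (+ 1)) :- x) refl x (fromℕ k) (fromℕ a)) ,
        λ e → <⇒≱ r (lin₁ (≤-reflexive (sym e)) (solve 3 (λ x k a → x :- (a :- k :+ con (+ 1)) := (x :+ k) :- (a :+ con (+ 1))) refl x (fromℕ k) (fromℕ a)))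

  ∣∣-≤ : ∀ {x y} → x ≤ y → - x ≤ y → ∣ x ∣ ≤ y
  ∣∣-≤ p q = ⊔-lub p q

  x≤∣x∣ : ∀ x → x ≤ ∣ x ∣
  x≤∣x∣ x = x≤x⊔y x (- x)

  -x≤∣x∣ : ∀ x → - x ≤ ∣ x ∣
  -x≤∣x∣ x = x≤y⊔x x (- x)

  ∣∣-nonNeg : ∀ x → 0# ≤ ∣ x ∣
  ∣∣-nonNeg x with ≤-total 0# x
  ... | inj₁ p = ≤-trans p (x≤∣x∣ x)
  ... | inj₂ p = ≤-trans (≤-respˡ -0#≈0# (-‿mono-≤ p)) (-x≤∣x∣ x)

  ∣∣-cong-≤ : ∀ {x y} → x ≈ y → ∣ x ∣ ≤ ∣ y ∣
  ∣∣-cong-≤ {x} {y} e = ∣∣-≤ (≤-respˡ (sym e) (x≤∣x∣ y)) (≤-respˡ (-‿cong (sym e)) (-x≤∣x∣ y))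

  ∣∣-cong : ∀ {x y} → x ≈ y → ∣ x ∣ ≈ ∣ y ∣
  ∣∣-cong e = ≤-antisym (∣∣-cong-≤ e) (∣∣-cong-≤ (sym e))

  ∣∣-+ : ∀ x y → ∣ x + y ∣ ≤ ∣ x ∣ + ∣ y ∣
  ∣∣-+ x y = ∣∣-≤ (+-mono-≤ (x≤∣x∣ x) (x≤∣x∣ y))
    (≤-respˡ (-‿+-comm x y) (+-mono-≤ (-x≤∣x∣ x) (-x≤∣x∣ y)))

  ∣∣-neg : ∀ x → ∣ - x ∣ ≈ ∣ x ∣
  ∣∣-neg x = ≤-antisym (half x) (≤-respˡ (∣∣-cong (-‿involutive x)) (half (- x)))
    where
    half : ∀ x → ∣ - x ∣ ≤ ∣ x ∣
    half x = ∣∣-≤ (-x≤∣x∣ x) (≤-respˡ (sym (-‿involutive x)) (x≤∣x∣ x))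

  ∣∣-nonNeg-≈ : ∀ {x} → 0# ≤ x → ∣ x ∣ ≈ x
  ∣∣-nonNeg-≈ {x} p = ≤-antisym (∣∣-≤ ≤-refl (≤-trans (≤-respʳ -0#≈0# (-‿mono-≤ p)) p)) (x≤∣x∣ x)

  ∣∣-scale : ∀ {c} → 0# ≤ c → ∀ x → ∣ c * x ∣ ≈ c * ∣ x ∣
  ∣∣-scale {c} p x = ≤-antisym
    (∣∣-≤ (*-monoˡ-≤ p (x≤∣x∣ x)) (≤-respˡ (sym (-‿distribʳ-* c x)) (*-monoˡ-≤ p (-x≤∣x∣ x))))
    back
    where
    back : c * ∣ x ∣ ≤ ∣ c * x ∣
    back with ≤-total 0# x
    ... | inj₁ q = ≤-respˡ (*-congˡ (sym (∣∣-nonNeg-≈ q))) (x≤∣x∣ (c * x))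
    ... | inj₂ q = ≤-respˡ (trans (-‿distribʳ-* c x) (*-congˡ (trans (sym (∣∣-nonNeg-≈ (≤-respˡ -0#≈0# (-‿mono-≤ q)))) (∣∣-neg x))))
                     (-x≤∣x∣ (c * x))

  ∣fromℤ∣ : ∀ i → ∣ fromℤ i ∣ ≈ fromℕ (ℤ.∣ i ∣)
  ∣fromℤ∣ (+ k) = ∣∣-nonNeg-≈ (fromℕ-nonNeg k)
  ∣fromℤ∣ -[1+ k ] = trans (∣∣-neg _) (∣∣-nonNeg-≈ (fromℕ-nonNeg (suc k)))

  1^ : ∀ k → 1# ^ k ≈ 1#
  1^ zero = refl
  1^ (suc k) = trans (*-identityˡ _) (1^ k)

  fromℕ*^ : ∀ a b k → fromℕ (a ℕ.* b ℕ.^ k) ≈ fromℕ a * fromℕ b ^ k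
  fromℕ*^ a b k = trans (fromℕ-* a (b ℕ.^ k)) (*-congˡ (fromℕ-^ b k))

  ∣fromℤ*∣≤ : ∀ i x → ∣ fromℤ i * x ∣ ≤ fromℕ ℤ.∣ i ∣ * ∣ x ∣
  ∣fromℤ*∣≤ (+ k) x = ≤-reflexive (∣∣-scale (fromℕ-nonNeg k) x)
  ∣fromℤ*∣≤ -[1+ k ] x = ≤-reflexive (trans (∣∣-cong (sym (-‿distribˡ-* (fromℕ (suc k)) x)))
    (trans (∣∣-neg (fromℕ (suc k) * x)) (∣∣-scale (fromℕ-nonNeg (suc k)) x)))

  floor-error : ∀ {x k} → k ≤ x → x < k + 1# → ∣ x - k ∣ ≤ 1#
  floor-error {x} {k} lo hi = ∣∣-≤ (lin₁ (proj₁ hi) (lemma₁ x k)) (lin₂ lo 0≤1 (lemma₂ x k))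
    where
    lemma₁ : ∀ x k → (k + 1#) - x ≈ 1# - (x - k)
    lemma₁ = solve 2 (λ x k → (k :+ con (+ 1)) :- x := con (+ 1) :- (x :- k)) refl
    lemma₂ : ∀ x k → (x - k) + (1# - 0#) ≈ 1# - - (x - k)
    lemma₂ = solve 2 (λ x k → (x :- k) :+ (con (+ 1) :- con (+ 0)) := con (+ 1) :- :- (x :- k)) refl

-- Null sets: measurability, countable unions, covers by cubes

module OuterMeasure (em : ExcludedMiddle 0ℓ) (R : RealNumbers) where

  open RealNumbers R hiding (zero)
  open IsTotalOrder isTotalOrder using () renaming
    (refl to ≤-refl; trans to ≤-trans; antisym to ≤-antisym; total to ≤-total; reflexive to ≤-reflexive)
  open OrderedField em R
  open Algebra.Properties.Semiring.Exp semiring using (^-congˡ)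
  open Algebra.Properties.CommutativeSemiring.Exp commutativeSemiring using (^-distrib-*)
  open AddSupEquality _≈_ using ([_]; ⊤⁺≈⊤⁺)
  open AddSupNonStrict _≤_ using ([_]; _≤⊤⁺; ≤⁺-trans)

  abstract
    ½∃ : ∃[ h ] ((1# + 1#) * h ≈ 1# × 0# < h)
    ½∃ = recip (<-≤-trans 0<1 (by-diff 0≤1 (solve 0 (con (+ 1) := (con (+ 1) :+ con (+ 1)) :- con (+ 1)) refl)))

  ½ : ℝ
  ½ = proj₁ ½∃

  0<½ : 0# < ½
  0<½ = proj₂ (proj₂ ½∃)

  ½+½ : ∀ x → x * ½ + x * ½ ≈ x
  ½+½ x = begin
    x * ½ + x * ½ ≈⟨ solve 2 (λ x h → x :* h :+ x :* h := x :* ((con (+ 1) :+ con (+ 1)) :* h)) refl x ½ ⟩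
    x * ((1# + 1#) * ½) ≈⟨ *-congˡ (proj₁ (proj₂ ½∃)) ⟩
    x * 1# ≈⟨ *-identityʳ x ⟩
    x ∎
    where
    open ≈-R

  ≤-ε : ∀ {x y} → (∀ ε → 0# < ε → x ≤ y + ε) → x ≤ y
  ≤-ε {x} {y} p with ≤-or-< x y
  ... | inj₁ q = q
  ... | inj₂ q = ⊥-elim (<⇒≱ (*-pos 0<δ 0<½) (lin₁ (p (δ * ½) (*-pos 0<δ 0<½)) (begin
    (y + δ * ½) - x ≈⟨ +-congˡ (-‿cong x≈) ⟩
    (y + δ * ½) - (y + (δ * ½ + δ * ½)) ≈⟨ solve 2 (λ y h → (y :+ h) :- (y :+ (h :+ h)) := con (+ 0) :- h) refl y (δ * ½) ⟩
    0# - δ * ½ ∎)))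
    where
    open ≈-R
    δ = x - y
    0<δ : 0# < δ
    0<δ = diff (proj₁ q) , λ e → <⇒≱ q (lin₁ (≤-reflexive (sym e))
      (solve 2 (λ x y → con (+ 0) :- (x :- y) := y :- x) refl x y))
    x≈ : x ≈ y + (δ * ½ + δ * ½)
    x≈ = trans (solve 2 (λ x y → x := y :+ (x :- y)) refl x y) (+-congˡ (sym (½+½ δ)))

  [≤]⁻¹ : ∀ {x y} → [ x ] ≤⁺ [ y ] → x ≤ y
  [≤]⁻¹ [ p ] = p

  IsSup⇒IsSup⁺ : ∀ {P : Pred ℝ 0ℓ} {Q : Pred ℝ⁺ 0ℓ} {s} → IsSup _≤_ P s →
    (∀ {x} → P x → Q [ x ]) → (∀ {x⁺} → Q x⁺ → ∃[ x ] x⁺ ≈⁺ [ x ] × P x) → ∃ P → IsSup _≤⁺_ Q [ s ]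
  IsSup⇒IsSup⁺ {P} {Q} {s} (ub , lub) to from (x₀ , Px₀) = ub⁺ , lub⁺
    where
    ub⁺ : ∀ x⁺ → Q x⁺ → x⁺ ≤⁺ [ s ]
    ub⁺ x⁺ q with from q
    ... | x , [ e ] , p = [ ≤-respˡ (sym e) (ub x p) ]
    lub⁺ : ∀ u → IsUpperBound _≤⁺_ Q u → [ s ] ≤⁺ u
    lub⁺ ⊤⁺ _ = _ ≤⊤⁺
    lub⁺ [ u ] h = [ lub u (λ x p → [≤]⁻¹ (h [ x ] (to p))) ]

  partialSum : (ℕ → ℝ) → ℕ → ℝ
  partialSum a N = sum {N} (a ∘ toℕ)

  series-bounded : ∀ a {ε} → (∀ N → partialSum a N ≤ ε) → ∃[ v ] IsSeriesSum a [ v ] × v ≤ ε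
  series-bounded a {ε} h with complete (λ x → ∃[ N ] x ≈ partialSum a N) (0# , 0 , refl)
                                  (ε , λ { x (N , e) → ≤-respˡ (sym e) (h N) })
  ... | v , ub , lub = v ,
    IsSup⇒IsSup⁺ (ub , lub) (λ { (N , e) → N , [ e ] }) (λ { (N , [ e ]) → _ , [ e ] , N , refl }) (0# , 0 , refl) ,
    lub ε λ { x (N , e) → ≤-respˡ (sym e) (h N) }

  series-≥0 : ∀ a {v} → IsSeriesSum a v → [ 0# ] ≤⁺ v
  series-≥0 a (ub , _) = ub [ 0# ] (0 , [ refl ])

  module _ {l : ℕ} where
    open Lebesgue R {suc l}
    open Box

    -- Bounds on partial sums stand in for the sum of the series, which `series-bounded` supplies by
    -- completeness; covers can then be built without knowing the sum of their volumes.
    IsNull : Pred (Vector ℝ (suc l)) 0ℓ → Set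
    IsNull E = ∀ ε → 0# < ε → ∃[ B ] Covers B E × ∀ N → partialSum (volume ∘ B) N ≤ ε

    IsNull⇒IsOuterMeasure : ∀ {E} → IsNull E → IsOuterMeasure E [ 0# ]
    IsNull⇒IsOuterMeasure {E} null = (λ { v (B , _ , s) → series-≥0 (volume ∘ B) s }) , glb
      where
      sums : Pred ℝ⁺ 0ℓ
      sums v = ∃[ B ] Covers B E × IsSeriesSum (volume ∘ B) v
      small : ∀ u → IsUpperBound (λ x y → y ≤⁺ x) sums u → ∀ ε → 0# < ε → u ≤⁺ [ ε ]
      small u h ε p with null ε p
      ... | B , cov , b with series-bounded (volume ∘ B) b
      ...   | v , s , v≤ε = ≤⁺-trans ≤-trans (h [ v ] (B , cov , s)) [ v≤ε ]
      glb : ∀ u → IsUpperBound (λ x y → y ≤⁺ x) sums u → u ≤⁺ [ 0# ]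
      glb ⊤⁺ h with small ⊤⁺ h 1# 0<1
      ... | ()
      glb [ u ] h = [ ≤-ε (λ ε p → ≤-respʳ (sym (+-identityˡ ε)) ([≤]⁻¹ (small [ u ] h ε p))) ]

    product-nonNeg : ∀ {k} (f : Vector ℝ k) → (∀ i → 0# ≤ f i) → 0# ≤ product f
    product-nonNeg {zero} f h = 0≤1
    product-nonNeg {suc k} f h = *-nonNeg (h zero) (product-nonNeg (f ∘ suc) (h ∘ suc))

    volume-nonNeg : ∀ b → 0# ≤ volume b
    volume-nonNeg b = product-nonNeg _ (λ i → diff (lower≤upper b i))

    interleave : (ℕ → Box) → (ℕ → Box) → ℕ → Box
    interleave B C zero = B 0
    interleave B C (suc k) = interleave C (B ∘ suc) k

    interleave-∋ˡ : ∀ (P : Pred Box 0ℓ) B C k → P (B k) → ∃[ j ] P (interleave B C j)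
    interleave-∋ˡ P B C zero p = 0 , p
    interleave-∋ˡ P B C (suc k) p with interleave-∋ˡ P (B ∘ suc) (C ∘ suc) k p
    ... | j , q = suc (suc j) , q

    interleave-∋ʳ : ∀ (P : Pred Box 0ℓ) B C k → P (C k) → ∃[ j ] P (interleave B C j)
    interleave-∋ʳ P B C k p with interleave-∋ˡ P C (B ∘ suc) k p
    ... | j , q = suc j , q

    -- The bounds are arbitrary reals, so that once the first box of B is removed the induction
    -- applies with the two sequences exchanged and β lowered by the volume of that box.
    partialSum-interleave : ∀ B C {β γ} → (∀ N → partialSum (volume ∘ B) N ≤ β) →
      (∀ N → partialSum (volume ∘ C) N ≤ γ) → ∀ N → partialSum (volume ∘ interleave B C) N ≤ β + γ
    partialSum-interleave B C p q zero = +-nonNeg (p 0) (q 0)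
    partialSum-interleave B C {β} {γ} p q (suc N) =
      lin₁ (partialSum-interleave C (B ∘ suc) {γ} {β - volume (B 0)} q
        (λ N → lin₁ (p (suc N)) (solve 3 (λ β v s → β :- (v :+ s) := (β :- v) :- s) refl β (volume (B 0)) (partialSum (volume ∘ B ∘ suc) N))) N)
        (solve 4 (λ β γ v s → (γ :+ (β :- v)) :- s := (β :+ γ) :- (v :+ s)) refl β γ (volume (B 0)) (partialSum (volume ∘ interleave C (B ∘ suc)) N))

    -- The part of T inside E has outer measure 0 and the part outside has at most that of T, by
    -- monotonicity. What remains is that T is no larger than its part outside E: a cover of that
    -- part, interleaved with a cover of E of volume at most ε, covers T.
    IsNull⇒Measurable : ∀ {E} → IsNull E → Measurable E
    IsNull⇒Measurable {E} null T {t} {a} {b} (t-lb , t-glb) (a-lb , a-glb) (b-lb , b-glb) =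
      goal t a b a≤0 0≤a b≤t t≤b
      where
      0≤a : [ 0# ] ≤⁺ a
      0≤a = a-glb [ 0# ] λ { v (B , _ , s) → series-≥0 (volume ∘ B) s }
      a≤0 : a ≤⁺ [ 0# ]
      a≤0 = proj₂ (IsNull⇒IsOuterMeasure null) a λ { v (B , cov , s) → a-lb v (B , (λ x x∈ → cov x (proj₂ x∈)) , s) }
      b≤t : b ≤⁺ t
      b≤t = t-glb b λ { v (B , cov , s) → b-lb v (B , (λ x x∈ → cov x (proj₁ x∈)) , s) }
      t≤b : t ≤⁺ b
      t≤b = b-glb t λ where
          ⊤⁺ _ → t ≤⊤⁺
          [ v ] (B , cov , s) → close v t (t≤v+ε v B cov s)
        where
        t≤v+ε : ∀ v B → Covers B (T ∖ E) → IsSeriesSum (volume ∘ B) [ v ] → ∀ ε → 0# < ε → t ≤⁺ [ v + ε ]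
        t≤v+ε v B cov (ub , _) ε p with null ε p
        ... | C , covC , c with series-bounded (volume ∘ interleave B C) (partialSum-interleave B C
                                 (λ N → [≤]⁻¹ (ub [ partialSum (volume ∘ B) N ] (N , [ refl ]))) c)
        ...   | w , sw , w≤ = ≤⁺-trans ≤-trans (t-lb [ w ] (interleave B C , covT , sw)) [ w≤ ]
          where
          covT : Covers (interleave B C) T
          covT x x∈T with em {x ∈ E}
          ... | no x∉E = let k , q = cov x (x∈T , x∉E) in interleave-∋ˡ (λ b → x ∈ Points b) B C k q
          ... | yes x∈E = let k , q = covC x x∈E in interleave-∋ʳ (λ b → x ∈ Points b) B C k q
        close : ∀ v t → (∀ ε → 0# < ε → t ≤⁺ [ v + ε ]) → t ≤⁺ [ v ]
        close v ⊤⁺ h with h 1# 0<1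
        ... | ()
        close v [ t ] h = [ ≤-ε (λ ε p → [≤]⁻¹ (h ε p)) ]
      goal : ∀ t a b → a ≤⁺ [ 0# ] → [ 0# ] ≤⁺ a → b ≤⁺ t → t ≤⁺ b → t ≈⁺ a +⁺ b
      goal t [ a ] ⊤⁺ _ _ (_ ≤⊤⁺) _ = ⊤⁺≈⊤⁺
      goal ⊤⁺ [ a ] [ b ] _ _ _ ()
      goal [ t ] [ a ] [ b ] [ p ] [ q ] [ r ] [ s ] = [ trans (≤-antisym s r) (trans (sym (+-identityˡ b)) (+-congʳ (≤-antisym q p))) ]

    IsNull⇒IsMeasure : ∀ {E} → IsNull E → IsMeasure E [ 0# ]
    IsNull⇒IsMeasure null = IsNull⇒Measurable null , IsNull⇒IsOuterMeasure null

    listVolume : List Box → ℝ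
    listVolume [] = 0#
    listVolume (b ∷ bs) = volume b + listVolume bs

    HasFiniteCovers : Pred (Vector ℝ (suc l)) 0ℓ → Set
    HasFiniteCovers E = ∀ ε → 0# < ε → ∃[ bs ] listVolume bs ≤ ε × (∀ x → x ∈ E → Any (λ b → x ∈ Points b) bs)

    point : Box
    point = record { lower = λ _ → 0# ; upper = λ _ → 0# ; lower≤upper = λ _ → ≤-refl }

    volume-point : volume point ≈ 0#
    volume-point = trans (*-congʳ (-‿inverseʳ 0#)) (zeroˡ _)

    -- The countable union is covered by the concatenation of the lists L 0, L 1, …,
    -- separated by degenerate boxes so that each state produces a box.
    module Concatenation (L : ℕ → List Box) where

      State : Set
      State = List Box × ℕ

      next : State → State
      next ([] , T) = L (suc T) , suc T
      next (_ ∷ bs , T) = bs , T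

      output : State → Box
      output ([] , _) = point
      output (b ∷ _ , _) = b

      stream : State → ℕ → Box
      stream s zero = output s
      stream s (suc k) = stream (next s) k

      stream-∋-current : ∀ (P : Pred Box 0ℓ) bs T → Any P bs → ∃[ j ] P (stream (bs , T) j)
      stream-∋-current P (b ∷ bs) T (here p) = 0 , p
      stream-∋-current P (b ∷ bs) T (there p) = let j , q = stream-∋-current P bs T p in suc j , q

      stream-∋-next : ∀ (P : Pred Box 0ℓ) bs T → ∃[ j ] P (stream (L (suc T) , suc T) j) → ∃[ j ] P (stream (bs , T) j)
      stream-∋-next P [] T (j , p) = suc j , p
      stream-∋-next P (b ∷ bs) T p = let j , q = stream-∋-next P bs T p in suc j , q

      stream-∋ : ∀ (P : Pred Box 0ℓ) T k → Any P (L (k ℕ.+ T)) → ∃[ j ] P (stream (L T , T) j)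
      stream-∋ P T zero p = stream-∋-current P (L T) T p
      stream-∋ P T (suc k) p = stream-∋-next P (L T) T
        (stream-∋ P (suc T) k (≡.subst (λ i → Any P (L i)) (≡.sym (ℕP.+-suc k T)) p))

      -- The summand ε ½^(T+1) is a reserve for all lists after the current one: on entering L
      -- (T+1), half of it pays for that list and the other half is the new reserve.
      partialSum-stream : ∀ {ε} → 0# < ε → (∀ T → listVolume (L T) ≤ ε * ½ ^ suc T) →
        ∀ N bs T → partialSum (volume ∘ stream (bs , T)) N ≤ listVolume bs + ε * ½ ^ suc T
      partialSum-stream {ε} 0<ε h zero bs T = +-nonNeg (nonNeg bs) (*-nonNeg (proj₁ 0<ε) (^-nonNeg (suc T) (proj₁ 0<½)))
        where
        nonNeg : ∀ bs → 0# ≤ listVolume bs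
        nonNeg [] = ≤-refl
        nonNeg (b ∷ bs) = +-nonNeg (volume-nonNeg b) (nonNeg bs)
      partialSum-stream {ε} 0<ε h (suc N) [] T = begin
        volume point + partialSum (volume ∘ stream (L (suc T) , suc T)) N
          ≈⟨ trans (+-congʳ volume-point) (+-identityˡ _) ⟩
        partialSum (volume ∘ stream (L (suc T) , suc T)) N
          ≤⟨ partialSum-stream 0<ε h N (L (suc T)) (suc T) ⟩
        listVolume (L (suc T)) + ε * ½ ^ suc (suc T)
          ≤⟨ +-mono-≤ (h (suc T)) ≤-refl ⟩
        ε * ½ ^ suc (suc T) + ε * ½ ^ suc (suc T)
          ≈⟨ +-cong regroup regroup ⟩
        (ε * ½ ^ suc T) * ½ + (ε * ½ ^ suc T) * ½
          ≈⟨ ½+½ _ ⟩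
        ε * ½ ^ suc T
          ≈⟨ +-identityˡ _ ⟨
        0# + ε * ½ ^ suc T ∎
        where
        open ≤-R
        regroup : ε * ½ ^ suc (suc T) ≈ (ε * ½ ^ suc T) * ½
        regroup = solve 3 (λ e h p → e :* (h :* p) := (e :* p) :* h) refl ε ½ (½ ^ suc T)
      partialSum-stream {ε} 0<ε h (suc N) (b ∷ bs) T =
        ≤-respʳ (sym (+-assoc _ _ _)) (+-monoʳ-≤ (volume b) (partialSum-stream 0<ε h N bs T))

    ⋃-IsNull : ∀ {E : Pred (Vector ℝ (suc l)) 0ℓ} (F : ℕ → Pred (Vector ℝ (suc l)) 0ℓ) →
      (∀ x → x ∈ E → ∃[ T ] x ∈ F T) → (∀ T → HasFiniteCovers (F T)) → IsNull E
    ⋃-IsNull {E} F E⊆ fin ε 0<ε = stream (L 0 , 0) , cov , bound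
      where
      cover : ∀ T → ∃[ bs ] listVolume bs ≤ ε * ½ ^ suc T × (∀ x → x ∈ F T → Any (λ b → x ∈ Points b) bs)
      cover T = fin T (ε * ½ ^ suc T) (*-pos 0<ε (^-pos (suc T) 0<½))
      L : ℕ → List Box
      L T = proj₁ (cover T)
      open Concatenation L
      cov : Covers (stream (L 0 , 0)) E
      cov x x∈ = let T , p = E⊆ x x∈ in
        stream-∋ (λ b → x ∈ Points b) 0 T
          (≡.subst (λ i → Any (λ b → x ∈ Points b) (L i)) (≡.sym (ℕP.+-identityʳ T)) (proj₂ (proj₂ (cover T)) x p))
      bound : ∀ N → partialSum (volume ∘ stream (L 0 , 0)) N ≤ ε
      bound N = begin
        partialSum (volume ∘ stream (L 0 , 0)) N ≤⟨ partialSum-stream 0<ε (λ T → proj₁ (proj₂ (cover T))) N (L 0) 0 ⟩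
        listVolume (L 0) + ε * ½ ^ 1 ≤⟨ +-mono-≤ (proj₁ (proj₂ (cover 0))) ≤-refl ⟩
        ε * ½ ^ 1 + ε * ½ ^ 1 ≈⟨ +-cong (*-congˡ (*-identityʳ ½)) (*-congˡ (*-identityʳ ½)) ⟩
        ε * ½ + ε * ½ ≈⟨ ½+½ ε ⟩
        ε ∎
        where open ≤-R

    -- Covered, for every k, by finitely many cubes of radius 1/r of total volume at most 1/k.
    Negligible : Pred (Vector ℝ (suc l)) 0ℓ → Set
    Negligible E = ∀ k → ∃[ r ] Σ (List (Vector ℝ (suc l))) λ L → 1 ℕ.≤ r × k ℕ.* (length L ℕ.* 2 ℕ.^ suc l) ℕ.≤ r ℕ.^ suc l ×
      (∀ x → x ∈ E → Any (λ c → ∀ i → fromℕ r * ∣ x i - c i ∣ ≤ 1#) L)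

    module Cube (r : ℕ) (1≤r : 1 ℕ.≤ r) where

      abstract
        ρ∃ : ∃[ ρ ] (fromℕ r * ρ ≈ 1# × 0# < ρ)
        ρ∃ = recip (fromℕ-pos 1≤r)

      ρ : ℝ
      ρ = proj₁ ρ∃

      0≤ρ : 0# ≤ ρ
      0≤ρ = proj₁ (proj₂ (proj₂ ρ∃))

      cube : Vector ℝ (suc l) → Box
      cube c = record
        { lower = λ i → c i - ρ
        ; upper = λ i → c i + ρ
        ; lower≤upper = λ i → by-diff (+-nonNeg 0≤ρ 0≤ρ) (lemma (c i) ρ)
        }
        where
        lemma : ∀ c ρ → ρ + ρ ≈ (c + ρ) - (c - ρ)
        lemma = solve 2 (λ c ρ → ρ :+ ρ := (c :+ ρ) :- (c :- ρ)) refl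

      product-const : ∀ {k} (f : Vector ℝ k) {x} → (∀ i → f i ≈ x) → product f ≈ x ^ k
      product-const {zero} f h = refl
      product-const {suc k} f h = *-cong (h zero) (product-const (f ∘ suc) (h ∘ suc))

      volume-cube : ∀ c → volume (cube c) ≈ (ρ + ρ) ^ suc l
      volume-cube c = product-const _ (λ i → lemma (c i) ρ)
        where
        lemma : ∀ c ρ → (c + ρ) - (c - ρ) ≈ ρ + ρ
        lemma = solve 2 (λ c ρ → (c :+ ρ) :- (c :- ρ) := ρ :+ ρ) refl

      listVolume-cubes : ∀ L → listVolume (List.map cube L) ≈ fromℕ (length L) * (ρ + ρ) ^ suc l
      listVolume-cubes [] = sym (zeroˡ _)
      listVolume-cubes (c ∷ L) = trans (+-cong (volume-cube c) (listVolume-cubes L))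
        (sym (trans (distribʳ _ 1# (fromℕ (length L))) (+-congʳ (*-identityˡ _))))

      -- Multiplying by r^(l+1) clears the denominators, so that the volume can be compared with the
      -- integer inequality in `Negligible`.
      rescaled-volume : ∀ L → fromℕ (r ℕ.^ suc l) * listVolume (List.map cube L) ≈ fromℕ (length L ℕ.* 2 ℕ.^ suc l)
      rescaled-volume L = begin
        fromℕ (r ℕ.^ suc l) * listVolume (List.map cube L)
          ≈⟨ *-cong (fromℕ-^ r (suc l)) (trans (listVolume-cubes L) (*-congˡ (trans (^-congˡ (suc l) 2ρ) (^-distrib-* (fromℕ 2) ρ (suc l))))) ⟩
        fromℕ r ^ suc l * (fromℕ (length L) * (fromℕ 2 ^ suc l * ρ ^ suc l))
          ≈⟨ lemma (fromℕ r ^ suc l) (fromℕ (length L)) (fromℕ 2 ^ suc l) (ρ ^ suc l) ⟩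
        fromℕ (length L) * fromℕ 2 ^ suc l * (fromℕ r ^ suc l * ρ ^ suc l)
          ≈⟨ *-congˡ (trans (sym (^-distrib-* (fromℕ r) ρ (suc l))) (trans (^-congˡ (suc l) (proj₁ (proj₂ ρ∃))) (1^ (suc l)))) ⟩
        fromℕ (length L) * fromℕ 2 ^ suc l * 1#
          ≈⟨ *-identityʳ _ ⟩
        fromℕ (length L) * fromℕ 2 ^ suc l
          ≈⟨ fromℕ*^ (length L) 2 (suc l) ⟨
        fromℕ (length L ℕ.* 2 ℕ.^ suc l) ∎
        where
        open ≈-R
        2ρ : ρ + ρ ≈ fromℕ 2 * ρ
        2ρ = x+x≈2x ρ
        lemma : ∀ a b c d → a * (b * (c * d)) ≈ b * c * (a * d)
        lemma = solve 4 (λ a b c d → a :* (b :* (c :* d)) := b :* c :* (a :* d)) refl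

      cube-∋ : ∀ {x c} → (∀ i → fromℕ r * ∣ x i - c i ∣ ≤ 1#) → x ∈ Points (cube c)
      cube-∋ {x} {c} h i =
          lin₁ (≤-trans (-x≤∣x∣ (x i - c i)) near) (lemma₁ (x i) (c i) ρ) , lin₁ (≤-trans (x≤∣x∣ (x i - c i)) near) (lemma₂ (x i) (c i) ρ)
        where
        near : ∣ x i - c i ∣ ≤ ρ
        near = *-cancelˡ-≤ (fromℕ-pos 1≤r) (≤-respʳ (sym (proj₁ (proj₂ ρ∃))) (h i))
        lemma₁ : ∀ x c ρ → ρ - - (x - c) ≈ x - (c - ρ)
        lemma₁ = solve 3 (λ x c ρ → ρ :- :- (x :- c) := x :- (c :- ρ)) refl
        lemma₂ : ∀ x c ρ → ρ - (x - c) ≈ c + ρ - x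
        lemma₂ = solve 3 (λ x c ρ → ρ :- (x :- c) := c :+ ρ :- x) refl

    Negligible⇒HasFiniteCovers : ∀ {E} → Negligible E → HasFiniteCovers E
    Negligible⇒HasFiniteCovers {E} neg ε 0<ε =
      List.map cube L , *-cancelˡ-≤ (fromℕ-pos (ℕP.m^n>0 r {{ℕ.>-nonZero 1≤r}} (suc l))) (begin
        fromℕ (r ℕ.^ suc l) * listVolume (List.map cube L) ≈⟨ rescaled-volume L ⟩
        fromℕ V ≈⟨ *-identityʳ _ ⟨
        fromℕ V * 1# ≤⟨ *-monoˡ-≤ (fromℕ-nonNeg V) 1≤kε ⟩
        fromℕ V * (fromℕ k * ε) ≈⟨ lemma (fromℕ V) (fromℕ k) ε ⟩
        fromℕ k * fromℕ V * ε ≈⟨ *-congʳ (fromℕ-* k V) ⟨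
        fromℕ (k ℕ.* V) * ε ≤⟨ *-monoʳ-≤ (proj₁ 0<ε) (fromℕ-mono kV≤) ⟩
        fromℕ (r ℕ.^ suc l) * ε ∎) ,
      λ x x∈ → AnyP.map⁺ (Any.map cube-∋ (covers x x∈))
      where
      open ≤-R
      abstract
        big : ∃[ k ] 1# ≤ fromℕ k * ε
        big = let ε⁻¹ , e , _ = recip 0<ε ; k , h = archimedean ε⁻¹ in
          k , ≤-trans (≤-reflexive (trans (sym e) (*-comm ε ε⁻¹))) (≤-respˡ (*-comm ε ε⁻¹) (≤-respʳ (*-comm ε (fromℕ k)) (*-monoˡ-≤ (proj₁ 0<ε) h)))
      k : ℕ
      k = proj₁ big
      1≤kε : 1# ≤ fromℕ k * ε
      1≤kε = proj₂ big
      r = proj₁ (neg k)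
      L = proj₁ (proj₂ (neg k))
      1≤r = proj₁ (proj₂ (proj₂ (neg k)))
      kV≤ = proj₁ (proj₂ (proj₂ (proj₂ (neg k))))
      covers = proj₂ (proj₂ (proj₂ (proj₂ (neg k))))
      V : ℕ
      V = length L ℕ.* 2 ℕ.^ suc l
      open Cube r 1≤r
      lemma : ∀ v k e → v * (k * e) ≈ k * v * e
      lemma = solve 3 (λ v k e → v :* (k :* e) := k :* v :* e) refl

    ⋃-Negligible-IsMeasure : ∀ {E : Pred (Vector ℝ (suc l)) 0ℓ} (F : ℕ → Pred (Vector ℝ (suc l)) 0ℓ) →
      (∀ x → x ∈ E → ∃[ T ] x ∈ F T) → (∀ T → Negligible (F T)) → IsMeasure E [ 0# ]
    ⋃-Negligible-IsMeasure F E⊆ neg = IsNull⇒IsMeasure (⋃-IsNull F E⊆ (λ T → Negligible⇒HasFiniteCovers (neg T)))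

-- Integer vectors, their norms, and distances to the integer lattice

module Diophantine (em : ExcludedMiddle 0ℓ) (R : RealNumbers) (m′ n′ : ℕ) where

  m n : ℕ
  m = suc m′
  n = suc n′

  open RealNumbers R hiding (zero)
  open IsTotalOrder isTotalOrder using () renaming
    (refl to ≤-refl; trans to ≤-trans; antisym to ≤-antisym; total to ≤-total; reflexive to ≤-reflexive)
  open OrderedField em R
  open OuterMeasure em R
  open Combinatorics
  open Approximation R m n
  open Max totalOrder using (x≤x⊔y; x≤y⊔x; ⊔-lub)
  open Algebra.Properties.Ring ring using (-0#≈0#; -‿distribˡ-*)
  open Algebra.Properties.CommutativeMonoid.Sum +-commutativeMonoid using (∑-distrib-+; sum-cong-≋)
  open Algebra.Properties.Semiring.Sum semiring using (*-distribˡ-sum)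
  open Algebra.Properties.Semiring.Exp semiring using (^-congˡ; ^-homo-*)
  open Algebra.Properties.CommutativeSemiring.Exp commutativeSemiring using (^-distrib-*)
  open AddSupEquality _≈_ using ([_])
  open AddSupNonStrict _≤_ using ([_]; _≤⊤⁺; ≤⁺-trans)
  open AddSupStrict _<_ using ([_]; [_]<⊤⁺)

  ∣lookup∣≤‖‖ℤ : ∀ q i → ℤ.∣ lookup q i ∣ ℕ.≤ ‖ q ‖ℤ
  ∣lookup∣≤‖‖ℤ = go
    where
    go : ∀ {k} (q : Vec ℤ k) i → ℤ.∣ lookup q i ∣ ℕ.≤ Vec.foldr′ ℕ._⊔_ 0 (Vec.map ℤ.∣_∣ q)
    go (x ∷ q) zero = ℕP.m≤m⊔n ℤ.∣ x ∣ _
    go (x ∷ q) (suc i) = ℕP.≤-trans (go q i) (ℕP.m≤n⊔m ℤ.∣ x ∣ _)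

  ‖‖ℤ-lub : ∀ q {N} → (∀ i → ℤ.∣ lookup q i ∣ ℕ.≤ N) → ‖ q ‖ℤ ℕ.≤ N
  ‖‖ℤ-lub = go
    where
    go : ∀ {k} (q : Vec ℤ k) {N} → (∀ i → ℤ.∣ lookup q i ∣ ℕ.≤ N) → Vec.foldr′ ℕ._⊔_ 0 (Vec.map ℤ.∣_∣ q) ℕ.≤ N
    go [] h = ℕ.z≤n
    go (x ∷ q) h = ℕP.⊔-lub (h zero) (go q (h ∘ suc))

  infixl 6 _⊕_
  _⊕_ : Vec ℤ n → Vec ℤ n → Vec ℤ n
  _⊕_ = Vec.zipWith ℤ._+_

  infixl 7 _⊙_
  _⊙_ : ℤ → Vec ℤ n → Vec ℤ n
  k ⊙ q = Vec.map (λ x → k ℤ.* x) q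

  lookup-⊕ : ∀ i q r → lookup (q ⊕ r) i ≡ lookup q i ℤ.+ lookup r i
  lookup-⊕ i q r = VecP.lookup-zipWith ℤ._+_ i q r

  lookup-⊙ : ∀ k i q → lookup (k ⊙ q) i ≡ k ℤ.* lookup q i
  lookup-⊙ k i q = VecP.lookup-map i (λ x → k ℤ.* x) q

  ‖⊕‖≤ : ∀ q r → ‖ q ⊕ r ‖ℤ ℕ.≤ ‖ q ‖ℤ ℕ.+ ‖ r ‖ℤ
  ‖⊕‖≤ q r = ‖‖ℤ-lub (q ⊕ r) λ i → ℕP.≤-trans (ℕP.≤-reflexive (≡.cong ℤ.∣_∣ (lookup-⊕ i q r)))
    (ℕP.≤-trans (ℤP.∣i+j∣≤∣i∣+∣j∣ (lookup q i) (lookup r i)) (ℕP.+-mono-≤ (∣lookup∣≤‖‖ℤ q i) (∣lookup∣≤‖‖ℤ r i)))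

  ‖⊙‖≤ : ∀ k q → ‖ k ⊙ q ‖ℤ ℕ.≤ ℤ.∣ k ∣ ℕ.* ‖ q ‖ℤ
  ‖⊙‖≤ k q = ‖‖ℤ-lub (k ⊙ q) λ i → ℕP.≤-trans (ℕP.≤-reflexive (≡.trans (≡.cong ℤ.∣_∣ (lookup-⊙ k i q)) (ℤP.abs-* k (lookup q i))))
    (ℕP.*-monoʳ-≤ ℤ.∣ k ∣ (∣lookup∣≤‖‖ℤ q i))

  *ᵥ-⊕ : ∀ A q r i → (A *ᵥ (q ⊕ r)) i ≈ (A *ᵥ q) i + (A *ᵥ r) i
  *ᵥ-⊕ A q r i = trans (sum-cong-≋ {x = λ j → A i j * fromℤ (lookup (q ⊕ r) j)} λ j → trans (*-congˡ (trans (fromℤ-cong (lookup-⊕ j q r)) (fromℤ-+ (lookup q j) (lookup r j)))) (distribˡ _ _ _))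
    (∑-distrib-+ (λ j → A i j * fromℤ (lookup q j)) (λ j → A i j * fromℤ (lookup r j)))

  *ᵥ-⊙ : ∀ A k q i → (A *ᵥ (k ⊙ q)) i ≈ fromℤ k * (A *ᵥ q) i
  *ᵥ-⊙ A k q i = trans (sum-cong-≋ {x = λ j → A i j * fromℤ (lookup (k ⊙ q) j)} λ j → trans (*-congˡ (trans (fromℤ-cong (lookup-⊙ k j q)) (fromℤ-* k (lookup q j))))
      (lemma (A i j) (fromℤ k) (fromℤ (lookup q j))))
    (sym (*-distribˡ-sum (fromℤ k) (λ j → A i j * fromℤ (lookup q j))))
    where
    lemma : ∀ a k x → a * (k * x) ≈ k * (a * x)
    lemma = solve 3 (λ a k x → a :* (k :* x) := k :* (a :* x)) refl

  ‖‖-nonNeg : ∀ {k} (x : Vector ℝ k) → 0# ≤ Vector.foldr _⊔_ 0# (Vector.map ∣_∣ x)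
  ‖‖-nonNeg {zero} x = ≤-refl
  ‖‖-nonNeg {suc k} x = ≤-trans (∣∣-nonNeg (x zero)) (x≤x⊔y _ _)

  ∣∣≤‖‖ : ∀ x i → ∣ x i ∣ ≤ ‖ x ‖
  ∣∣≤‖‖ = go
    where
    go : ∀ {k} (x : Vector ℝ k) i → ∣ x i ∣ ≤ Vector.foldr _⊔_ 0# (Vector.map ∣_∣ x)
    go x zero = x≤x⊔y _ _
    go x (suc i) = ≤-trans (go (x ∘ suc) i) (x≤y⊔x _ _)

  ‖‖-mono : ∀ x y → (∀ i → ∣ x i ∣ ≤ ∣ y i ∣) → ‖ x ‖ ≤ ‖ y ‖
  ‖‖-mono = go
    where
    go : ∀ {k} (x y : Vector ℝ k) → (∀ i → ∣ x i ∣ ≤ ∣ y i ∣) →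
      Vector.foldr _⊔_ 0# (Vector.map ∣_∣ x) ≤ Vector.foldr _⊔_ 0# (Vector.map ∣_∣ y)
    go {zero} x y h = ≤-refl
    go {suc k} x y h = ⊔-lub (≤-trans (h zero) (x≤x⊔y _ _)) (≤-trans (go (x ∘ suc) (y ∘ suc) (h ∘ suc)) (x≤y⊔x _ _))

  ‖‖-scale-≤ : ∀ {c u} x → 0# ≤ c → 0# ≤ u → (∀ i → c * ∣ x i ∣ ≤ u) → c * ‖ x ‖ ≤ u
  ‖‖-scale-≤ {c} {u} x 0≤c 0≤u = go x
    where
    go : ∀ {k} (x : Vector ℝ k) → (∀ i → c * ∣ x i ∣ ≤ u) → c * Vector.foldr _⊔_ 0# (Vector.map ∣_∣ x) ≤ u
    go {zero} x h = ≤-respˡ (sym (zeroʳ c)) 0≤u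
    go {suc k} x h with ≤-total ∣ x zero ∣ (Vector.foldr _⊔_ 0# (Vector.map ∣_∣ (x ∘ suc)))
    ... | inj₁ p = ≤-trans (*-monoˡ-≤ 0≤c (⊔-lub p ≤-refl)) (go (x ∘ suc) (h ∘ suc))
    ... | inj₂ p = ≤-trans (*-monoˡ-≤ 0≤c (⊔-lub ≤-refl p)) (h zero)

  suc-fromℤ-≤ : ∀ {i j} → i ℤ.< j → fromℤ i + 1# ≤ fromℤ j
  suc-fromℤ-≤ {i} {j} p = ≤-respˡ (trans (fromℤ-+ (+ 1) i) (trans (+-congʳ fromℕ-1) (+-comm 1# (fromℤ i))))
    (fromℤ-mono (ℤP.i<j⇒suc[i]≤j p))

  -- Every integer is at most f or at least f + 1, hence at least as far from x as f or f + 1 is.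
  nearest : ∀ f {x d} → fromℤ f ≤ x → x ≤ fromℤ f + 1# → d ≤ x - fromℤ f → d ≤ fromℤ f + 1# - x → ∀ p → d ≤ ∣ x - fromℤ p ∣
  nearest f {x} {d} f≤x x≤f+1 p q k with k ℤP.≤? f
  ... | yes r = ≤-trans (≤-trans p (+-monoʳ-≤ x (-‿mono-≤ (fromℤ-mono r)))) (x≤∣x∣ (x - fromℤ k))
  ... | no ¬r = ≤-trans (lin₂ q (suc-fromℤ-≤ (ℤP.≰⇒> ¬r)) (lemma d x (fromℤ f) (fromℤ k))) (-x≤∣x∣ (x - fromℤ k))
    where
    lemma : ∀ d x f k → ((f + 1# - x) - d) + (k - (f + 1#)) ≈ - (x - k) - d
    lemma = solve 4 (λ d x f k → ((f :+ con (+ 1) :- x) :- d) :+ (k :- (f :+ con (+ 1))) := :- (x :- k) :- d) refl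

  abstract
    nearestℤ : ∀ x → ∃[ p ] (∀ p′ → ∣ x - fromℤ p ∣ ≤ ∣ x - fromℤ p′ ∣)
    nearestℤ x = choose (≤-total (x - fromℤ f) (fromℤ f + 1# - x))
      where
      f : ℤ
      f = proj₁ (floor x)
      f≤x : fromℤ f ≤ x
      f≤x = proj₁ (proj₂ (floor x))
      x≤f+1 : x ≤ fromℤ f + 1#
      x≤f+1 = proj₁ (proj₂ (proj₂ (floor x)))
      f+1 : fromℤ (f ℤ.+ + 1) ≈ fromℤ f + 1#
      f+1 = trans (fromℤ-+ f (+ 1)) (+-congˡ fromℕ-1)
      choose : x - fromℤ f ≤ fromℤ f + 1# - x ⊎ fromℤ f + 1# - x ≤ x - fromℤ f → ∃[ p ] (∀ p′ → ∣ x - fromℤ p ∣ ≤ ∣ x - fromℤ p′ ∣)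
      choose (inj₁ p) = f , λ p′ → ≤-respˡ (sym (∣∣-nonNeg-≈ (diff f≤x))) (nearest f f≤x x≤f+1 ≤-refl p p′)
      choose (inj₂ p) = f ℤ.+ + 1 , λ p′ → ≤-respˡ (sym below) (nearest f f≤x x≤f+1 p ≤-refl p′)
        where
        lemma : ∀ x g → - (x - g) ≈ g - x
        lemma = solve 2 (λ x g → :- (x :- g) := g :- x) refl
        below : ∣ x - fromℤ (f ℤ.+ + 1) ∣ ≈ fromℤ f + 1# - x
        below = trans (∣∣-cong (+-congˡ (-‿cong f+1))) (trans (sym (∣∣-neg (x - (fromℤ f + 1#))))
          (trans (∣∣-cong (lemma x (fromℤ f + 1#))) (∣∣-nonNeg-≈ (diff x≤f+1))))

  abstract
    -- Rounding every coordinate to a nearest integer minimises all coordinates at once, and so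
    -- their maximum.
    distance : ∀ y → ∃ (IsDist y)
    distance y = ‖ y -ᵥ Vector.map fromℤ p ‖ , (p , refl) , λ { x (p′ , e) → ≤-respʳ (sym e)
        (‖‖-mono (y -ᵥ Vector.map fromℤ p) (y -ᵥ Vector.map fromℤ p′) (λ i → proj₂ (nearestℤ (y i)) (p′ i))) }
      where
      p : Vector ℤ m
      p i = proj₁ (nearestℤ (y i))

  IsDist-nonNeg : ∀ y {d} → IsDist y d → 0# ≤ d
  IsDist-nonNeg y ((p , e) , _) = ≤-respʳ (sym e) (‖‖-nonNeg (y -ᵥ Vector.map fromℤ p))

  -- ⟨y⟩ ≤ 1/s, with no condition when s = 0.
  Near : Vector ℝ m → ℕ → Set
  Near y s = ∃ λ (p : Vector ℤ m) → (∀ i → fromℕ s * ∣ y i - fromℤ (p i) ∣ ≤ 1#)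

  Near⇒dist : ∀ y s {d} → IsDist y d → Near y s → fromℕ s * d ≤ 1#
  Near⇒dist y s (_ , least) (p , h) = ≤-trans
    (*-monoˡ-≤ (fromℕ-nonNeg s) (least ‖ y -ᵥ Vector.map fromℤ p ‖ (p , refl)))
    (‖‖-scale-≤ (y -ᵥ Vector.map fromℤ p) (fromℕ-nonNeg s) 0≤1 h)

  dist⇒Near : ∀ y s {d} → IsDist y d → fromℕ s * d ≤ 1# → Near y s
  dist⇒Near y s {d} ((p , e) , _) h = p , λ i → ≤-trans
    (*-monoˡ-≤ (fromℕ-nonNeg s) (≤-respʳ (sym e) (∣∣≤‖‖ (y -ᵥ Vector.map fromℤ p) i))) h

  -- The vanishing of the limit inferior of ‖q‖ⁿ⟨A q⟩ᵐ, in integers: from ⟨A q⟩ ≤ 1/s and E ‖q‖ⁿ ≤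
  -- sᵐ the value at q is at most 1/E.
  WellApproximable : Matrix → Set
  WellApproximable A = ∀ E N → ∃[ q ] ∃[ s ] N ℕ.≤ ‖ q ‖ℤ × E ℕ.* ‖ q ‖ℤ ℕ.^ n ℕ.≤ s ℕ.^ m × Near (A *ᵥ q) s

  -- Bad matrices are those that are not well approximable

  abstract
    inf-exists : ∀ (P : Pred ℝ 0ℓ) → ∃ P → (∀ x → P x → 0# ≤ x) → ∃ (IsInf _≤_ P)
    inf-exists P (x₀ , p₀) h with complete (λ u → ∀ x → P x → u ≤ x) (0# , h) (x₀ , λ u lb → lb x₀ p₀)
    ... | s , ub , lub = s , (λ x p → lub x (λ u lb → lb x p)) , λ u lb → ub u lb

  abstract
    inf⁺-exists : ∀ (Q : Pred ℝ⁺ 0ℓ) → ∃[ x ] Q [ x ] → (∀ x → Q [ x ] → 0# ≤ x) → ∃ (IsInf _≤⁺_ Q)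
    inf⁺-exists Q (x₀ , p₀) h with inf-exists (λ x → Q [ x ]) (x₀ , p₀) h
    ... | s , lb , glb = [ s ] , lb⁺ , glb⁺
      where
      lb⁺ : ∀ x → Q x → [ s ] ≤⁺ x
      lb⁺ ⊤⁺ _ = _ ≤⊤⁺
      lb⁺ [ x ] p = [ lb x p ]
      glb⁺ : ∀ u → (∀ x → Q x → u ≤⁺ x) → u ≤⁺ [ s ]
      glb⁺ ⊤⁺ l with l [ x₀ ] p₀
      ... | ()
      glb⁺ [ u ] l = [ glb u (λ x p → [≤]⁻¹ (l [ x ] p)) ]

  abstract
    sup⁺-exists : ∀ (Q : Pred ℝ⁺ 0ℓ) → ∃[ x ] Q [ x ] → ∃ (IsSup _≤⁺_ Q)
    sup⁺-exists Q (x₀ , p₀) with em {∃[ u ] IsUpperBound _≤⁺_ Q [ u ]}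
    ... | no ¬b = ⊤⁺ , (λ x _ → x ≤⊤⁺) , λ { ⊤⁺ _ → _ ≤⊤⁺ ; [ u ] h → ⊥-elim (¬b (u , h)) }
    ... | yes (u , b) with complete (λ x → Q [ x ]) (x₀ , p₀) (u , λ x p → [≤]⁻¹ (b [ x ] p))
    ...   | s , ub , lub = [ s ] , ub⁺ , λ { ⊤⁺ _ → _ ≤⊤⁺ ; [ v ] h → [ lub v (λ x p → [≤]⁻¹ (h [ x ] p)) ] }
      where
      ub⁺ : ∀ x → Q x → x ≤⁺ [ s ]
      ub⁺ [ x ] p = [ ub x p ]
      ub⁺ ⊤⁺ p with b ⊤⁺ p
      ... | ()

  abstract
    -- The root rounded up. Passing from s ≥ 1 to s + 1 at most doubles it, which costs the factor
    -- 2^(d+1).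
    root⁺ : ∀ d X → 1 ℕ.≤ X → ∃[ s ] X ℕ.≤ s ℕ.^ suc d × s ℕ.^ suc d ℕ.≤ 2 ℕ.^ suc d ℕ.* X
    root⁺ d X 1≤X with root d X
    ... | zero , p , q = 1 , ℕP.<⇒≤ q , ℕP.≤-trans (ℕP.≤-reflexive (ℕP.^-zeroˡ (suc d))) (ℕP.*-mono-≤ (ℕP.m^n>0 2 (suc d)) 1≤X)
    ... | s@(suc _) , p , q = suc s , ℕP.<⇒≤ q , (begin
      suc s ℕ.^ suc d ≤⟨ ℕP.^-monoˡ-≤ (suc d) (ℕP.≤-trans (ℕP.+-monoˡ-≤ s (ℕ.s≤s ℕ.z≤n)) (ℕP.≤-reflexive (n+n≡2*n s))) ⟩
      (2 ℕ.* s) ℕ.^ suc d ≡⟨ ^-distribʳ-* (suc d) 2 s ⟩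
      2 ℕ.^ suc d ℕ.* s ℕ.^ suc d ≤⟨ ℕP.*-monoʳ-≤ (2 ℕ.^ suc d) p ⟩
      2 ℕ.^ suc d ℕ.* X ∎)
      where
      open ℕP.≤-Reasoning

  Value : Matrix → Vec ℤ n → Pred ℝ 0ℓ
  Value A q x = ∃[ d ] IsDist (A *ᵥ q) d × x ≈ fromℕ ‖ q ‖ℤ ^ n * d ^ m

  TailValue : Matrix → ℕ → Pred ℝ⁺ 0ℓ
  TailValue A N x = ∃[ q ] ∃[ y ] N ℕ.≤ ‖ q ‖ℤ × y ∈ Value A q × x ≈⁺ [ y ]

  N≤‖replicate‖ : ∀ N → N ℕ.≤ ‖ Vec.replicate n (+ N) ‖ℤ
  N≤‖replicate‖ N = ∣lookup∣≤‖‖ℤ (Vec.replicate n (+ N)) zero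

  Value-nonNeg : ∀ A q {x} → Value A q x → 0# ≤ x
  Value-nonNeg A q (d , dist , e) = ≤-respʳ (sym e)
    (*-nonNeg (^-nonNeg n (fromℕ-nonNeg ‖ q ‖ℤ)) (^-nonNeg m (IsDist-nonNeg (A *ᵥ q) dist)))

  TailValue-nonNeg : ∀ A N x → TailValue A N [ x ] → 0# ≤ x
  TailValue-nonNeg A N x (q , y , _ , v , [ e ]) = ≤-respʳ (sym e) (Value-nonNeg A q v)

  tailValue-inhabited : ∀ A N → ∃[ x ] TailValue A N [ x ]
  tailValue-inhabited A N = let d , dist = distance (A *ᵥ q) in
      fromℕ ‖ q ‖ℤ ^ n * d ^ m , q , fromℕ ‖ q ‖ℤ ^ n * d ^ m , N≤‖replicate‖ N , (d , dist , refl) , [ refl ]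
    where
    q : Vec ℤ n
    q = Vec.replicate n (+ N)

  -- Let s be the m-th root of (E + 1)‖q‖ⁿ rounded up. As q is no solution at precision 1/s, s⟨A q⟩
  -- is at least 1, and the m-th power of this is the claim. `suc E` instead of E keeps the radicand
  -- positive.
  value-lower : ∀ A E q → 1 ℕ.≤ ‖ q ‖ℤ → (∀ s → E ℕ.* ‖ q ‖ℤ ℕ.^ n ℕ.≤ s ℕ.^ m → ¬ Near (A *ᵥ q) s) →
    ∀ {x} → Value A q x → 1# ≤ fromℕ (2 ℕ.^ m ℕ.* suc E) * x
  value-lower A E q 1≤q h {x} (d , dist , e) = begin
    1# ≈⟨ 1^ m ⟨
    1# ^ m ≤⟨ ^-mono-≤ m 0≤1 1≤sd ⟩
    (fromℕ s * d) ^ m ≈⟨ ^-distrib-* (fromℕ s) d m ⟩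
    fromℕ s ^ m * d ^ m ≈⟨ *-congʳ (fromℕ-^ s m) ⟨
    fromℕ (s ℕ.^ m) * d ^ m ≤⟨ *-monoʳ-≤ 0≤dᵐ (fromℕ-mono s≤) ⟩
    fromℕ (2 ℕ.^ m ℕ.* (suc E ℕ.* ‖ q ‖ℤ ℕ.^ n)) * d ^ m ≡⟨ ≡.cong (λ k → fromℕ k * d ^ m) (≡.sym (ℕP.*-assoc (2 ℕ.^ m) (suc E) (‖ q ‖ℤ ℕ.^ n))) ⟩
    fromℕ (2 ℕ.^ m ℕ.* suc E ℕ.* ‖ q ‖ℤ ℕ.^ n) * d ^ m ≈⟨ *-congʳ (fromℕ*^ (2 ℕ.^ m ℕ.* suc E) ‖ q ‖ℤ n) ⟩
    fromℕ (2 ℕ.^ m ℕ.* suc E) * fromℕ ‖ q ‖ℤ ^ n * d ^ m ≈⟨ *-assoc _ _ _ ⟩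
    fromℕ (2 ℕ.^ m ℕ.* suc E) * (fromℕ ‖ q ‖ℤ ^ n * d ^ m) ≈⟨ *-congˡ e ⟨
    fromℕ (2 ℕ.^ m ℕ.* suc E) * x ∎
    where
    open ≤-R
    X : ℕ
    X = suc E ℕ.* ‖ q ‖ℤ ℕ.^ n
    1≤X : 1 ℕ.≤ X
    1≤X = ℕP.*-mono-≤ {1} {suc E} (ℕ.s≤s ℕ.z≤n) (1≤n^d n 1≤q)
    s : ℕ
    s = proj₁ (root⁺ m′ X 1≤X)
    s≥ : X ℕ.≤ s ℕ.^ m
    s≥ = proj₁ (proj₂ (root⁺ m′ X 1≤X))
    s≤ : s ℕ.^ m ℕ.≤ 2 ℕ.^ m ℕ.* X
    s≤ = proj₂ (proj₂ (root⁺ m′ X 1≤X))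
    0≤dᵐ : 0# ≤ d ^ m
    0≤dᵐ = ^-nonNeg m (IsDist-nonNeg (A *ᵥ q) dist)
    1≤sd : 1# ≤ fromℕ s * d
    1≤sd with ≤-total 1# (fromℕ s * d)
    ... | inj₁ p = p
    ... | inj₂ p = ⊥-elim (h s (ℕP.≤-trans (ℕP.*-monoˡ-≤ (‖ q ‖ℤ ℕ.^ n) (ℕP.n≤1+n E)) s≥) (dist⇒Near (A *ᵥ q) s dist p))

  value-upper : ∀ A E q s → E ℕ.* ‖ q ‖ℤ ℕ.^ n ℕ.≤ s ℕ.^ m → Near (A *ᵥ q) s →
    ∀ {x} → Value A q x → fromℕ E * x ≤ 1#
  value-upper A E q s E≤ near {x} (d , dist , e) = begin
    fromℕ E * x ≈⟨ *-congˡ e ⟩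
    fromℕ E * (fromℕ ‖ q ‖ℤ ^ n * d ^ m) ≈⟨ *-assoc _ _ _ ⟨
    fromℕ E * fromℕ ‖ q ‖ℤ ^ n * d ^ m ≈⟨ *-congʳ (fromℕ*^ E ‖ q ‖ℤ n) ⟨
    fromℕ (E ℕ.* ‖ q ‖ℤ ℕ.^ n) * d ^ m ≤⟨ *-monoʳ-≤ 0≤dᵐ (fromℕ-mono E≤) ⟩
    fromℕ (s ℕ.^ m) * d ^ m ≈⟨ *-congʳ (fromℕ-^ s m) ⟩
    fromℕ s ^ m * d ^ m ≈⟨ ^-distrib-* (fromℕ s) d m ⟨
    (fromℕ s * d) ^ m ≤⟨ ^-mono-≤ m (*-nonNeg (fromℕ-nonNeg s) (IsDist-nonNeg (A *ᵥ q) dist)) (Near⇒dist (A *ᵥ q) s dist near) ⟩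
    1# ^ m ≈⟨ 1^ m ⟩
    1# ∎
    where
    open ≤-R
    0≤dᵐ : 0# ≤ d ^ m
    0≤dᵐ = ^-nonNeg m (IsDist-nonNeg (A *ᵥ q) dist)

  ¬WellApproximable⇒Bad : ∀ A → A ∈ [0,1⟩ᵐˣⁿ → ¬ WellApproximable A → A ∈ Bad⁰
  ¬WellApproximable⇒Bad A A∈ ¬wa with ¬∀⇒∃ ¬wa
  ... | E , ¬E with ¬∀⇒∃ ¬E
  ...   | N , ¬N = A∈ , proj₁ liminf , proj₂ liminf , positive (proj₁ liminf) [c]≤ℓ
    where
    c∃ : ∃[ c ] (fromℕ (2 ℕ.^ m ℕ.* suc E) * c ≈ 1# × 0# < c)
    c∃ = recip (fromℕ-pos (ℕP.*-mono-≤ {1} {2 ℕ.^ m} (ℕP.m^n>0 2 m) (ℕ.s≤s ℕ.z≤n)))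
    c : ℝ
    c = proj₁ c∃
    -- The maximum with 1 excludes q = 0, as `value-lower` requires.
    N₁ : ℕ
    N₁ = N ℕ.⊔ 1
    tailInf : ∃ (IsInf _≤⁺_ (TailValue A N₁))
    tailInf = inf⁺-exists (TailValue A N₁) (tailValue-inhabited A N₁) (TailValue-nonNeg A N₁)
    tailInfs : Pred ℝ⁺ 0ℓ
    tailInfs s = ∃[ k ] IsInf _≤⁺_ (TailValue A k) s
    finiteInf : ∀ s → IsInf _≤⁺_ (TailValue A N₁) s → ∃[ x ] IsInf _≤⁺_ (TailValue A N₁) [ x ]
    finiteInf [ x ] i = x , i
    finiteInf ⊤⁺ (lb , _) with lb [ proj₁ (tailValue-inhabited A N₁) ] (proj₂ (tailValue-inhabited A N₁))
    ... | ()
    liminf : ∃ (IsSup _≤⁺_ tailInfs)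
    liminf = sup⁺-exists tailInfs (let x , i = finiteInf (proj₁ tailInf) (proj₂ tailInf) in x , N₁ , i)
    lower : ∀ x → TailValue A N₁ x → [ c ] ≤⁺ x
    lower [ x ] (q , y , N₁≤ , v , [ e ]) = [ *-cancelˡ-≤ (fromℕ-pos (ℕP.*-mono-≤ {1} {2 ℕ.^ m} (ℕP.m^n>0 2 m) (ℕ.s≤s ℕ.z≤n)))
      (≤-trans (≤-reflexive (proj₁ (proj₂ c∃))) (≤-respʳ (*-congˡ (sym e)) (value-lower A E q (ℕP.≤-trans (ℕP.m≤n⊔m N 1) N₁≤)
        (λ s E≤ near → ¬N (q , s , ℕP.≤-trans (ℕP.m≤m⊔n N 1) N₁≤ , E≤ , near)) v))) ]
    [c]≤ℓ : [ c ] ≤⁺ proj₁ liminf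
    [c]≤ℓ = ≤⁺-trans ≤-trans (proj₂ (proj₂ tailInf) [ c ] lower)
      (proj₁ (proj₂ liminf) (proj₁ tailInf) (N₁ , proj₂ tailInf))
    positive : ∀ ℓ → [ c ] ≤⁺ ℓ → [ 0# ] <⁺ ℓ
    positive ⊤⁺ _ = [ 0# ]<⊤⁺
    positive [ x ] [ p ] = [ <-≤-trans (proj₂ (proj₂ c∃)) p ]

  -- Solutions of every quality E lie beyond every N, so all tail infima are at most 0, and with
  -- them their supremum.
  Bad⇒¬WellApproximable : ∀ A → A ∈ Bad⁰ → ¬ WellApproximable A
  Bad⇒¬WellApproximable A (_ , ℓ , (_ , lub) , 0<ℓ) wa = contra 0<ℓ (lub [ 0# ] λ { s (N , lb , _) → tail≤0 N s lb })
    where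
    contra : ∀ {ℓ} → [ 0# ] <⁺ ℓ → ¬ ℓ ≤⁺ [ 0# ]
    contra [ p ] [ q ] = <⇒≱ p q
    small : ∀ N ε → 0# < ε → ∃[ x ] TailValue A N [ x ] × x ≤ ε
    small N ε 0<ε with recip 0<ε
    ... | ε⁻¹ , ee , 0<ε⁻¹ with archimedean ε⁻¹
    ...   | E , ε⁻¹≤E with wa E N
    ...     | q , s , N≤ , E≤ , near = x , (q , x , N≤ , v , [ refl ]) ,
                *-cancelˡ-≤ (<-≤-trans 0<ε⁻¹ ε⁻¹≤E) (begin
                  fromℕ E * x ≤⟨ value-upper A E q s E≤ near v ⟩
                  1# ≈⟨ ee ⟨
                  ε * ε⁻¹ ≈⟨ *-comm ε ε⁻¹ ⟩
                  ε⁻¹ * ε ≤⟨ *-monoʳ-≤ (proj₁ 0<ε) ε⁻¹≤E ⟩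
                  fromℕ E * ε ∎)
      where
      open ≤-R
      d = distance (A *ᵥ q)
      x : ℝ
      x = fromℕ ‖ q ‖ℤ ^ n * proj₁ d ^ m
      v : Value A q x
      v = proj₁ d , proj₂ d , refl
    tail≤0 : ∀ N s → (∀ x → TailValue A N x → s ≤⁺ x) → s ≤⁺ [ 0# ]
    tail≤0 N ⊤⁺ lb with lb [ proj₁ (tailValue-inhabited A N) ] (proj₂ (tailValue-inhabited A N))
    ... | ()
    tail≤0 N [ s ] lb = [ ≤-ε (λ ε 0<ε → let x , t , x≤ε = small N ε 0<ε in
      ≤-respʳ (sym (+-identityˡ ε)) (≤-trans ([≤]⁻¹ (lb [ x ] t)) x≤ε)) ]

  -- From membership in Ω to recurrence

  ball : ℕ → List (Vec ℤ n)
  ball N = List.map Vec.tabulate (choices (λ _ → intRange N))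

  -- Lets `InfinitelyMany` be applied to a ball, so that it yields solutions of large norm.
  ∈-ball : ∀ {q N} → ‖ q ‖ℤ ℕ.≤ N → q ∈ᴸ ball N
  ∈-ball {q} {N} h = AnyP.map⁺ (Any.map (λ e → ≡.trans (≡.sym (VecP.tabulate∘lookup q)) (VecP.tabulate-cong e))
    (choices-Any (λ _ → intRange N) (λ i x → lookup q i ≡ x) (λ i → ∈-intRange (ℕP.≤-trans (∣lookup∣≤‖‖ℤ q i) h))))

  Near-anti : ∀ y {s t} → s ℕ.≤ t → Near y t → Near y s
  Near-anti y {s} {t} s≤t (p , h) = p , λ i → ≤-trans
    (*-monoʳ-≤ (∣∣-nonNeg (y i - fromℤ (p i))) (fromℕ-mono s≤t)) (h i)

  partialSum-+ : ∀ a M N → partialSum a (M ℕ.+ N) ≈ partialSum a M + partialSum (λ k → a (M ℕ.+ k)) N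
  partialSum-+ a zero N = sym (+-identityˡ _)
  partialSum-+ a (suc M) N = trans (+-congˡ (partialSum-+ (a ∘ suc) M N)) (sym (+-assoc _ _ _))

  partialSum-≥ : ∀ a N {c} → (∀ k → k ℕ.< N → c ≤ a k) → fromℕ N * c ≤ partialSum a N
  partialSum-≥ a zero {c} h = ≤-reflexive (zeroˡ c)
  partialSum-≥ a (suc N) {c} h = ≤-respˡ (sym (trans (distribʳ c 1# (fromℕ N)) (+-congʳ (*-identityˡ c))))
    (+-mono-≤ (h 0 (ℕ.s≤s ℕ.z≤n)) (partialSum-≥ (a ∘ suc) N (λ k k<N → h (suc k) (ℕ.s≤s k<N))))

  partialSum-≤ : ∀ a N {c} → (∀ k → k ℕ.< N → a k ≤ c) → partialSum a N ≤ fromℕ N * c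
  partialSum-≤ a zero {c} h = ≤-reflexive (sym (zeroˡ c))
  partialSum-≤ a (suc N) {c} h = ≤-respʳ (sym (trans (distribʳ c 1# (fromℕ N)) (+-congʳ (*-identityˡ c))))
    (+-mono-≤ (h 0 (ℕ.s≤s ℕ.z≤n)) (partialSum-≤ (a ∘ suc) N (λ k k<N → h (suc k) (ℕ.s≤s k<N))))

  partialSum-nonNeg : ∀ a N → (∀ k → 0# ≤ a k) → 0# ≤ partialSum a N
  partialSum-nonNeg a zero h = ≤-refl
  partialSum-nonNeg a (suc N) h = +-nonNeg (h 0) (partialSum-nonNeg (a ∘ suc) N (h ∘ suc))

  partialSum-mono : ∀ a {M N} → (∀ k → 0# ≤ a k) → M ℕ.≤ N → partialSum a M ≤ partialSum a N
  partialSum-mono a {M} {N} h M≤N = ≡.subst (λ k → partialSum a M ≤ partialSum a k) (ℕP.m+[n∸m]≡n M≤N)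
    (≤-respʳ (sym (partialSum-+ a M (N ℕ.∸ M)))
      (≤-respˡ (+-identityʳ _) (+-monoʳ-≤ (partialSum a M) (partialSum-nonNeg (λ k → a (M ℕ.+ k)) (N ℕ.∸ M) (λ k → h (M ℕ.+ k))))))

  divergent : ∀ a {c} → 0# < c → (∀ N → ∃[ N′ ] partialSum a N + c ≤ partialSum a N′) → IsSeriesSum a ⊤⁺
  divergent a {c} 0<c grow = (λ x _ → x ≤⊤⁺) , λ { ⊤⁺ _ → _ ≤⊤⁺ ; [ u ] ub → ⊥-elim (absurd u ub) }
    where
    reach : ∀ j → ∃[ N ] fromℕ j * c ≤ partialSum a N
    reach zero = 0 , ≤-reflexive (zeroˡ c)
    reach (suc j) = let N , p = reach j ; N′ , q = grow N in N′ ,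
      ≤-trans (≤-reflexive (trans (distribʳ c 1# (fromℕ j)) (trans (+-comm _ _) (+-congˡ (*-identityˡ c)))))
        (≤-trans (+-mono-≤ p ≤-refl) q)
    absurd : ∀ u → IsUpperBound _≤⁺_ (λ x → ∃[ N ] x ≈⁺ [ partialSum a N ]) [ u ] → ⊥
    absurd u ub with recip 0<c
    ... | c⁻¹ , e , _ with archimedean (u * c⁻¹ + 1#)
    ...   | j , h with reach j
    ...     | N , p = 1≰0 (lin₂ h j≤ (lemma (u * c⁻¹) (fromℕ j)))
      where
      lemma : ∀ x j → (j - (x + 1#)) + (x - j) ≈ 0# - 1#
      lemma = solve 2 (λ x j → (j :- (x :+ con (+ 1))) :+ (x :- j) := con (+ 0) :- con (+ 1)) refl
      eq : ∀ c u i → c * (u * i) ≈ (c * i) * u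
      eq = solve 3 (λ c u i → c :* (u :* i) := (c :* i) :* u) refl
      open ≤-R
      j≤ : fromℕ j ≤ u * c⁻¹
      j≤ = *-cancelˡ-≤ 0<c (begin
        c * fromℕ j ≈⟨ *-comm c (fromℕ j) ⟩
        fromℕ j * c ≤⟨ p ⟩
        partialSum a N ≤⟨ [≤]⁻¹ (ub [ partialSum a N ] (N , [ refl ])) ⟩
        u ≈⟨ *-identityˡ u ⟨
        1# * u ≈⟨ *-congʳ e ⟨
        c * c⁻¹ * u ≈⟨ eq c u c⁻¹ ⟨
        c * (u * c⁻¹) ∎)

  recip-antitone : ∀ {x y x⁻¹ y⁻¹} → 0# < x → 0# < y → x * x⁻¹ ≈ 1# → y * y⁻¹ ≈ 1# → x ≤ y → y⁻¹ ≤ x⁻¹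
  recip-antitone {x} {y} {x⁻¹} {y⁻¹} 0<x 0<y ex ey x≤y = *-cancelˡ-≤ (*-pos 0<x 0<y) (begin
    x * y * y⁻¹ ≈⟨ trans (*-assoc x y y⁻¹) (trans (*-congˡ ey) (*-identityʳ x)) ⟩
    x ≤⟨ x≤y ⟩
    y ≈⟨ trans (lemma x y x⁻¹) (trans (*-congˡ ex) (*-identityʳ y)) ⟨
    x * y * x⁻¹ ∎)
    where
    open ≤-R
    lemma : ∀ x y i → x * y * i ≈ y * (x * i)
    lemma = solve 3 (λ x y i → x :* y :* i := y :* (x :* i)) refl

  module BlockFunction (A : Matrix) (γ : Vector ℝ m) (C T₀ : ℕ)
    (scale : ∀ T → T₀ ℕ.≤ T → ∃[ h ] ∃[ s ] T ℕ.≤ h × s ℕ.^ m ℕ.≤ C ℕ.* h ℕ.^ n ×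
      (∀ q → T ℕ.≤ ‖ q ‖ℤ → ‖ q ‖ℤ ℕ.≤ 2 ℕ.* h → ¬ Near (A *ᵥ q -ᵥ γ) s)) where

    record Block : Set where
      field
        T h σ : ℕ
        T₀≤T : T₀ ℕ.≤ T
        1≤T : 1 ℕ.≤ T
        T≤h : T ℕ.≤ h
        1≤σ : 1 ℕ.≤ σ
        σ-bound : σ ℕ.^ m ℕ.≤ suc C ℕ.* h ℕ.^ n
        far : ∀ q → T ℕ.≤ ‖ q ‖ℤ → ‖ q ‖ℤ ℕ.≤ 2 ℕ.* h → ¬ Near (A *ᵥ q -ᵥ γ) σ
    open Block

    -- Taking the maximum with the previous σ makes ψ decreasing. It keeps the window free of
    -- solutions, since a larger σ asks for more nearness, and it respects the bound, since h only
    -- grows. With `suc C` the bound also admits the initial σ = 1 when C = 0.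
    block : ∀ T σ → T₀ ℕ.≤ T → 1 ℕ.≤ T → 1 ℕ.≤ σ → σ ℕ.^ m ℕ.≤ suc C ℕ.* T ℕ.^ n → Block
    block T σ T₀≤T 1≤T 1≤σ σ≤ = record
      { T = T ; h = h′ ; σ = s ℕ.⊔ σ ; T₀≤T = T₀≤T ; 1≤T = 1≤T ; T≤h = T≤h′
      ; 1≤σ = ℕP.≤-trans 1≤σ (ℕP.m≤n⊔m s σ) ; σ-bound = bound (ℕP.⊔-sel s σ)
      ; far = λ q lo hi near → far′ q lo hi (Near-anti (A *ᵥ q -ᵥ γ) (ℕP.m≤m⊔n s σ) near) }
      where
      h′ = proj₁ (scale T T₀≤T)
      s = proj₁ (proj₂ (scale T T₀≤T))
      T≤h′ = proj₁ (proj₂ (proj₂ (scale T T₀≤T)))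
      s≤ = proj₁ (proj₂ (proj₂ (proj₂ (scale T T₀≤T))))
      far′ = proj₂ (proj₂ (proj₂ (proj₂ (scale T T₀≤T))))
      bound : s ℕ.⊔ σ ≡ s ⊎ s ℕ.⊔ σ ≡ σ → (s ℕ.⊔ σ) ℕ.^ m ℕ.≤ suc C ℕ.* h′ ℕ.^ n
      bound (inj₁ e) = ℕP.≤-trans (ℕP.≤-reflexive (≡.cong (ℕ._^ m) e))
        (ℕP.≤-trans s≤ (ℕP.*-monoˡ-≤ (h′ ℕ.^ n) (ℕP.n≤1+n C)))
      bound (inj₂ e) = ℕP.≤-trans (ℕP.≤-reflexive (≡.cong (ℕ._^ m) e))
        (ℕP.≤-trans σ≤ (ℕP.*-monoʳ-≤ (suc C) (ℕP.^-monoˡ-≤ n T≤h′)))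

    initial : Block
    initial = block (T₀ ℕ.⊔ 1) 1 (ℕP.m≤m⊔n T₀ 1) (ℕP.m≤n⊔m T₀ 1) ℕP.≤-refl
      (ℕP.≤-trans (ℕP.≤-reflexive (ℕP.^-zeroˡ m)) (ℕP.*-mono-≤ {1} {suc C} (ℕ.s≤s ℕ.z≤n)
        (1≤n^d n (ℕP.m≤n⊔m T₀ 1))))

    end : Block → ℕ
    end B = 2 ℕ.* h B

    h≤end : ∀ B → h B ℕ.≤ end B
    h≤end B = ℕP.m≤n*m (h B) 2

    T≤end : ∀ B → T B ℕ.≤ end B
    T≤end B = ℕP.≤-trans (T≤h B) (h≤end B)

    next : Block → Block
    next B = block (suc (end B)) (σ B) (ℕP.≤-trans (T₀≤T B) (ℕP.m≤n⇒m≤1+n (T≤end B))) (ℕ.s≤s ℕ.z≤n) (1≤σ B)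
      (ℕP.≤-trans (σ-bound B) (ℕP.*-monoʳ-≤ (suc C) (ℕP.^-monoˡ-≤ n (ℕP.m≤n⇒m≤1+n (h≤end B)))))

    advance : ∀ B q → Dec (q ℕ.≤ end B) → Block
    advance B q (yes _) = B
    advance B q (no _) = next B

    -- The block in force at argument q. It changes exactly when q passes the end of the block,
    -- where the next window begins, so the windows leave no gap.
    state : ℕ → Block
    state zero = initial
    state (suc q) = advance (state q) (suc q) (suc q ℕP.≤? end (state q))

    q≤end : ∀ q → q ℕ.≤ end (state q)
    q≤end zero = ℕ.z≤n
    q≤end (suc q) with suc q ℕP.≤? end (state q)
    ... | yes p = p
    ... | no ¬p = ℕP.≤-trans (ℕ.s≤s (q≤end q)) (T≤end (next (state q)))

    -- The first block is in force already before its window begins, whence the maximum.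
    T≤q : ∀ q → T (state q) ℕ.≤ q ℕ.⊔ T initial
    T≤q zero = ℕP.≤-refl
    T≤q (suc q) with suc q ℕP.≤? end (state q)
    ... | yes p = ℕP.≤-trans (T≤q q) (ℕP.⊔-monoˡ-≤ (T initial) (ℕP.n≤1+n q))
    ... | no ¬p = ℕP.≤-trans (ℕP.≰⇒> ¬p) (ℕP.m≤m⊔n (suc q) (T initial))

    σ-suc : ∀ q → σ (state q) ℕ.≤ σ (state (suc q))
    σ-suc q with suc q ℕP.≤? end (state q)
    ... | yes p = ℕP.≤-refl
    ... | no ¬p = ℕP.m≤n⊔m (proj₁ (proj₂ (scale (suc (end (state q))) T₀≤))) (σ (state q))
      where
      T₀≤ : T₀ ℕ.≤ suc (end (state q))
      T₀≤ = ℕP.≤-trans (T₀≤T (state q)) (ℕP.m≤n⇒m≤1+n (T≤end (state q)))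

    σ-mono : ∀ q k → σ (state q) ℕ.≤ σ (state (k ℕ.+ q))
    σ-mono q zero = ℕP.≤-refl
    σ-mono q (suc k) = ℕP.≤-trans (σ-mono q k) (σ-suc (k ℕ.+ q))

    stay : ∀ q k {B} → state q ≡ B → k ℕ.+ q ℕ.≤ end B → state (k ℕ.+ q) ≡ B
    stay q zero e _ = e
    stay q (suc k) {B} e h with stay q k e (ℕP.≤-trans (ℕP.n≤1+n (k ℕ.+ q)) h)
    ... | e′ rewrite e′ with suc (k ℕ.+ q) ℕP.≤? end B
    ...   | yes _ = ≡.refl
    ...   | no ¬p = ⊥-elim (¬p h)

    state-next : ∀ q {B} → state q ≡ B → state (suc (end B)) ≡ next B
    state-next q {B} ≡.refl = go (≡.subst (λ k → state k ≡ B) (ℕP.m∸n+n≡m (q≤end q))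
        (stay q (end B ℕ.∸ q) ≡.refl (ℕP.≤-reflexive (ℕP.m∸n+n≡m (q≤end q)))))
      where
      go : state (end B) ≡ B → state (suc (end B)) ≡ next B
      go e rewrite e with suc (end B) ℕP.≤? end B
      ... | yes p = ⊥-elim (ℕP.1+n≰n p)
      ... | no _ = ≡.refl

    abstract
      σ⁻¹ : ∀ B → ∃[ x ] (fromℕ (σ B) * x ≈ 1# × 0# < x)
      σ⁻¹ B = recip (fromℕ-pos (1≤σ B))

    ψ : ℕ → ℝ
    ψ q = proj₁ (σ⁻¹ (state q))

    ψ-pos : ∀ q → 0# < ψ q
    ψ-pos q = proj₂ (proj₂ (σ⁻¹ (state q)))

    ψ-decreasing : ψ ∈ Decreasing
    ψ-decreasing {q} {r} q≤r = recip-antitone (fromℕ-pos (1≤σ (state q))) (fromℕ-pos (1≤σ (state r)))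
      (proj₁ (proj₂ (σ⁻¹ (state q)))) (proj₁ (proj₂ (σ⁻¹ (state r))))
      (fromℕ-mono (≡.subst (λ k → σ (state q) ℕ.≤ σ (state k)) (ℕP.m∸n+n≡m q≤r) (σ-mono q (r ℕ.∸ q))))

    term : ℕ → ℝ
    term k = fromℕ (suc k) ^ n′ * ψ (suc k) ^ m

    term-nonNeg : ∀ k → 0# ≤ term k
    term-nonNeg k = *-nonNeg (^-nonNeg n′ (fromℕ-nonNeg (suc k))) (^-nonNeg m (proj₁ (ψ-pos (suc k))))

    abstract
      c∃ : ∃[ c ] (fromℕ (suc C) * c ≈ 1# × 0# < c)
      c∃ = recip (fromℕ-pos {suc C} (ℕ.s≤s ℕ.z≤n))
    c : ℝ
    c = proj₁ c∃

    grow : ∀ N → ∃[ N′ ] partialSum term N + c ≤ partialSum term N′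
    -- The indices h, ..., 2h - 1 stand for the arguments h + 1, ..., 2h, all within the next block.
    -- Each term is at least h^(n-1)/σ^m, and by `σ-bound` the h of them add up to at least c = 1/(C
    -- + 1).
    grow N = h B ℕ.+ h B , (begin
      partialSum term N + c
        ≤⟨ +-mono-≤ (partialSum-mono term term-nonNeg N≤h) c≤ ⟩
      partialSum term (h B) + fromℕ (h B) * (fromℕ (h B) ^ n′ * ρ ^ m)
        ≤⟨ +-monoʳ-≤ (partialSum term (h B)) (partialSum-≥ (λ k → term (h B ℕ.+ k)) (h B) term≥) ⟩
      partialSum term (h B) + partialSum (λ k → term (h B ℕ.+ k)) (h B)
        ≈⟨ partialSum-+ term (h B) (h B) ⟨
      partialSum term (h B ℕ.+ h B) ∎)
      where
      open ≤-R
      B : Block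
      B = next (state N)
      ρ : ℝ
      ρ = proj₁ (σ⁻¹ B)
      N≤h : N ℕ.≤ h B
      N≤h = ℕP.≤-trans (ℕP.m≤n⇒m≤1+n (q≤end N)) (T≤h B)
      in-block : ∀ k → T B ℕ.≤ k → k ℕ.≤ end B → state k ≡ B
      in-block k lo hi = ≡.subst (λ k → state k ≡ B) (ℕP.m∸n+n≡m lo)
        (stay (T B) (k ℕ.∸ T B) (state-next N ≡.refl) (≡.subst (ℕ._≤ end B) (≡.sym (ℕP.m∸n+n≡m lo)) hi))
      term≥ : ∀ k → k ℕ.< h B → fromℕ (h B) ^ n′ * ρ ^ m ≤ term (h B ℕ.+ k)
      term≥ k k<h = *-mono-≤ (^-nonNeg n′ (fromℕ-nonNeg (h B))) (^-nonNeg m (proj₁ (ψ-pos (suc (h B ℕ.+ k)))))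
        (^-mono-≤ n′ (fromℕ-nonNeg (h B)) (fromℕ-mono (ℕP.m≤n⇒m≤1+n (ℕP.m≤m+n (h B) k))))
        (≤-reflexive (reflexive (≡.cong (λ S → proj₁ (σ⁻¹ S) ^ m) (≡.sym (in-block (suc (h B ℕ.+ k))
          (ℕP.≤-trans (T≤h B) (ℕP.m≤n⇒m≤1+n (ℕP.m≤m+n (h B) k)))
          (ℕP.≤-trans (ℕP.≤-reflexive (≡.sym (ℕP.+-suc (h B) k)))
            (ℕP.≤-trans (ℕP.+-monoʳ-≤ (h B) k<h) (ℕP.≤-reflexive (n+n≡2*n (h B))))))))))
      ρσ : fromℕ (σ B) ^ m * ρ ^ m ≈ 1#
      ρσ = trans (sym (^-distrib-* (fromℕ (σ B)) ρ m)) (trans (^-congˡ m (proj₁ (proj₂ (σ⁻¹ B)))) (1^ m))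
      c≤ : c ≤ fromℕ (h B) * (fromℕ (h B) ^ n′ * ρ ^ m)
      c≤ = *-cancelˡ-≤ (fromℕ-pos {suc C} (ℕ.s≤s ℕ.z≤n)) (begin
        fromℕ (suc C) * c ≈⟨ proj₁ (proj₂ c∃) ⟩
        1# ≈⟨ ρσ ⟨
        fromℕ (σ B) ^ m * ρ ^ m ≈⟨ *-congʳ (fromℕ-^ (σ B) m) ⟨
        fromℕ (σ B ℕ.^ m) * ρ ^ m ≤⟨ *-monoʳ-≤ (^-nonNeg m (proj₁ (proj₂ (proj₂ (σ⁻¹ B))))) (fromℕ-mono (σ-bound B)) ⟩
        fromℕ (suc C ℕ.* h B ℕ.^ n) * ρ ^ m ≈⟨ *-congʳ (fromℕ*^ (suc C) (h B) n) ⟩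
        fromℕ (suc C) * (fromℕ (h B) * fromℕ (h B) ^ n′) * ρ ^ m ≈⟨ trans (*-assoc _ _ _) (*-congˡ (*-assoc _ _ _)) ⟩
        fromℕ (suc C) * (fromℕ (h B) * (fromℕ (h B) ^ n′ * ρ ^ m)) ∎)

    ψ∈𝒟 : ψ ∈ 𝒟
    ψ∈𝒟 = (λ q → proj₁ (ψ-pos q)) , ψ-decreasing , divergent term (proj₂ (proj₂ c∃)) grow

    ∉W : ¬ (A , γ) ∈ W ψ
    -- A solution outside this ball has norm beyond the start of the first window, so it lies inside
    -- the window of its block.
    ∉W (_ , _ , inf) with inf (ball (T initial))
    ... | q , (d , dist , d<ψ) , q∉ = far B q lo (q≤end ‖ q ‖ℤ) (dist⇒Near (A *ᵥ q -ᵥ γ) (σ B) dist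
        (≤-respʳ (proj₁ (proj₂ (σ⁻¹ B))) (*-monoˡ-≤ (fromℕ-nonNeg (σ B)) (proj₁ d<ψ))))
      where
      B : Block
      B = state ‖ q ‖ℤ
      lo : T B ℕ.≤ ‖ q ‖ℤ
      lo = ℕP.≤-trans (T≤q ‖ q ‖ℤ) (ℕP.⊔-lub ℕP.≤-refl (ℕP.<⇒≤ (ℕP.≰⇒> (λ p → q∉ (∈-ball p)))))

  Recurrent : Matrix → Vector ℝ m → ℕ → ℕ → Set
  Recurrent A γ C T = ∀ h s → T ℕ.≤ h → s ℕ.^ m ℕ.≤ C ℕ.* h ℕ.^ n →
    ∃[ q ] T ℕ.≤ ‖ q ‖ℤ × ‖ q ‖ℤ ℕ.≤ 2 ℕ.* h × Near (A *ᵥ q -ᵥ γ) s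

  abstract
    -- The blocks may start anywhere, so the scale of recurrence can be pushed beyond any T₀; this
    -- later produces a second solution of larger norm.
    Ω⇒Recurrent : ∀ A γ → (A , γ) ∈ Ω → ∀ C T₀ → ∃[ T ] T₀ ℕ.≤ T × Recurrent A γ C T
    Ω⇒Recurrent A γ ω C T₀ = by-contra λ ¬∃ → BF.∉W ¬∃ (ω (BF.ψ ¬∃) (BF.ψ∈𝒟 ¬∃))
      where
      scale : ¬ (∃[ T ] T₀ ℕ.≤ T × Recurrent A γ C T) → ∀ T → T₀ ℕ.≤ T → ∃[ h ] ∃[ s ] T ℕ.≤ h × s ℕ.^ m ℕ.≤ C ℕ.* h ℕ.^ n ×
        (∀ q → T ℕ.≤ ‖ q ‖ℤ → ‖ q ‖ℤ ℕ.≤ 2 ℕ.* h → ¬ Near (A *ᵥ q -ᵥ γ) s)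
      scale ¬∃ T T₀≤T = by-contra λ ¬s → ¬∃ (T , T₀≤T , λ h s T≤h s≤ → by-contra λ ¬q →
        ¬s (h , s , T≤h , s≤ , λ q lo hi near → ¬q (q , lo , hi , near)))
      module BF (¬∃ : ¬ (∃[ T ] T₀ ℕ.≤ T × Recurrent A γ C T)) = BlockFunction A γ C T₀ (scale ¬∃)

  -- Badly approximable matrices have empty fibres

  ‖‖ℤ-attained : ∀ q → ∃[ j ] ℤ.∣ lookup q j ∣ ≡ ‖ q ‖ℤ
  ‖‖ℤ-attained q = let j , h = argmax (lookup q) in j , ℕP.≤-antisym (∣lookup∣≤‖‖ℤ q j) (‖‖ℤ-lub q h)

  ‖⊙‖≥ : ∀ k q → ℤ.∣ k ∣ ℕ.* ‖ q ‖ℤ ℕ.≤ ‖ k ⊙ q ‖ℤ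
  ‖⊙‖≥ k q = let j , e = ‖‖ℤ-attained q in
    ≡.subst (λ x → ℤ.∣ k ∣ ℕ.* x ℕ.≤ ‖ k ⊙ q ‖ℤ) e
      (ℕP.≤-trans (ℕP.≤-reflexive (≡.sym (≡.trans (≡.cong ℤ.∣_∣ (lookup-⊙ k j q)) (ℤP.abs-* k (lookup q j)))))
        (∣lookup∣≤‖‖ℤ (k ⊙ q) j))

  lookup-injective : ∀ {q r : Vec ℤ n} → (∀ i → lookup q i ≡ lookup r i) → q ≡ r
  lookup-injective {q} {r} e = ≡.trans (≡.sym (VecP.tabulate∘lookup q)) (≡.trans (VecP.tabulate-cong e) (VecP.tabulate∘lookup r))

  infixl 6 _⊖_
  _⊖_ : Vec ℤ n → Vec ℤ n → Vec ℤ n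
  q ⊖ r = q ⊕ ℤ.-1ℤ ⊙ r

  ‖⊖‖≤ : ∀ q r → ‖ q ⊖ r ‖ℤ ℕ.≤ ‖ q ‖ℤ ℕ.+ ‖ r ‖ℤ
  ‖⊖‖≤ q r = ℕP.≤-trans (‖⊕‖≤ q (ℤ.-1ℤ ⊙ r))
    (ℕP.+-monoʳ-≤ ‖ q ‖ℤ (ℕP.≤-trans (‖⊙‖≤ ℤ.-1ℤ r) (ℕP.≤-reflexive (ℕP.*-identityˡ ‖ r ‖ℤ))))

  ‖⊖‖≡0⇒≡ : ∀ {q r} → ‖ q ⊖ r ‖ℤ ≡ 0 → q ≡ r
  ‖⊖‖≡0⇒≡ {q} {r} e = lookup-injective λ i → ℤP.i-j≡0⇒i≡j (lookup q i) (lookup r i)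
    (≡.trans (≡.sym (≡.trans (lookup-⊕ i q (ℤ.-1ℤ ⊙ r)) (≡.cong (λ z → lookup q i ℤ.+ z) (≡.trans (lookup-⊙ ℤ.-1ℤ i r) (ℤP.-1*i≡-i (lookup r i))))))
      (ℤP.∣i∣≡0⇒i≡0 (ℕP.n≤0⇒n≡0 (ℕP.≤-trans (∣lookup∣≤‖‖ℤ (q ⊖ r) i) (ℕP.≤-reflexive e)))))

  *ᵥ-⊖ : ∀ A q r i → (A *ᵥ (q ⊖ r)) i ≈ (A *ᵥ q) i - (A *ᵥ r) i
  *ᵥ-⊖ A q r i = trans (*ᵥ-⊕ A q (ℤ.-1ℤ ⊙ r) i) (+-congˡ (trans (*ᵥ-⊙ A ℤ.-1ℤ r i)
    (trans (sym (-‿distribˡ-* (fromℕ 1) ((A *ᵥ r) i))) (-‿cong (trans (*-congʳ fromℕ-1) (*-identityˡ ((A *ᵥ r) i)))))))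

  x+x≤1⇒x+y≤1 : ∀ {x y} → x + x ≤ 1# → y + y ≤ 1# → x + y ≤ 1#
  x+x≤1⇒x+y≤1 {x} {y} p q with ≤-total x y
  ... | inj₁ r = ≤-trans (+-mono-≤ r ≤-refl) q
  ... | inj₂ r = ≤-trans (+-monoʳ-≤ x r) p

  double : ∀ t x → fromℕ (t ℕ.+ t) * x ≈ fromℕ t * x + fromℕ t * x
  double t x = trans (*-congʳ (fromℕ-+ t t)) (distribʳ x (fromℕ t) (fromℕ t))

  Near-difference : ∀ y z w t → (∀ i → w i ≈ y i - z i) → Near y (t ℕ.+ t) → Near z (t ℕ.+ t) → Near w t
  Near-difference y z w t e (p , hp) (q , hq) = (λ i → p i ℤ.- q i) , λ i → begin
    fromℕ t * ∣ w i - fromℤ (p i ℤ.- q i) ∣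
      ≈⟨ *-congˡ (∣∣-cong (trans (+-cong (e i) (-‿cong (trans (fromℤ-+ (p i) (ℤ.- q i)) (+-congˡ (fromℤ-neg (q i))))))
           (lemma (y i) (z i) (fromℤ (p i)) (fromℤ (q i))))) ⟩
    fromℕ t * ∣ (y i - fromℤ (p i)) + - (z i - fromℤ (q i)) ∣
      ≤⟨ *-monoˡ-≤ (fromℕ-nonNeg t) (∣∣-+ (y i - fromℤ (p i)) (- (z i - fromℤ (q i)))) ⟩
    fromℕ t * (∣ y i - fromℤ (p i) ∣ + ∣ - (z i - fromℤ (q i)) ∣)
      ≈⟨ trans (*-congˡ (+-congˡ (∣∣-neg (z i - fromℤ (q i))))) (distribˡ (fromℕ t) _ _) ⟩
    fromℕ t * ∣ y i - fromℤ (p i) ∣ + fromℕ t * ∣ z i - fromℤ (q i) ∣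
      ≤⟨ x+x≤1⇒x+y≤1 (≤-respˡ (double t ∣ y i - fromℤ (p i) ∣) (hp i)) (≤-respˡ (double t ∣ z i - fromℤ (q i) ∣) (hq i)) ⟩
    1# ∎
    where
    open ≤-R
    lemma : ∀ y z p q → (y - z) - (p - q) ≈ (y - p) + - (z - q)
    lemma = solve 4 (λ y z p q → (y :- z) :- (p :- q) := (y :- p) :+ :- (z :- q)) refl

  Near-multiple : ∀ A q k s → Near (A *ᵥ q) (k ℕ.* s) → Near (A *ᵥ (+ k ⊙ q)) s
  Near-multiple A q k s (p , h) = (λ i → + k ℤ.* p i) , λ i → begin
    fromℕ s * ∣ (A *ᵥ (+ k ⊙ q)) i - fromℤ (+ k ℤ.* p i) ∣
      ≈⟨ *-congˡ (∣∣-cong (trans (+-cong (*ᵥ-⊙ A (+ k) q i) (-‿cong (fromℤ-* (+ k) (p i)))) (lemma (fromℕ k) ((A *ᵥ q) i) (fromℤ (p i))))) ⟩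
    fromℕ s * ∣ fromℕ k * ((A *ᵥ q) i - fromℤ (p i)) ∣
      ≈⟨ *-congˡ (∣∣-scale (fromℕ-nonNeg k) ((A *ᵥ q) i - fromℤ (p i))) ⟩
    fromℕ s * (fromℕ k * ∣ (A *ᵥ q) i - fromℤ (p i) ∣)
      ≈⟨ trans (sym (*-assoc (fromℕ s) (fromℕ k) _)) (*-congʳ (trans (*-comm (fromℕ s) (fromℕ k)) (sym (fromℕ-* k s)))) ⟩
    fromℕ (k ℕ.* s) * ∣ (A *ᵥ q) i - fromℤ (p i) ∣
      ≤⟨ h i ⟩
    1# ∎
    where
    open ≤-R
    lemma : ∀ k y p → k * y - k * p ≈ k * (y - p)
    lemma = solve 3 (λ k y p → k :* y :- k :* p := k :* (y :- p)) refl

  -- The failure of well approximability for all nonzero q, not only those of large norm; in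
  -- exchange the distance is only bounded below by 1/(k s).
  Separated : Matrix → ℕ → ℕ → Set
  Separated A E k = ∀ q s → 1 ℕ.≤ ‖ q ‖ℤ → E ℕ.* ‖ q ‖ℤ ℕ.^ n ℕ.≤ s ℕ.^ m → ¬ Near (A *ᵥ q) (k ℕ.* s)

  -- Small q are excluded through their multiples k q, whose norms are large.
  ¬WellApproximable⇒Separated : ∀ A → ¬ WellApproximable A → ∃[ E ] ∃[ k ] Separated A E k
  ¬WellApproximable⇒Separated A ¬wa with ¬∀⇒∃ ¬wa
  ... | E , ¬E with ¬∀⇒∃ ¬E
  ...   | N , ¬N = E ℕ.* k ℕ.^ n , k , λ q s 1≤q E≤ near → ¬N (+ k ⊙ q , s ,
            ℕP.≤-trans (ℕP.m≤m⊔n N 1) (ℕP.≤-trans (ℕP.m≤m*n k ‖ q ‖ℤ {{ℕ.>-nonZero 1≤q}}) (‖⊙‖≥ (+ k) q)) ,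
            (let open ℕP.≤-Reasoning in begin
              E ℕ.* ‖ + k ⊙ q ‖ℤ ℕ.^ n ≤⟨ ℕP.*-monoʳ-≤ E (ℕP.^-monoˡ-≤ n (‖⊙‖≤ (+ k) q)) ⟩
              E ℕ.* (k ℕ.* ‖ q ‖ℤ) ℕ.^ n ≡⟨ ≡.cong (E ℕ.*_) (^-distribʳ-* n k ‖ q ‖ℤ) ⟩
              E ℕ.* (k ℕ.^ n ℕ.* ‖ q ‖ℤ ℕ.^ n) ≡⟨ ℕP.*-assoc E (k ℕ.^ n) (‖ q ‖ℤ ℕ.^ n) ⟨
              E ℕ.* k ℕ.^ n ℕ.* ‖ q ‖ℤ ℕ.^ n ≤⟨ E≤ ⟩
              s ℕ.^ m ∎) ,
            Near-multiple A q k s near)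
    where
    k : ℕ
    k = N ℕ.⊔ 1

  module Separation (A : Matrix) (E k : ℕ) (separated : Separated A E k) (γ : Vector ℝ m) where

    -- If q and r have norm at most 2(2τ)ᵐ, their difference has norm at most 4·2ᵐ τᵐ, and c₁ makes
    -- E times the n-th power of this at most (c₁ τⁿ)ᵐ. In c₀ = 2 k c₁, the k comes from `Separated`
    -- and the 2 from `Near-difference`.
    c₁ c₀ : ℕ
    c₁ = E ℕ.* (4 ℕ.* 2 ℕ.^ m) ℕ.^ n
    c₀ = k ℕ.* c₁ ℕ.+ k ℕ.* c₁

    -- Paired with h = τᵐ: then sᵐ = c₀ᵐ hⁿ exactly, so recurrence applies without roots.
    s : ℕ → ℕ
    s τ = c₀ ℕ.* τ ℕ.^ n

    s≡ : ∀ τ → s τ ≡ k ℕ.* (c₁ ℕ.* τ ℕ.^ n) ℕ.+ k ℕ.* (c₁ ℕ.* τ ℕ.^ n)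
    s≡ τ = lemma k c₁ (τ ℕ.^ n)
      where
      lemma : ∀ k c x → (k ℕ.* c ℕ.+ k ℕ.* c) ℕ.* x ≡ k ℕ.* (c ℕ.* x) ℕ.+ k ℕ.* (c ℕ.* x)
      lemma = ℕ-Solver.solve-∀

    ^-^-comm : ∀ a i j → (a ℕ.^ i) ℕ.^ j ≡ (a ℕ.^ j) ℕ.^ i
    ^-^-comm a i j = ≡.trans (ℕP.^-*-assoc a i j) (≡.trans (≡.cong (a ℕ.^_) (ℕP.*-comm i j)) (≡.sym (ℕP.^-*-assoc a j i)))

    abstract
      -- The difference of two distinct solutions would contradict separation. The norms are allowed
      -- up to the end of the window of 2τ, so that the solutions found at τ and at τ + 1 can be
      -- compared.
      unique : ∀ τ q r → ‖ q ‖ℤ ℕ.≤ 2 ℕ.* (2 ℕ.* τ) ℕ.^ m → ‖ r ‖ℤ ℕ.≤ 2 ℕ.* (2 ℕ.* τ) ℕ.^ m →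
        Near (A *ᵥ q -ᵥ γ) (s τ) → Near (A *ᵥ r -ᵥ γ) (s τ) → q ≡ r
      unique τ q r ‖q‖≤ ‖r‖≤ nq nr with ‖ q ⊖ r ‖ℤ ℕP.≟ 0
      ... | yes e = ‖⊖‖≡0⇒≡ e
      ... | no ne = ⊥-elim (separated (q ⊖ r) (c₁ ℕ.* τ ℕ.^ n) (ℕP.n≢0⇒n>0 ne) E≤
            (Near-difference (A *ᵥ q -ᵥ γ) (A *ᵥ r -ᵥ γ) (A *ᵥ (q ⊖ r)) (k ℕ.* (c₁ ℕ.* τ ℕ.^ n))
              (λ i → trans (*ᵥ-⊖ A q r i) (lemma ((A *ᵥ q) i) ((A *ᵥ r) i) (γ i)))
              (≡.subst (Near (A *ᵥ q -ᵥ γ)) (s≡ τ) nq) (≡.subst (Near (A *ᵥ r -ᵥ γ)) (s≡ τ) nr)))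
        where
        lemma : ∀ x y g → x - y ≈ (x - g) - (y - g)
        lemma = solve 3 (λ x y g → x :- y := (x :- g) :- (y :- g)) refl
        regroup : ∀ a b → 2 ℕ.* (a ℕ.* b) ℕ.+ 2 ℕ.* (a ℕ.* b) ≡ 4 ℕ.* a ℕ.* b
        regroup = ℕ-Solver.solve-∀
        norm≤ : ‖ q ⊖ r ‖ℤ ℕ.≤ 4 ℕ.* 2 ℕ.^ m ℕ.* τ ℕ.^ m
        norm≤ = ℕP.≤-trans (‖⊖‖≤ q r) (ℕP.≤-trans (ℕP.+-mono-≤ ‖q‖≤ ‖r‖≤) (ℕP.≤-reflexive (≡.trans
          (≡.cong (λ x → 2 ℕ.* x ℕ.+ 2 ℕ.* x) (^-distribʳ-* m 2 τ)) (regroup (2 ℕ.^ m) (τ ℕ.^ m)))))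
        E≤ : E ℕ.* ‖ q ⊖ r ‖ℤ ℕ.^ n ℕ.≤ (c₁ ℕ.* τ ℕ.^ n) ℕ.^ m
        E≤ = begin
          E ℕ.* ‖ q ⊖ r ‖ℤ ℕ.^ n ≤⟨ ℕP.*-monoʳ-≤ E (ℕP.^-monoˡ-≤ n norm≤) ⟩
          E ℕ.* (4 ℕ.* 2 ℕ.^ m ℕ.* τ ℕ.^ m) ℕ.^ n ≡⟨ ≡.cong (E ℕ.*_) (^-distribʳ-* n (4 ℕ.* 2 ℕ.^ m) (τ ℕ.^ m)) ⟩
          E ℕ.* ((4 ℕ.* 2 ℕ.^ m) ℕ.^ n ℕ.* (τ ℕ.^ m) ℕ.^ n) ≡⟨ ℕP.*-assoc E _ _ ⟨
          c₁ ℕ.* (τ ℕ.^ m) ℕ.^ n ≤⟨ ℕP.*-mono-≤ (n≤n^[1+d] c₁ m′) (ℕP.≤-reflexive (^-^-comm τ m n)) ⟩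
          c₁ ℕ.^ m ℕ.* (τ ℕ.^ n) ℕ.^ m ≡⟨ ^-distribʳ-* m c₁ (τ ℕ.^ n) ⟨
          (c₁ ℕ.* τ ℕ.^ n) ℕ.^ m ∎
          where open ℕP.≤-Reasoning

    Limit : ℕ → Vec ℤ n → Set
    Limit T q = ∀ τ → T ℕ.≤ τ → ‖ q ‖ℤ ℕ.≤ 2 ℕ.* τ ℕ.^ m × Near (A *ᵥ q -ᵥ γ) (s τ)

    abstract
      constant : ∀ T → Recurrent A γ (c₀ ℕ.^ m) T → ∃[ q ] T ℕ.≤ ‖ q ‖ℤ × Limit (suc T) q
      constant T rec = q 0 , proj₁ (solution-at 0) , λ τ 1+T≤τ →
          ≡.subst (λ t → ‖ q 0 ‖ℤ ℕ.≤ 2 ℕ.* t ℕ.^ m × Near (A *ᵥ q 0 -ᵥ γ) (s t)) (ℕP.m∸n+n≡m 1+T≤τ)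
            (≡.subst (λ q → ‖ q ‖ℤ ℕ.≤ 2 ℕ.* (τ ℕ.∸ suc T ℕ.+ suc T) ℕ.^ m × Near (A *ᵥ q -ᵥ γ) (s (τ ℕ.∸ suc T ℕ.+ suc T)))
              (q≡ (τ ℕ.∸ suc T)) (proj₂ (solution-at (τ ℕ.∸ suc T))))
        where
        -- Starting from `suc T` keeps τ positive, as τ + 1 ≤ 2τ demands.
        solution : ∀ j → ∃[ q ] T ℕ.≤ ‖ q ‖ℤ × ‖ q ‖ℤ ℕ.≤ 2 ℕ.* (j ℕ.+ suc T) ℕ.^ m × Near (A *ᵥ q -ᵥ γ) (s (j ℕ.+ suc T))
        solution j = rec (τ ℕ.^ m) (s τ) (ℕP.≤-trans (ℕP.≤-trans (ℕP.n≤1+n T) (ℕP.m≤n+m (suc T) j)) (n≤n^[1+d] τ m′))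
          (ℕP.≤-reflexive (≡.trans (^-distribʳ-* m c₀ (τ ℕ.^ n)) (≡.cong (c₀ ℕ.^ m ℕ.*_) (^-^-comm τ n m))))
          where
          τ : ℕ
          τ = j ℕ.+ suc T
        q : ℕ → Vec ℤ n
        q j = proj₁ (solution j)
        solution-at : ∀ j → T ℕ.≤ ‖ q j ‖ℤ × ‖ q j ‖ℤ ℕ.≤ 2 ℕ.* (j ℕ.+ suc T) ℕ.^ m × Near (A *ᵥ q j -ᵥ γ) (s (j ℕ.+ suc T))
        solution-at j = proj₂ (solution j)
        q-suc : ∀ j → q (suc j) ≡ q j
        q-suc j = unique τ (q (suc j)) (q j)
            (ℕP.≤-trans (proj₁ (proj₂ (solution-at (suc j)))) (ℕP.*-monoʳ-≤ 2 (ℕP.^-monoˡ-≤ m 1+τ≤2τ)))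
            (ℕP.≤-trans (proj₁ (proj₂ (solution-at j))) (ℕP.*-monoʳ-≤ 2 (ℕP.^-monoˡ-≤ m (ℕP.m≤n*m τ 2))))
            (Near-anti (A *ᵥ q (suc j) -ᵥ γ) (ℕP.*-monoʳ-≤ c₀ (ℕP.^-monoˡ-≤ n (ℕP.n≤1+n τ))) (proj₂ (proj₂ (solution-at (suc j)))))
            (proj₂ (proj₂ (solution-at j)))
          where
          τ : ℕ
          τ = j ℕ.+ suc T
          1+τ≤2τ : suc τ ℕ.≤ 2 ℕ.* τ
          1+τ≤2τ = ℕP.≤-trans (ℕP.+-monoˡ-≤ τ (ℕP.≤-trans (ℕ.s≤s ℕ.z≤n) (ℕP.m≤n+m (suc T) j)))
            (ℕP.≤-reflexive (n+n≡2*n τ))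
        q≡ : ∀ j → q j ≡ q 0
        q≡ zero = ≡.refl
        q≡ (suc j) = ≡.trans (q-suc j) (q≡ j)

    -- Both are solutions at the common scale T + T′, where `unique` compares them.
    limit-unique : ∀ T T′ q q′ → Limit T q → Limit T′ q′ → q ≡ q′
    limit-unique T T′ q q′ lim lim′ = unique τ q q′ (widen (proj₁ a)) (widen (proj₁ a′)) (proj₂ a) (proj₂ a′)
      where
      τ : ℕ
      τ = T ℕ.+ T′
      widen : ∀ {x} → x ℕ.≤ 2 ℕ.* τ ℕ.^ m → x ℕ.≤ 2 ℕ.* (2 ℕ.* τ) ℕ.^ m
      widen h = ℕP.≤-trans h (ℕP.*-monoʳ-≤ 2 (ℕP.^-monoˡ-≤ m (ℕP.m≤n*m τ 2)))
      a = lim τ (ℕP.m≤m+n T T′)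
      a′ = lim′ τ (ℕP.m≤n+m T′ T)

    abstract
      limit-beyond : (A , γ) ∈ Ω → ∀ N → ∃[ T ] ∃[ q ] N ℕ.≤ ‖ q ‖ℤ × Limit T q
      limit-beyond ω N =
        let T , N≤T , rec = Ω⇒Recurrent A γ ω (c₀ ℕ.^ m) N
            q , T≤ , lim = constant T rec
        in suc T , q , ℕP.≤-trans N≤T T≤ , lim

    ∉Ω : ¬ (A , γ) ∈ Ω
    ∉Ω ω =
      let T , q , _ , lim = limit-beyond ω 0
          T′ , q′ , q<q′ , lim′ = limit-beyond ω (suc ‖ q ‖ℤ)
      in ℕP.<-irrefl (≡.cong ‖_‖ℤ (limit-unique T T′ q q′ lim lim′)) q<q′

  ¬WellApproximable⇒∉Ω : ∀ A γ → ¬ WellApproximable A → ¬ (A , γ) ∈ Ω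
  ¬WellApproximable⇒∉Ω A γ ¬wa = let E , k , sep = ¬WellApproximable⇒Separated A ¬wa in Separation.∉Ω A E k sep γ

  -- A point in the fibre of a well approximable matrix

  IsDist⇒≤ : ∀ y {d ρ} → IsDist y d → 0# ≤ ρ → (p : Vector ℤ m) → (∀ i → ∣ y i - fromℤ (p i) ∣ ≤ ρ) → d ≤ ρ
  IsDist⇒≤ y {d} {ρ} (_ , least) 0≤ρ p h = ≤-trans (least ‖ y -ᵥ Vector.map fromℤ p ‖ (p , refl))
    (≤-respˡ (*-identityˡ _) (‖‖-scale-≤ (y -ᵥ Vector.map fromℤ p) 0≤1 0≤ρ (λ i → ≤-respˡ (sym (*-identityˡ _)) (h i))))

  nestedIntervals : ∀ (a b : ℕ → ℝ) → (∀ k → a k ≤ a (suc k)) → (∀ k → b (suc k) ≤ b k) → (∀ k → a k ≤ b k) →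
    ∃[ x ] (∀ k → a k ≤ x × x ≤ b k)
  nestedIntervals a b a↑ b↓ a≤b =
    let x , ub , lub = complete (λ y → ∃[ k ] y ≈ a k) (a 0 , 0 , refl) (b 0 , λ { y (k , e) → ≤-respˡ (sym e) (aᵢ≤bⱼ k 0) })
    in x , λ k → ub (a k) (k , refl) , lub (b k) λ { y (i , e) → ≤-respˡ (sym e) (aᵢ≤bⱼ i k) }
    where
    a-mono : ∀ i k → a i ≤ a (k ℕ.+ i)
    a-mono i zero = ≤-refl
    a-mono i (suc k) = ≤-trans (a-mono i k) (a↑ (k ℕ.+ i))
    b-mono : ∀ i k → b (k ℕ.+ i) ≤ b i
    b-mono i zero = ≤-refl
    b-mono i (suc k) = ≤-trans (b↓ (k ℕ.+ i)) (b-mono i k)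
    aᵢ≤bⱼ : ∀ i j → a i ≤ b j
    aᵢ≤bⱼ i j = ≤-trans (a-mono i j) (≤-trans (a≤b (j ℕ.+ i))
      (≤-respˡ (reflexive (≡.cong b (ℕP.+-comm i j))) (b-mono j i)))

  2^k*½^k : ∀ k → fromℕ (2 ℕ.^ k) * ½ ^ k ≈ 1#
  2^k*½^k k = trans (*-congʳ (fromℕ-^ 2 k)) (trans (sym (^-distrib-* (fromℕ 2) ½ k))
    (trans (^-congˡ k (trans (*-congʳ (+-congˡ fromℕ-1)) (proj₁ (proj₂ ½∃)))) (1^ k)))

  ∉-of-norm : ∀ (F : List (Vec ℤ n)) → ∃[ K ] (∀ q → K ℕ.≤ ‖ q ‖ℤ → ¬ q ∈ᴸ F)
  ∉-of-norm [] = 0 , λ q _ ()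
  ∉-of-norm (r ∷ F) = let K , h = ∉-of-norm F in K ℕ.⊔ suc ‖ r ‖ℤ , λ
    { q p (here e) → ℕP.<-irrefl (≡.cong ‖_‖ℤ (≡.sym e)) (ℕP.≤-trans (ℕP.m≤n⊔m K (suc ‖ r ‖ℤ)) p)
    ; q p (there q∈) → h q (ℕP.≤-trans (ℕP.m≤m⊔n K (suc ‖ r ‖ℤ)) p) q∈ }

  module Existence (A : Matrix) (A∈ : A ∈ [0,1⟩ᵐˣⁿ) (wa : WellApproximable A) where

    -- The factor 2^k makes the series converge. The factor 2^(n+m) pays in `block-sum` for ‖Q
    -- (k+1)‖ ≤ 2‖q k‖ and for `ρ k` being twice `r (suc k)`.
    E : ℕ → ℕ
    E k = 2 ℕ.^ (n ℕ.+ m) ℕ.* 2 ℕ.^ k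

    Stage : Set
    Stage = Vec ℤ n × Vector ℤ m × ℕ

    -- The first summand forces the next s to be at least twice the present one, which gives
    -- geometric tails; the second makes q dominate Q, so that the norms of the partial sums
    -- increase strictly.
    N : Stage → ℕ
    N (Q , _ , s) = (2 ℕ.* s) ℕ.^ m ℕ.+ suc (2 ℕ.* ‖ Q ‖ℤ)

    abstract
      pick : ∀ k S → ∃[ q ] ∃[ s ] N S ℕ.≤ ‖ q ‖ℤ × E k ℕ.* ‖ q ‖ℤ ℕ.^ n ℕ.≤ s ℕ.^ m × Near (A *ᵥ q) s
      pick k S = wa (E k) (N S)

    step : ℕ → Stage → Stage
    step k S@(Q , P , s) = let q , s′ , _ , _ , p , _ = pick k S in Q ⊕ q , (λ i → P i ℤ.+ p i) , s′

    stage : ℕ → Stage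
    stage zero = Vec.replicate n (+ 0) , (λ _ → + 0) , 1
    stage (suc k) = step k (stage k)

    Q : ℕ → Vec ℤ n
    Q k = proj₁ (stage k)
    P : ℕ → Vector ℤ m
    P k = proj₁ (proj₂ (stage k))
    s : ℕ → ℕ
    s k = proj₂ (proj₂ (stage k))

    q : ℕ → Vec ℤ n
    q k = proj₁ (pick k (stage k))
    p : ℕ → Vector ℤ m
    p k = proj₁ (proj₂ (proj₂ (proj₂ (proj₂ (pick k (stage k))))))

    q-large : ∀ k → N (stage k) ℕ.≤ ‖ q k ‖ℤ
    q-large k = proj₁ (proj₂ (proj₂ (pick k (stage k))))
    s-large : ∀ k → E k ℕ.* ‖ q k ‖ℤ ℕ.^ n ℕ.≤ s (suc k) ℕ.^ m
    s-large k = proj₁ (proj₂ (proj₂ (proj₂ (pick k (stage k)))))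
    q-near : ∀ k i → fromℕ (s (suc k)) * ∣ (A *ᵥ q k) i - fromℤ (p k i) ∣ ≤ 1#
    q-near k = proj₂ (proj₂ (proj₂ (proj₂ (proj₂ (pick k (stage k))))))

    1≤E : ∀ k → 1 ℕ.≤ E k
    1≤E k = ℕP.*-mono-≤ {1} {2 ℕ.^ (n ℕ.+ m)} {1} (ℕP.m^n>0 2 (n ℕ.+ m)) (ℕP.m^n>0 2 k)

    2s≤s : ∀ k → 2 ℕ.* s k ℕ.≤ s (suc k)
    2s≤s k = ^-cancelˡ-≤ m′ (begin
      (2 ℕ.* s k) ℕ.^ m ≤⟨ ℕP.m≤m+n ((2 ℕ.* s k) ℕ.^ m) (suc (2 ℕ.* ‖ Q k ‖ℤ)) ⟩
      N (stage k) ≤⟨ q-large k ⟩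
      ‖ q k ‖ℤ ≤⟨ n≤n^[1+d] ‖ q k ‖ℤ n′ ⟩
      ‖ q k ‖ℤ ℕ.^ n ≤⟨ ℕP.m≤n*m (‖ q k ‖ℤ ℕ.^ n) (E k) {{ℕ.>-nonZero (1≤E k)}} ⟩
      E k ℕ.* ‖ q k ‖ℤ ℕ.^ n ≤⟨ s-large k ⟩
      s (suc k) ℕ.^ m ∎)
      where open ℕP.≤-Reasoning

    1≤s : ∀ k → 1 ℕ.≤ s k
    1≤s zero = ℕP.≤-refl
    1≤s (suc k) = ℕP.≤-trans (1≤s k) (ℕP.≤-trans (ℕP.m≤n*m (s k) 2) (2s≤s k))

    Q-increasing : ∀ k → suc ‖ Q k ‖ℤ ℕ.≤ ‖ Q (suc k) ‖ℤ
    Q-increasing k = ℕP.+-cancelʳ-≤ ‖ Q k ‖ℤ _ _ (begin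
      suc ‖ Q k ‖ℤ ℕ.+ ‖ Q k ‖ℤ ≡⟨ ≡.cong suc (n+n≡2*n ‖ Q k ‖ℤ) ⟩
      suc (2 ℕ.* ‖ Q k ‖ℤ) ≤⟨ ℕP.m≤n+m (suc (2 ℕ.* ‖ Q k ‖ℤ)) ((2 ℕ.* s k) ℕ.^ m) ⟩
      N (stage k) ≤⟨ q-large k ⟩
      ‖ q k ‖ℤ ≡⟨ ≡.cong ‖_‖ℤ q≡ ⟩
      ‖ Q (suc k) ⊖ Q k ‖ℤ ≤⟨ ‖⊖‖≤ (Q (suc k)) (Q k) ⟩
      ‖ Q (suc k) ‖ℤ ℕ.+ ‖ Q k ‖ℤ ∎)
      where
      open ℕP.≤-Reasoning
      lemma : ∀ a b → b ≡ a ℤ.+ b ℤ.+ ℤ.-1ℤ ℤ.* a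
      lemma = ℤ-Solver.solve-∀
      q≡ : q k ≡ Q (suc k) ⊖ Q k
      q≡ = lookup-injective λ i → ≡.trans (lemma (lookup (Q k) i) (lookup (q k) i)) (≡.sym (≡.trans
        (lookup-⊕ i (Q (suc k)) (ℤ.-1ℤ ⊙ Q k)) (≡.cong₂ ℤ._+_ (lookup-⊕ i (Q k) (q k)) (lookup-⊙ ℤ.-1ℤ i (Q k)))))

    Q-mono : ∀ k → k ℕ.≤ ‖ Q k ‖ℤ
    Q-mono zero = ℕ.z≤n
    Q-mono (suc k) = ℕP.≤-trans (ℕ.s≤s (Q-mono k)) (Q-increasing k)

    Q≤2q : ∀ k → ‖ Q (suc k) ‖ℤ ℕ.≤ 2 ℕ.* ‖ q k ‖ℤ
    Q≤2q k = ℕP.≤-trans (‖⊕‖≤ (Q k) (q k)) (ℕP.+-mono-≤ (begin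
      ‖ Q k ‖ℤ ≤⟨ ℕP.m≤n*m ‖ Q k ‖ℤ 2 ⟩
      2 ℕ.* ‖ Q k ‖ℤ ≤⟨ ℕP.n≤1+n (2 ℕ.* ‖ Q k ‖ℤ) ⟩
      suc (2 ℕ.* ‖ Q k ‖ℤ) ≤⟨ ℕP.m≤n+m (suc (2 ℕ.* ‖ Q k ‖ℤ)) ((2 ℕ.* s k) ℕ.^ m) ⟩
      N (stage k) ≤⟨ q-large k ⟩
      ‖ q k ‖ℤ ∎) (ℕP.≤-reflexive (≡.sym (ℕP.+-identityʳ ‖ q k ‖ℤ))))
      where open ℕP.≤-Reasoning

    abstract
      s⁻¹ : ∀ k → ∃[ x ] (fromℕ (s k) * x ≈ 1# × 0# < x)
      s⁻¹ k = recip (fromℕ-pos (1≤s k))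

    r : ℕ → ℝ
    r k = proj₁ (s⁻¹ k)

    0≤r : ∀ k → 0# ≤ r k
    0≤r k = proj₁ (proj₂ (proj₂ (s⁻¹ k)))

    s*r : ∀ k → fromℕ (s k) * r k ≈ 1#
    s*r k = proj₁ (proj₂ (s⁻¹ k))

    r-halves : ∀ k → r (suc k) + r (suc k) ≤ r k
    r-halves k = *-cancelˡ-≤ (fromℕ-pos (1≤s k)) (begin
      fromℕ (s k) * (r (suc k) + r (suc k)) ≈⟨ lemma (fromℕ (s k)) (r (suc k)) ⟩
      (fromℕ (s k) + fromℕ (s k)) * r (suc k) ≈⟨ *-congʳ (fromℕ-+ (s k) (s k)) ⟨
      fromℕ (s k ℕ.+ s k) * r (suc k) ≤⟨ *-monoʳ-≤ (0≤r (suc k)) (fromℕ-mono (ℕP.≤-trans (ℕP.≤-reflexive (n+n≡2*n (s k))) (2s≤s k))) ⟩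
      fromℕ (s (suc k)) * r (suc k) ≈⟨ s*r (suc k) ⟩
      1# ≈⟨ s*r k ⟨
      fromℕ (s k) * r k ∎)
      where
      open ≤-R
      lemma : ∀ s r → s * (r + r) ≈ (s + s) * r
      lemma = solve 2 (λ s r → s :* (r :+ r) := (s :+ s) :* r) refl

    x : Fin m → ℕ → ℝ
    x i k = (A *ᵥ Q k) i - fromℤ (P k i)

    x-step : ∀ i k → ∣ x i (suc k) - x i k ∣ ≤ r (suc k)
    x-step i k = *-cancelˡ-≤ (fromℕ-pos (1≤s (suc k))) (begin
      fromℕ (s (suc k)) * ∣ x i (suc k) - x i k ∣ ≈⟨ *-congˡ (∣∣-cong (trans
          (+-congʳ (+-cong (*ᵥ-⊕ A (Q k) (q k) i) (-‿cong (fromℤ-+ (P k i) (p k i)))))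
          (lemma ((A *ᵥ Q k) i) ((A *ᵥ q k) i) (fromℤ (P k i)) (fromℤ (p k i))))) ⟩
      fromℕ (s (suc k)) * ∣ (A *ᵥ q k) i - fromℤ (p k i) ∣ ≤⟨ q-near k i ⟩
      1# ≈⟨ s*r (suc k) ⟨
      fromℕ (s (suc k)) * r (suc k) ∎)
      where
      open ≤-R
      lemma : ∀ a b c d → (a + b - (c + d)) - (a - c) ≈ b - d
      lemma = solve 4 (λ a b c d → (a :+ b :- (c :+ d)) :- (a :- c) := b :- d) refl

    -- A bound for the tail r (k+1) + r (k+2) + ..., since r at least halves at each step.
    ρ : ℕ → ℝ
    ρ k = r (suc k) + r (suc k)

    0≤ρ : ∀ k → 0# ≤ ρ k
    0≤ρ k = +-nonNeg (0≤r (suc k)) (0≤r (suc k))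

    abstract
      -- The intervals of radius `ρ k` about `x i k` are nested: the centre moves by at most r
      -- (k+1), and the new radius 2 r (k+2) is at most r (k+1).
      limit : ∀ i → ∃[ y ] (∀ k → x i k - ρ k ≤ y × y ≤ x i k + ρ k)
      limit i = nestedIntervals (λ k → x i k - ρ k) (λ k → x i k + ρ k)
        (λ k → lin₂ (≤-trans (-x≤∣x∣ (x i (suc k) - x i k)) (x-step i k)) (r-halves (suc k))
          (lemma₁ (x i (suc k)) (x i k) (r (suc k)) (r (suc (suc k)))))
        (λ k → lin₂ (≤-trans (x≤∣x∣ (x i (suc k) - x i k)) (x-step i k)) (r-halves (suc k))
          (lemma₂ (x i (suc k)) (x i k) (r (suc k)) (r (suc (suc k)))))
        (λ k → lin₂ (0≤ρ k) (0≤ρ k) (lemma₃ (x i k) (ρ k)))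
        where
        lemma₁ : ∀ y x r t → (r - (- (y - x))) + (r - (t + t)) ≈ (y - (t + t)) - (x - (r + r))
        lemma₁ = solve 4 (λ y x r t → (r :- (:- (y :- x))) :+ (r :- (t :+ t)) := (y :- (t :+ t)) :- (x :- (r :+ r))) refl
        lemma₂ : ∀ y x r t → (r - (y - x)) + (r - (t + t)) ≈ (x + (r + r)) - (y + (t + t))
        lemma₂ = solve 4 (λ y x r t → (r :- (y :- x)) :+ (r :- (t :+ t)) := (x :+ (r :+ r)) :- (y :+ (t :+ t))) refl
        lemma₃ : ∀ x r → (r - 0#) + (r - 0#) ≈ (x + r) - (x - r)
        lemma₃ = solve 2 (λ x r → (r :- con (+ 0)) :+ (r :- con (+ 0)) := (x :+ r) :- (x :- r)) refl

    f : Fin m → ℤ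
    f i = proj₁ (floor (proj₁ (limit i)))

    γ : Vector ℝ m
    γ i = proj₁ (limit i) - fromℤ (f i)

    γ∈ : γ ∈ [0,1⟩ᵐ
    γ∈ i = diff f≤ , (lin₁ (proj₁ <f+1) (lemma (proj₁ (limit i)) (fromℤ (f i))) ,
        λ e → <⇒≱ <f+1 (lin₁ (≤-reflexive (sym e)) (lemma′ (proj₁ (limit i)) (fromℤ (f i)))))
      where
      f≤ : fromℤ (f i) ≤ proj₁ (limit i)
      f≤ = proj₁ (proj₂ (floor (proj₁ (limit i))))
      <f+1 : proj₁ (limit i) < fromℤ (f i) + 1#
      <f+1 = proj₂ (proj₂ (floor (proj₁ (limit i))))
      lemma : ∀ y f → (f + 1#) - y ≈ 1# - (y - f)
      lemma = solve 2 (λ y f → (f :+ con (+ 1)) :- y := con (+ 1) :- (y :- f)) refl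
      lemma′ : ∀ y f → (y - f) - 1# ≈ y - (f + 1#)
      lemma′ = solve 2 (λ y f → (y :- f) :- con (+ 1) := y :- (f :+ con (+ 1))) refl

    dist≤ρ : ∀ k {d} → IsDist (A *ᵥ Q k -ᵥ γ) d → d ≤ ρ k
    dist≤ρ k dist = IsDist⇒≤ (A *ᵥ Q k -ᵥ γ) dist (0≤ρ k) (λ i → P k i ℤ.+ f i) λ i →
      let lo , hi = proj₂ (limit i) k in
      ∣∣-≤ (lin₂ lo (≤-reflexive (sym (fromℤ-+ (P k i) (f i)))) (lemma₁ ((A *ᵥ Q k) i) (fromℤ (P k i)) (proj₁ (limit i)) (fromℤ (f i)) (fromℤ (P k i ℤ.+ f i)) (ρ k)))
           (lin₂ hi (≤-reflexive (fromℤ-+ (P k i) (f i))) (lemma₂ ((A *ᵥ Q k) i) (fromℤ (P k i)) (proj₁ (limit i)) (fromℤ (f i)) (fromℤ (P k i ℤ.+ f i)) (ρ k)))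
      where
      lemma₁ : ∀ a p y f g r → (y - (a - p - r)) + (g - (p + f)) ≈ r - (a - (y - f) - g)
      lemma₁ = solve 6 (λ a p y f g r → (y :- (a :- p :- r)) :+ (g :- (p :+ f)) := r :- (a :- (y :- f) :- g)) refl
      lemma₂ : ∀ a p y f g r → ((a - p + r) - y) + ((p + f) - g) ≈ r - - (a - (y - f) - g)
      lemma₂ = solve 6 (λ a p y f g r → ((a :- p :+ r) :- y) :+ ((p :+ f) :- g) := r :- :- (a :- (y :- f) :- g)) refl

    -- The left side bounds the whole stretch of the series of ψ from ‖Q k‖ to ‖Q (k+1)‖ if ψ is at
    -- most `ρ k` there.
    block-sum : ∀ k → fromℕ ‖ Q (suc k) ‖ℤ ^ n * ρ k ^ m ≤ ½ ^ k
    block-sum k = *-cancelˡ-≤ (fromℕ-pos (ℕP.m^n>0 2 k)) (begin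
      fromℕ (2 ℕ.^ k) * (fromℕ ‖ Q (suc k) ‖ℤ ^ n * ρ k ^ m)
        ≤⟨ *-monoˡ-≤ (fromℕ-nonNeg (2 ℕ.^ k)) (*-monoʳ-≤ (^-nonNeg m (0≤ρ k)) (^-mono-≤ n (fromℕ-nonNeg ‖ Q (suc k) ‖ℤ) (fromℕ-mono (Q≤2q k)))) ⟩
      fromℕ (2 ℕ.^ k) * (fromℕ (2 ℕ.* ‖ q k ‖ℤ) ^ n * ρ k ^ m)
        ≈⟨ *-congˡ (*-cong (trans (^-congˡ n (fromℕ-* 2 ‖ q k ‖ℤ)) (^-distrib-* (fromℕ 2) (fromℕ ‖ q k ‖ℤ) n))
             (trans (^-congˡ m ρ≈) (^-distrib-* (fromℕ 2) (r (suc k)) m))) ⟩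
      fromℕ (2 ℕ.^ k) * (fromℕ 2 ^ n * fromℕ ‖ q k ‖ℤ ^ n * (fromℕ 2 ^ m * r (suc k) ^ m))
        ≈⟨ lemma (fromℕ (2 ℕ.^ k)) (fromℕ 2 ^ n) (fromℕ ‖ q k ‖ℤ ^ n) (fromℕ 2 ^ m) (r (suc k) ^ m) ⟩
      fromℕ 2 ^ n * fromℕ 2 ^ m * fromℕ (2 ℕ.^ k) * fromℕ ‖ q k ‖ℤ ^ n * r (suc k) ^ m
        ≈⟨ *-congʳ (*-congʳ (*-congʳ (trans (fromℕ-^ 2 (n ℕ.+ m)) (^-homo-* (fromℕ 2) n m)))) ⟨
      fromℕ (2 ℕ.^ (n ℕ.+ m)) * fromℕ (2 ℕ.^ k) * fromℕ ‖ q k ‖ℤ ^ n * r (suc k) ^ m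
        ≈⟨ *-congʳ (trans (fromℕ*^ (E k) ‖ q k ‖ℤ n) (*-congʳ (fromℕ-* (2 ℕ.^ (n ℕ.+ m)) (2 ℕ.^ k)))) ⟨
      fromℕ (E k ℕ.* ‖ q k ‖ℤ ℕ.^ n) * r (suc k) ^ m
        ≤⟨ *-monoʳ-≤ (^-nonNeg m (0≤r (suc k))) (fromℕ-mono (s-large k)) ⟩
      fromℕ (s (suc k) ℕ.^ m) * r (suc k) ^ m
        ≈⟨ trans (*-congʳ (fromℕ-^ (s (suc k)) m)) (sym (^-distrib-* (fromℕ (s (suc k))) (r (suc k)) m)) ⟩
      (fromℕ (s (suc k)) * r (suc k)) ^ m
        ≈⟨ trans (^-congˡ m (s*r (suc k))) (1^ m) ⟩
      1#
        ≈⟨ 2^k*½^k k ⟨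
      fromℕ (2 ℕ.^ k) * ½ ^ k ∎)
      where
      open ≤-R
      ρ≈ : ρ k ≈ fromℕ 2 * r (suc k)
      ρ≈ = x+x≈2x (r (suc k))
      lemma : ∀ a b c d e → a * (b * c * (d * e)) ≈ b * d * a * c * e
      lemma = solve 5 (λ a b c d e → a :* (b :* c :* (d :* e)) := b :* d :* a :* c :* e) refl

    module _ (ψ : ℕ → ℝ) (ψ∈ : ψ ∈ 𝒟) where

      term : ℕ → ℝ
      term k = fromℕ (suc k) ^ n′ * ψ (suc k) ^ m

      term-nonNeg : ∀ k → 0# ≤ term k
      term-nonNeg k = *-nonNeg (^-nonNeg n′ (fromℕ-nonNeg (suc k))) (^-nonNeg m (proj₁ ψ∈ (suc k)))

      module _ (K : ℕ) (small : ∀ k → K ℕ.≤ k → ψ ‖ Q k ‖ℤ ≤ ρ k) where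

        sum-step : ∀ k → K ℕ.≤ k → partialSum term ‖ Q (suc k) ‖ℤ ≤ partialSum term ‖ Q k ‖ℤ + ½ ^ k
        sum-step k K≤k = begin
          partialSum term ‖ Q (suc k) ‖ℤ
            ≡⟨ ≡.cong (partialSum term) (ℕP.m+[n∸m]≡n Q≤Q) ⟨
          partialSum term (‖ Q k ‖ℤ ℕ.+ j)
            ≈⟨ partialSum-+ term ‖ Q k ‖ℤ j ⟩
          partialSum term ‖ Q k ‖ℤ + partialSum (λ i → term (‖ Q k ‖ℤ ℕ.+ i)) j
            ≤⟨ +-monoʳ-≤ (partialSum term ‖ Q k ‖ℤ) (≤-trans (partialSum-≤ (λ i → term (‖ Q k ‖ℤ ℕ.+ i)) j term≤) (≤-trans
                 (*-monoʳ-≤ (*-nonNeg (^-nonNeg n′ (fromℕ-nonNeg ‖ Q (suc k) ‖ℤ)) (^-nonNeg m (0≤ρ k))) (fromℕ-mono (ℕP.m∸n≤m ‖ Q (suc k) ‖ℤ ‖ Q k ‖ℤ)))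
                 (≤-respˡ (*-assoc (fromℕ ‖ Q (suc k) ‖ℤ) _ _) (block-sum k)))) ⟩
          partialSum term ‖ Q k ‖ℤ + ½ ^ k ∎
          where
          open ≤-R
          Q≤Q : ‖ Q k ‖ℤ ℕ.≤ ‖ Q (suc k) ‖ℤ
          Q≤Q = ℕP.≤-trans (ℕP.n≤1+n ‖ Q k ‖ℤ) (Q-increasing k)
          j : ℕ
          j = ‖ Q (suc k) ‖ℤ ℕ.∸ ‖ Q k ‖ℤ
          term≤ : ∀ i → i ℕ.< j → term (‖ Q k ‖ℤ ℕ.+ i) ≤ fromℕ ‖ Q (suc k) ‖ℤ ^ n′ * ρ k ^ m
          term≤ i i<j = *-mono-≤ (^-nonNeg n′ (fromℕ-nonNeg (suc (‖ Q k ‖ℤ ℕ.+ i)))) (^-nonNeg m (0≤ρ k))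
            (^-mono-≤ n′ (fromℕ-nonNeg (suc (‖ Q k ‖ℤ ℕ.+ i))) (fromℕ-mono (ℕP.≤-trans (ℕP.≤-reflexive (≡.sym (ℕP.+-suc ‖ Q k ‖ℤ i)))
              (ℕP.≤-trans (ℕP.+-monoʳ-≤ ‖ Q k ‖ℤ i<j) (ℕP.≤-reflexive (ℕP.m+[n∸m]≡n Q≤Q))))))
            (^-mono-≤ m (proj₁ ψ∈ (suc (‖ Q k ‖ℤ ℕ.+ i)))
              (≤-trans (proj₁ (proj₂ ψ∈) (ℕP.m≤n⇒m≤1+n (ℕP.m≤m+n ‖ Q k ‖ℤ i))) (small k K≤k)))

        -- ½^k + ½^k is the geometric tail from k on. Adding it to the partial sum up to ‖Q k‖ gives
        -- a quantity that does not increase with k ≥ K, so its value at K bounds all partial sums.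
        U : ℝ
        U = partialSum term ‖ Q K ‖ℤ + (½ ^ K + ½ ^ K)

        sum-bounded : ∀ j → partialSum term ‖ Q (j ℕ.+ K) ‖ℤ + (½ ^ (j ℕ.+ K) + ½ ^ (j ℕ.+ K)) ≤ U
        sum-bounded zero = ≤-refl
        sum-bounded (suc j) = ≤-trans
          (≤-trans (+-mono-≤ (sum-step k (ℕP.m≤n+m K j)) (≤-reflexive halves))
            (≤-reflexive (+-assoc _ _ _)))
          (sum-bounded j)
          where
          k : ℕ
          k = j ℕ.+ K
          halves : ½ ^ suc k + ½ ^ suc k ≈ ½ ^ k
          halves = trans (+-cong (*-comm ½ (½ ^ k)) (*-comm ½ (½ ^ k))) (½+½ (½ ^ k))

        absurd : ⊥
        absurd with proj₂ (proj₂ (proj₂ ψ∈)) [ U ] (λ { [ y ] (N , [ e ]) → [ ≤-respˡ (sym e) (bound N) ] })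
          where
          bound : ∀ N → partialSum term N ≤ U
          bound N = ≤-trans (partialSum-mono term term-nonNeg (ℕP.≤-trans (ℕP.m≤m+n N K) (Q-mono (N ℕ.+ K))))
            (≤-trans (≤-respˡ (+-identityʳ _) (+-monoʳ-≤ (partialSum term ‖ Q (N ℕ.+ K) ‖ℤ)
              (+-nonNeg (^-nonNeg (N ℕ.+ K) (proj₁ 0<½)) (^-nonNeg (N ℕ.+ K) (proj₁ 0<½))))) (sum-bounded N))
        ... | ()

      infinitelyMany : InfinitelyMany λ q → ∃[ d ] IsDist (A *ᵥ q -ᵥ γ) d × d < ψ ‖ q ‖ℤ
      infinitelyMany F = by-contra λ none → let K , avoid = ∉-of-norm F in
        absurd K λ k K≤k → let d , dist = distance (A *ᵥ Q k -ᵥ γ) in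
          ≤-trans (by-contra λ ψ≰d → none (Q k , (d , dist , ≰⇒< ψ≰d) , avoid (Q k) (ℕP.≤-trans K≤k (Q-mono k))))
            (dist≤ρ k dist)

    γ∈Ω : (A , γ) ∈ Ω
    γ∈Ω ψ ψ∈ = A∈ , γ∈ , infinitelyMany ψ ψ∈

  WellApproximable⇒Ω-nonempty : ∀ A → A ∈ [0,1⟩ᵐˣⁿ → WellApproximable A → ∃[ γ ] γ ∈ [0,1⟩ᵐ × (A , γ) ∈ Ω
  WellApproximable⇒Ω-nonempty A A∈ wa = Existence.γ A A∈ wa , Existence.γ∈ A A∈ wa , Existence.γ∈Ω A A∈ wa

  -- The range conditions are part of `W ψ`, so they are read off from one particular ψ in `𝒟`, the
  -- constant 1.
  Ω-range : ∀ {A γ} → (A , γ) ∈ Ω → A ∈ [0,1⟩ᵐˣⁿ × γ ∈ [0,1⟩ᵐ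
  Ω-range ω = let A∈ , γ∈ , _ = ω (λ _ → 1#) ((λ _ → 0≤1) , (λ _ → ≤-refl) , divergent term 0<1 grow) in A∈ , γ∈
    where
    term : ℕ → ℝ
    term k = fromℕ (suc k) ^ n′ * 1# ^ m
    1≤term : ∀ k → 1# ≤ term k
    1≤term k = ≤-respˡ (trans (*-cong (1^ n′) (1^ m)) (*-identityˡ 1#))
      (*-monoʳ-≤ (^-nonNeg m 0≤1) (^-mono-≤ n′ 0≤1 (≤-respˡ fromℕ-1 (fromℕ-mono {1} {suc k} (ℕ.s≤s ℕ.z≤n)))))
    grow : ∀ N → ∃[ N′ ] partialSum term N + 1# ≤ partialSum term N′
    grow N = N ℕ.+ 1 , ≤-respʳ (sym (partialSum-+ term N 1)) (+-monoʳ-≤ (partialSum term N)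
      (≤-respʳ (sym (+-identityʳ (term (N ℕ.+ 0)))) (1≤term (N ℕ.+ 0))))

  -- Fibres over well approximable matrices are null

  abstract
    -- Division with remainder by a y of either sign. The bound on c matters as much as the
    -- remainder: it limits how far adding c q* can move A q.
    reduce : ∀ x y → 1 ℕ.≤ ℤ.∣ y ∣ → ∃[ c ] ∃[ b ] b ℕ.< ℤ.∣ y ∣ × x ℤ.+ c ℤ.* y ≡ + b × ℤ.∣ c ∣ ℕ.* ℤ.∣ y ∣ ℕ.≤ ℤ.∣ x ∣ ℕ.+ ℤ.∣ y ∣
    reduce x y 1≤y = finish (choose y 1≤y)
      where
      choose : ∀ y → 1 ℕ.≤ ℤ.∣ y ∣ → ∃[ c ] ∃[ b ] b ℕ.< ℤ.∣ y ∣ × x ℤ.+ c ℤ.* y ≡ + b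
      choose (+ suc Y) _ = ℤ.- (x /ℕ suc Y) , x %ℕ suc Y , n%ℕd<d x (suc Y) ,
        ≡.trans (≡.cong (λ z → z ℤ.+ ℤ.- (x /ℕ suc Y) ℤ.* + suc Y) (a≡a%ℕn+[a/ℕn]*n x (suc Y))) (lemma (+ (x %ℕ suc Y)) (x /ℕ suc Y) (+ suc Y))
        where
        lemma : ∀ r q y → r ℤ.+ q ℤ.* y ℤ.+ ℤ.- q ℤ.* y ≡ r
        lemma = ℤ-Solver.solve-∀
      choose -[1+ Y ] _ = x /ℕ suc Y , x %ℕ suc Y , n%ℕd<d x (suc Y) ,
        ≡.trans (≡.cong (λ z → z ℤ.+ (x /ℕ suc Y) ℤ.* -[1+ Y ]) (a≡a%ℕn+[a/ℕn]*n x (suc Y))) (lemma (+ (x %ℕ suc Y)) (x /ℕ suc Y) (+ suc Y))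
        where
        lemma : ∀ r q y → r ℤ.+ q ℤ.* y ℤ.+ q ℤ.* (ℤ.- y) ≡ r
        lemma = ℤ-Solver.solve-∀
      finish : (∃[ c ] ∃[ b ] b ℕ.< ℤ.∣ y ∣ × x ℤ.+ c ℤ.* y ≡ + b) →
        ∃[ c ] ∃[ b ] b ℕ.< ℤ.∣ y ∣ × x ℤ.+ c ℤ.* y ≡ + b × ℤ.∣ c ∣ ℕ.* ℤ.∣ y ∣ ℕ.≤ ℤ.∣ x ∣ ℕ.+ ℤ.∣ y ∣
      finish (c , b , b< , e) = c , b , b< , e , (begin
        ℤ.∣ c ∣ ℕ.* ℤ.∣ y ∣ ≡⟨ ℤP.abs-* c y ⟨
        ℤ.∣ c ℤ.* y ∣ ≡⟨ ≡.cong ℤ.∣_∣ (≡.trans (lemma x (c ℤ.* y)) (≡.cong (λ z → z ℤ.- x) e)) ⟩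
        ℤ.∣ + b ℤ.- x ∣ ≤⟨ ℤP.∣i-j∣≤∣i∣+∣j∣ (+ b) x ⟩
        b ℕ.+ ℤ.∣ x ∣ ≤⟨ ℕP.+-monoˡ-≤ ℤ.∣ x ∣ (ℕP.<⇒≤ b<) ⟩
        ℤ.∣ y ∣ ℕ.+ ℤ.∣ x ∣ ≡⟨ ℕP.+-comm ℤ.∣ y ∣ ℤ.∣ x ∣ ⟩
        ℤ.∣ x ∣ ℕ.+ ℤ.∣ y ∣ ∎)
        where
        open ℕP.≤-Reasoning
        lemma : ∀ x z → z ≡ x ℤ.+ z ℤ.- x
        lemma = ℤ-Solver.solve-∀

  -- Every q with ‖q‖ ≤ 2h is a + c q* with |c| ≤ 3M and the j-th entry of a in [0, ‖q*‖),
  -- so the points A q cluster around the fewer points A a.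
  module Clusters (A : Matrix) (M r : ℕ) (1≤M : 1 ℕ.≤ M) (1≤r : 1 ℕ.≤ r) (q* : Vec ℤ n) (s* : ℕ) (1≤q* : 1 ℕ.≤ ‖ q* ‖ℤ)
    (6Mr≤s* : 6 ℕ.* M ℕ.* r ℕ.≤ s*) (near* : Near (A *ᵥ q*) s*) where

    Q h : ℕ
    Q = ‖ q* ‖ℤ
    h = M ℕ.* Q

    j : Fin n
    j = proj₁ (‖‖ℤ-attained q*)

    -- Modulo q*, the entry at j takes only ‖q*‖ values instead of order h = M ‖q*‖, which saves a
    -- factor M over counting all q. The other entries stay below 2h + 3M‖q*‖ = 5h.
    entries : Fin n → List ℤ
    entries i with i FinP.≟ j
    ... | yes _ = List.map +_ (upTo Q)
    ... | no _ = intRange (5 ℕ.* h)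

    residues : List (Vec ℤ n)
    residues = List.map Vec.tabulate (choices entries)

    length-residues : length residues ℕ.≤ Q ℕ.* (suc (5 ℕ.* h ℕ.+ 5 ℕ.* h)) ℕ.^ n′
    length-residues = ℕP.≤-trans (ℕP.≤-reflexive (length-map Vec.tabulate (choices entries))) (length-choices-at-≤ entries j at-j away)
      where
      at-j : length (entries j) ℕ.≤ Q
      at-j with j FinP.≟ j
      ... | yes _ = ℕP.≤-reflexive (≡.trans (length-map +_ (upTo Q)) (length-upTo Q))
      ... | no ¬p = contradiction ≡.refl ¬p
      away : ∀ i → ¬ i ≡ j → length (entries i) ℕ.≤ suc (5 ℕ.* h ℕ.+ 5 ℕ.* h)
      away i i≢j with i FinP.≟ j
      ... | yes p = contradiction p i≢j
      ... | no _ = ℕP.≤-reflexive (length-intRange (5 ℕ.* h))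

    residue : ∀ q → ‖ q ‖ℤ ℕ.≤ 2 ℕ.* h → ∃[ c ] ℤ.∣ c ∣ ℕ.≤ 3 ℕ.* M × (q ⊕ c ⊙ q*) ∈ᴸ residues
    residue q q≤ = c , c≤ , AnyP.map⁺ (Any.map (λ e → ≡.trans (≡.sym (VecP.tabulate∘lookup a)) (VecP.tabulate-cong e))
        (choices-Any entries (λ i x → lookup a i ≡ x) entry))
      where
      red = reduce (lookup q j) (lookup q* j) (≡.subst (1 ℕ.≤_) (≡.sym (proj₂ (‖‖ℤ-attained q*))) 1≤q*)
      c = proj₁ red
      b = proj₁ (proj₂ red)
      Q≡ : ℤ.∣ lookup q* j ∣ ≡ Q
      Q≡ = proj₂ (‖‖ℤ-attained q*)
      b<Q : b ℕ.< Q
      b<Q = ≡.subst (b ℕ.<_) Q≡ (proj₁ (proj₂ (proj₂ red)))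
      a : Vec ℤ n
      a = q ⊕ c ⊙ q*
      a-at-j : lookup a j ≡ + b
      a-at-j = ≡.trans (lookup-⊕ j q (c ⊙ q*)) (≡.trans (≡.cong (λ z → lookup q j ℤ.+ z) (lookup-⊙ c j q*)) (proj₁ (proj₂ (proj₂ (proj₂ red)))))
      c≤ : ℤ.∣ c ∣ ℕ.≤ 3 ℕ.* M
      c≤ = ℕP.*-cancelʳ-≤ ℤ.∣ c ∣ (3 ℕ.* M) Q {{ℕ.>-nonZero 1≤q*}} (begin
        ℤ.∣ c ∣ ℕ.* Q ≡⟨ ≡.cong (ℤ.∣ c ∣ ℕ.*_) Q≡ ⟨
        ℤ.∣ c ∣ ℕ.* ℤ.∣ lookup q* j ∣ ≤⟨ proj₂ (proj₂ (proj₂ (proj₂ red))) ⟩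
        ℤ.∣ lookup q j ∣ ℕ.+ ℤ.∣ lookup q* j ∣ ≤⟨ ℕP.+-mono-≤ (ℕP.≤-trans (∣lookup∣≤‖‖ℤ q j) q≤) (ℕP.≤-reflexive Q≡) ⟩
        2 ℕ.* h ℕ.+ Q ≤⟨ ℕP.+-monoʳ-≤ (2 ℕ.* h) (ℕP.m≤n*m Q M {{ℕ.>-nonZero 1≤M}}) ⟩
        2 ℕ.* h ℕ.+ h ≡⟨ eq M Q ⟩
        3 ℕ.* M ℕ.* Q ∎)
        where
        open ℕP.≤-Reasoning
        eq : ∀ M Q → 2 ℕ.* (M ℕ.* Q) ℕ.+ M ℕ.* Q ≡ 3 ℕ.* M ℕ.* Q
        eq = ℕ-Solver.solve-∀
      a≤ : ‖ a ‖ℤ ℕ.≤ 5 ℕ.* h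
      a≤ = begin
        ‖ a ‖ℤ ≤⟨ ‖⊕‖≤ q (c ⊙ q*) ⟩
        ‖ q ‖ℤ ℕ.+ ‖ c ⊙ q* ‖ℤ ≤⟨ ℕP.+-mono-≤ q≤ (ℕP.≤-trans (‖⊙‖≤ c q*) (ℕP.*-monoˡ-≤ Q c≤)) ⟩
        2 ℕ.* h ℕ.+ 3 ℕ.* M ℕ.* Q ≡⟨ eq M Q ⟩
        5 ℕ.* h ∎
        where
        open ℕP.≤-Reasoning
        eq : ∀ M Q → 2 ℕ.* (M ℕ.* Q) ℕ.+ 3 ℕ.* M ℕ.* Q ≡ 5 ℕ.* (M ℕ.* Q)
        eq = ℕ-Solver.solve-∀
      entry : ∀ i → Any (λ x → lookup a i ≡ x) (entries i)
      entry i with i FinP.≟ j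
      ... | yes ≡.refl = ≡.subst (_∈ᴸ List.map +_ (upTo Q)) (≡.sym a-at-j) (∈-map⁺ +_ (∈-upTo⁺ b<Q))
      ... | no _ = ∈-intRange (ℕP.≤-trans (∣lookup∣≤‖‖ℤ a i) a≤)

    -- Adding c q* moves A q modulo 1 by at most 3M/s* ≤ 1/(2r) in each coordinate; the hypothesis
    -- leaves 1/(2r) for the rest.
    near-residue : ∀ γ q c → ℤ.∣ c ∣ ℕ.≤ 3 ℕ.* M → Near (A *ᵥ q -ᵥ γ) (r ℕ.+ r) → Near (A *ᵥ (q ⊕ c ⊙ q*) -ᵥ γ) r
    near-residue γ q c c≤ (p , hp) = (λ i → p i ℤ.+ c ℤ.* p* i) , λ i → begin
      fromℕ r * ∣ (A *ᵥ (q ⊕ c ⊙ q*)) i - γ i - fromℤ (p i ℤ.+ c ℤ.* p* i) ∣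
        ≈⟨ *-congˡ (∣∣-cong (trans (+-cong (+-congʳ (trans (*ᵥ-⊕ A q (c ⊙ q*) i) (+-congˡ (*ᵥ-⊙ A c q* i))))
             (-‿cong (trans (fromℤ-+ (p i) (c ℤ.* p* i)) (+-congˡ (fromℤ-* c (p* i))))))
             (lemma ((A *ᵥ q) i) (fromℤ c) ((A *ᵥ q*) i) (γ i) (fromℤ (p i)) (fromℤ (p* i))))) ⟩
      fromℕ r * ∣ u i + fromℤ c * v i ∣
        ≤⟨ *-monoˡ-≤ (fromℕ-nonNeg r) (≤-trans (∣∣-+ (u i) (fromℤ c * v i)) (+-monoʳ-≤ ∣ u i ∣ (∣c*x∣≤ (v i)))) ⟩
      fromℕ r * (∣ u i ∣ + fromℕ (3 ℕ.* M) * ∣ v i ∣)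
        ≈⟨ distribˡ (fromℕ r) ∣ u i ∣ _ ⟩
      fromℕ r * ∣ u i ∣ + fromℕ r * (fromℕ (3 ℕ.* M) * ∣ v i ∣)
        ≤⟨ x+x≤1⇒x+y≤1 (≤-respˡ (double r ∣ u i ∣) (hp i)) (v-bound i) ⟩
      1# ∎
      where
      open ≤-R
      p* = proj₁ near*
      u v : Fin m → ℝ
      u i = (A *ᵥ q) i - γ i - fromℤ (p i)
      v i = (A *ᵥ q*) i - fromℤ (p* i)
      lemma : ∀ y c z g p t → (y + c * z - g) - (p + c * t) ≈ (y - g - p) + c * (z - t)
      lemma = solve 6 (λ y c z g p t → (y :+ c :* z :- g) :- (p :+ c :* t) := (y :- g :- p) :+ c :* (z :- t)) refl
      ∣c*x∣≤ : ∀ x → ∣ fromℤ c * x ∣ ≤ fromℕ (3 ℕ.* M) * ∣ x ∣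
      ∣c*x∣≤ x = ≤-trans (∣fromℤ*∣≤ c x) (*-monoʳ-≤ (∣∣-nonNeg x) (fromℕ-mono c≤))
      eq : ∀ r M → r ℕ.* (3 ℕ.* M) ℕ.+ r ℕ.* (3 ℕ.* M) ≡ 6 ℕ.* M ℕ.* r
      eq = ℕ-Solver.solve-∀
      v-bound : ∀ i → fromℕ r * (fromℕ (3 ℕ.* M) * ∣ v i ∣) + fromℕ r * (fromℕ (3 ℕ.* M) * ∣ v i ∣) ≤ 1#
      v-bound i = begin
        fromℕ r * (fromℕ (3 ℕ.* M) * ∣ v i ∣) + fromℕ r * (fromℕ (3 ℕ.* M) * ∣ v i ∣)
          ≈⟨ +-cong assoc assoc ⟩
        fromℕ (r ℕ.* (3 ℕ.* M)) * ∣ v i ∣ + fromℕ (r ℕ.* (3 ℕ.* M)) * ∣ v i ∣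
          ≈⟨ double (r ℕ.* (3 ℕ.* M)) ∣ v i ∣ ⟨
        fromℕ (r ℕ.* (3 ℕ.* M) ℕ.+ r ℕ.* (3 ℕ.* M)) * ∣ v i ∣
          ≤⟨ *-monoʳ-≤ (∣∣-nonNeg (v i)) (fromℕ-mono (ℕP.≤-trans (ℕP.≤-reflexive (eq r M)) 6Mr≤s*)) ⟩
        fromℕ s* * ∣ v i ∣
          ≤⟨ proj₂ near* i ⟩
        1# ∎
        where
        assoc : fromℕ r * (fromℕ (3 ℕ.* M) * ∣ v i ∣) ≈ fromℕ (r ℕ.* (3 ℕ.* M)) * ∣ v i ∣
        assoc = trans (sym (*-assoc _ _ _)) (*-congʳ (sym (fromℕ-* r (3 ℕ.* M))))

    f : Vec ℤ n → Fin m → ℤ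
    f a i = proj₁ (floor ((A *ᵥ a) i))

    shift : Vec ℤ n → Fin m → ℤ → ℝ
    shift a i e = (A *ᵥ a) i - fromℤ (f a i ℤ.+ e)

    -- Nearness is modulo the integers, whereas a cover needs actual centres. Since γ lies in the
    -- unit cube, the integer involved is within 2 of the floor of the coordinate, which leaves five
    -- translates.
    candidates : Vec ℤ n → Fin m → List ℝ
    candidates a i = List.map (shift a i) (intRange 2)

    centres : List (Vector ℝ m)
    centres = concatMap (λ a → choices (candidates a)) residues

    length-centres : length centres ℕ.≤ Q ℕ.* (suc (5 ℕ.* h ℕ.+ 5 ℕ.* h)) ℕ.^ n′ ℕ.* 5 ℕ.^ m
    length-centres = ℕP.≤-trans
      (length-concatMap-≤ (λ a → choices (candidates a)) residues (λ a → length-choices-≤ (candidates a)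
        (λ i → ℕP.≤-reflexive (≡.trans (length-map (shift a i) (intRange 2)) (length-intRange 2)))))
      (ℕP.*-monoˡ-≤ (5 ℕ.^ m) length-residues)

    centres-∋ : ∀ γ q → γ ∈ [0,1⟩ᵐ → ‖ q ‖ℤ ℕ.≤ 2 ℕ.* h → Near (A *ᵥ q -ᵥ γ) (r ℕ.+ r) →
      Any (λ c → ∀ i → fromℕ r * ∣ γ i - c i ∣ ≤ 1#) centres
    centres-∋ γ q γ∈ q≤ near = concatMap-Any (λ a → choices (candidates a)) {residues}
        (λ { ≡.refl → choices-Any (candidates a) (λ i c → fromℕ r * ∣ γ i - c ∣ ≤ 1#) candidate }) (proj₂ (proj₂ res))
      where
      res = residue q q≤
      c = proj₁ res
      a : Vec ℤ n
      a = q ⊕ c ⊙ q*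
      nr : Near (A *ᵥ a -ᵥ γ) r
      nr = near-residue γ q c (proj₁ (proj₂ res)) near
      candidate : ∀ i → Any (λ c → fromℕ r * ∣ γ i - c ∣ ≤ 1#) (candidates a i)
      candidate i = AnyP.map⁺ {f = shift a i} (Any.map (λ { ≡.refl → ≤-respˡ (*-congˡ close) (proj₂ nr i) }) (∈-intRange {2} {e} e≤2))
        where
        y : ℝ
        y = (A *ᵥ a) i
        p g e : ℤ
        p = proj₁ nr i
        g = f a i
        e = p ℤ.- g
        p≡ : p ≡ g ℤ.+ e
        p≡ = lemma p g
          where
          lemma : ∀ p g → p ≡ g ℤ.+ (p ℤ.- g)
          lemma = ℤ-Solver.solve-∀
        close : ∣ y - γ i - fromℤ p ∣ ≈ ∣ γ i - (y - fromℤ (g ℤ.+ e)) ∣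
        close = trans (sym (∣∣-neg _)) (∣∣-cong (trans (lemma y (γ i) (fromℤ p)) (+-congˡ (-‿cong (+-congˡ (-‿cong (fromℤ-cong p≡)))))))
          where
          lemma : ∀ y g p → - (y - g - p) ≈ g - (y - p)
          lemma = solve 3 (λ y g p → :- (y :- g :- p) := g :- (y :- p)) refl
        abs≤1 : ∣ y - γ i - fromℤ p ∣ ≤ 1#
        abs≤1 = ≤-trans (≤-respˡ (*-identityˡ _) (*-monoʳ-≤ (∣∣-nonNeg (y - γ i - fromℤ p)) (≤-respˡ fromℕ-1 (fromℕ-mono 1≤r)))) (proj₂ nr i)
        g≤y : fromℤ g ≤ y
        g≤y = proj₁ (proj₂ (floor y))
        y≤g+1 : y ≤ fromℤ g + 1#
        y≤g+1 = proj₁ (proj₂ (proj₂ (floor y)))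
        e≈ : fromℤ e ≈ fromℤ p - fromℤ g
        e≈ = trans (fromℤ-+ p (ℤ.- g)) (+-congˡ (fromℤ-neg g))
        two : fromℕ 2 ≈ 1# + 1#
        two = +-congˡ fromℕ-1
        e≤2 : ℤ.∣ e ∣ ℕ.≤ 2
        e≤2 = fromℕ-cancel-≤ (≤-respˡ (∣fromℤ∣ e) (≤-respˡ (∣∣-cong (sym e≈)) (≤-respʳ (sym two) (∣∣-≤
          (lin₃ (≤-trans (-x≤∣x∣ (y - γ i - fromℤ p)) abs≤1) y≤g+1 (proj₁ (γ∈ i)) (lemma₁ y (γ i) (fromℤ p) (fromℤ g)))
          (lin₃ (≤-trans (x≤∣x∣ (y - γ i - fromℤ p)) abs≤1) g≤y (proj₁ (proj₂ (γ∈ i))) (lemma₂ y (γ i) (fromℤ p) (fromℤ g)))))))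
          where
          lemma₁ : ∀ y t p g → (1# - - (y - t - p)) + (g + 1# - y) + (t - 0#) ≈ (1# + 1#) - (p - g)
          lemma₁ = solve 4 (λ y t p g → (con (+ 1) :- :- (y :- t :- p)) :+ (g :+ con (+ 1) :- y) :+ (t :- con (+ 0)) := (con (+ 1) :+ con (+ 1)) :- (p :- g)) refl
          lemma₂ : ∀ y t p g → (1# - (y - t - p)) + (y - g) + (1# - t) ≈ (1# + 1#) - - (p - g)
          lemma₂ = solve 4 (λ y t p g → (con (+ 1) :- (y :- t :- p)) :+ (y :- g) :+ (con (+ 1) :- t) := (con (+ 1) :+ con (+ 1)) :- :- (p :- g)) refl

  -- The constant 2ᵐ admits the precision 1/(2r) with r the m-th root of hⁿ rounded down, as
  -- `near-residue` needs.
  RecurrentFibre : Matrix → ℕ → Pred (Vector ℝ m) 0ℓ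
  RecurrentFibre A T γ = γ ∈ [0,1⟩ᵐ × Recurrent A γ (2 ℕ.^ m) T

  RecurrentFibre-Negligible : ∀ A T → WellApproximable A → Negligible (RecurrentFibre A T)
  RecurrentFibre-Negligible A T wa k = r , centres , 1≤r , volume≤ , λ γ (γ∈ , rec) →
      let q , _ , q≤ , near = rec h (r ℕ.+ r) T≤h s≤ in centres-∋ γ q γ∈ q≤ near
    where
    -- K collects the constants of the count, including k, and the factor M gained by clustering
    -- exceeds it. E is what 6 M r ≤ s* requires, given rᵐ ≤ hⁿ = Mⁿ‖q*‖ⁿ.
    K M E : ℕ
    K = k ℕ.* 11 ℕ.^ n′ ℕ.* 5 ℕ.^ m ℕ.* 2 ℕ.^ m ℕ.* 2 ℕ.^ m
    M = suc K
    E = 6 ℕ.^ m ℕ.* M ℕ.^ m ℕ.* M ℕ.^ n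
    abstract
      pick : ∃[ q ] ∃[ s ] T ℕ.⊔ 1 ℕ.≤ ‖ q ‖ℤ × E ℕ.* ‖ q ‖ℤ ℕ.^ n ℕ.≤ s ℕ.^ m × Near (A *ᵥ q) s
      pick = wa E (T ℕ.⊔ 1)
    q* = proj₁ pick
    s* = proj₁ (proj₂ pick)
    1≤Q : 1 ℕ.≤ ‖ q* ‖ℤ
    1≤Q = ℕP.≤-trans (ℕP.m≤n⊔m T 1) (proj₁ (proj₂ (proj₂ pick)))
    hₖ : ℕ
    hₖ = M ℕ.* ‖ q* ‖ℤ
    1≤h : 1 ℕ.≤ hₖ
    1≤h = ℕP.*-mono-≤ {1} {M} (ℕ.s≤s ℕ.z≤n) 1≤Q
    abstract
      rootₖ : ∃[ r ] r ℕ.^ m ℕ.≤ hₖ ℕ.^ n × hₖ ℕ.^ n ℕ.< suc r ℕ.^ m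
      rootₖ = root m′ (hₖ ℕ.^ n)
    r : ℕ
    r = proj₁ rootₖ
    1≤r : 1 ℕ.≤ r
    1≤r with 1 ℕP.≤? r
    ... | yes p = p
    ... | no ¬p = ⊥-elim (ℕP.<⇒≱ (proj₂ (proj₂ rootₖ))
        (ℕP.≤-trans (ℕP.^-monoˡ-≤ m (ℕP.≰⇒> ¬p)) (ℕP.≤-trans (ℕP.≤-reflexive (ℕP.^-zeroˡ m)) (1≤n^d n 1≤h))))
    6Mr≤s* : 6 ℕ.* M ℕ.* r ℕ.≤ s*
    6Mr≤s* = ^-cancelˡ-≤ m′ (begin
      (6 ℕ.* M ℕ.* r) ℕ.^ m ≡⟨ ≡.trans (^-distribʳ-* m (6 ℕ.* M) r) (≡.cong (ℕ._* r ℕ.^ m) (^-distribʳ-* m 6 M)) ⟩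
      6 ℕ.^ m ℕ.* M ℕ.^ m ℕ.* r ℕ.^ m ≤⟨ ℕP.*-monoʳ-≤ (6 ℕ.^ m ℕ.* M ℕ.^ m) (proj₁ (proj₂ rootₖ)) ⟩
      6 ℕ.^ m ℕ.* M ℕ.^ m ℕ.* hₖ ℕ.^ n ≡⟨ ≡.cong (6 ℕ.^ m ℕ.* M ℕ.^ m ℕ.*_) (^-distribʳ-* n M ‖ q* ‖ℤ) ⟩
      6 ℕ.^ m ℕ.* M ℕ.^ m ℕ.* (M ℕ.^ n ℕ.* ‖ q* ‖ℤ ℕ.^ n) ≡⟨ ℕP.*-assoc (6 ℕ.^ m ℕ.* M ℕ.^ m) (M ℕ.^ n) (‖ q* ‖ℤ ℕ.^ n) ⟨
      E ℕ.* ‖ q* ‖ℤ ℕ.^ n ≤⟨ proj₁ (proj₂ (proj₂ (proj₂ pick))) ⟩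
      s* ℕ.^ m ∎)
      where open ℕP.≤-Reasoning
    open Clusters A M r (ℕ.s≤s ℕ.z≤n) 1≤r q* s* 1≤Q 6Mr≤s* (proj₂ (proj₂ (proj₂ (proj₂ pick))))
    T≤h : T ℕ.≤ h
    T≤h = ℕP.≤-trans (ℕP.m≤m⊔n T 1) (ℕP.≤-trans (proj₁ (proj₂ (proj₂ pick))) (ℕP.m≤n*m ‖ q* ‖ℤ M))
    s≤ : (r ℕ.+ r) ℕ.^ m ℕ.≤ 2 ℕ.^ m ℕ.* h ℕ.^ n
    s≤ = ℕP.≤-trans (ℕP.≤-reflexive (≡.trans (≡.cong (ℕ._^ m) (n+n≡2*n r)) (^-distribʳ-* m 2 r))) (ℕP.*-monoʳ-≤ (2 ℕ.^ m) (proj₁ (proj₂ rootₖ)))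
    11h : suc (5 ℕ.* h ℕ.+ 5 ℕ.* h) ℕ.≤ 11 ℕ.* h
    11h = ℕP.≤-trans (ℕP.+-monoˡ-≤ (5 ℕ.* h ℕ.+ 5 ℕ.* h) 1≤h) (ℕP.≤-reflexive (eq h))
      where
      eq : ∀ h → h ℕ.+ (5 ℕ.* h ℕ.+ 5 ℕ.* h) ≡ 11 ℕ.* h
      eq = ℕ-Solver.solve-∀
    regroup : ∀ t k q a b c f → t ℕ.* (k ℕ.* (q ℕ.* (a ℕ.* b) ℕ.* f ℕ.* c)) ≡ k ℕ.* a ℕ.* f ℕ.* c ℕ.* t ℕ.* q ℕ.* b
    regroup = ℕ-Solver.solve-∀
    volume≤ : k ℕ.* (length centres ℕ.* 2 ℕ.^ m) ℕ.≤ r ℕ.^ m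
    volume≤ = ℕP.*-cancelˡ-≤ (2 ℕ.^ m) {{ℕP.m^n≢0 2 m}} (begin
      2 ℕ.^ m ℕ.* (k ℕ.* (length centres ℕ.* 2 ℕ.^ m))
        ≤⟨ ℕP.*-monoʳ-≤ (2 ℕ.^ m) (ℕP.*-monoʳ-≤ k (ℕP.*-monoˡ-≤ (2 ℕ.^ m) (ℕP.≤-trans length-centres
             (ℕP.*-monoˡ-≤ (5 ℕ.^ m) (ℕP.*-monoʳ-≤ ‖ q* ‖ℤ (ℕP.≤-trans (ℕP.^-monoˡ-≤ n′ 11h) (ℕP.≤-reflexive (^-distribʳ-* n′ 11 h)))))))) ⟩
      2 ℕ.^ m ℕ.* (k ℕ.* (‖ q* ‖ℤ ℕ.* (11 ℕ.^ n′ ℕ.* h ℕ.^ n′) ℕ.* 5 ℕ.^ m ℕ.* 2 ℕ.^ m))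
        ≡⟨ regroup (2 ℕ.^ m) k ‖ q* ‖ℤ (11 ℕ.^ n′) (h ℕ.^ n′) (2 ℕ.^ m) (5 ℕ.^ m) ⟩
      K ℕ.* ‖ q* ‖ℤ ℕ.* h ℕ.^ n′
        ≤⟨ ℕP.*-monoˡ-≤ (h ℕ.^ n′) (ℕP.*-monoˡ-≤ ‖ q* ‖ℤ (ℕP.n≤1+n K)) ⟩
      h ℕ.^ n
        ≤⟨ ℕP.<⇒≤ (proj₂ (proj₂ rootₖ)) ⟩
      suc r ℕ.^ m
        ≤⟨ ℕP.^-monoˡ-≤ m (ℕP.≤-trans (ℕP.+-monoˡ-≤ r 1≤r) (ℕP.≤-reflexive (n+n≡2*n r))) ⟩
      (2 ℕ.* r) ℕ.^ m
        ≡⟨ ^-distribʳ-* m 2 r ⟩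
      2 ℕ.^ m ℕ.* r ℕ.^ m ∎)
      where open ℕP.≤-Reasoning

  Ω-fibre-IsMeasure : ∀ A → WellApproximable A → Lebesgue.IsMeasure R Ω₍ A ₎ [ 0# ]
  Ω-fibre-IsMeasure A wa = ⋃-Negligible-IsMeasure (RecurrentFibre A)
    (λ γ ω → let T , _ , rec = Ω⇒Recurrent A γ ω (2 ℕ.^ m) 0 in T , proj₂ (Ω-range ω) , rec)
    (λ T → RecurrentFibre-Negligible A T wa)

  -- Slices at a fixed γ are null

  fromℕ-cancel-< : ∀ {a b} → fromℕ a < fromℕ b → a ℕ.< b
  fromℕ-cancel-< {a} {b} p with a ℕP.<? b
  ... | yes q = q
  ... | no ¬q = ⊥-elim (<⇒≱ p (fromℕ-mono (ℕP.≮⇒≥ ¬q)))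

  *-monoˡ-< : ∀ {c x y} → 0# < c → x < y → c * x < c * y
  *-monoˡ-< 0<c p = ≰⇒< λ q → <⇒≱ p (*-cancelˡ-≤ 0<c q)

  abstract
    n≤2^n : ∀ k → k ℕ.≤ 2 ℕ.^ k
    n≤2^n zero = ℕ.z≤n
    n≤2^n (suc k) = ℕP.≤-trans (ℕP.+-mono-≤ (ℕP.m^n>0 2 k) (n≤2^n k)) (ℕP.≤-reflexive (n+n≡2*n (2 ℕ.^ k)))

  ∣-*fromℤ∣≤ : ∀ {x u} q {X} → ∣ x - u ∣ ≤ 1# → ℤ.∣ q ∣ ℕ.≤ X → ∣ x * fromℤ q - u * fromℤ q ∣ ≤ fromℕ X
  ∣-*fromℤ∣≤ {x} {u} q {X} near q≤ = ≤-trans (≤-reflexive (∣∣-cong (lemma x u (fromℤ q)))) (≤-trans (bound q)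
      (≤-trans (*-mono-≤ (fromℕ-nonNeg ℤ.∣ q ∣) 0≤1 (fromℕ-mono q≤) near) (≤-reflexive (*-identityʳ (fromℕ X)))))
    where
    lemma : ∀ x u q → x * q - u * q ≈ q * (x - u)
    lemma = solve 3 (λ x u q → x :* q :- u :* q := q :* (x :- u)) refl
    bound : ∀ q → ∣ fromℤ q * (x - u) ∣ ≤ fromℕ ℤ.∣ q ∣ * ∣ x - u ∣
    bound q = ∣fromℤ*∣≤ q (x - u)

  dot-error : ∀ {k} c (a : Vector ℝ k) (w : Fin k → ℕ) (q : Fin k → ℤ) X → (∀ j → ∣ c * a j - fromℕ (w j) ∣ ≤ 1#) →
    (∀ j → ℤ.∣ q j ∣ ℕ.≤ X) → ∣ c * sum (λ j → a j * fromℤ (q j)) - fromℤ (dot w q) ∣ ≤ fromℕ (k ℕ.* X)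
  dot-error {zero} c a w q X near q≤ = ∣∣-≤ (≤-reflexive (lemma c)) (≤-reflexive (trans (-‿cong (lemma c)) -0#≈0#))
    where
    lemma : ∀ c → c * 0# - 0# ≈ 0#
    lemma = solve 1 (λ c → c :* con (+ 0) :- con (+ 0) := con (+ 0)) refl
  dot-error {suc k} c a w q X near q≤ = begin
    ∣ c * (a zero * fromℤ (q zero) + rest) - fromℤ (+ w zero ℤ.* q zero ℤ.+ dot (w ∘ suc) (q ∘ suc)) ∣
      ≈⟨ ∣∣-cong (trans (+-congˡ (-‿cong (trans (fromℤ-+ (+ w zero ℤ.* q zero) (dot (w ∘ suc) (q ∘ suc))) (+-congʳ (fromℤ-* (+ w zero) (q zero))))))
           (lemma c (a zero) (fromℤ (q zero)) rest (fromℕ (w zero)) (fromℤ (dot (w ∘ suc) (q ∘ suc))))) ⟩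
    ∣ (c * a zero * fromℤ (q zero) - fromℕ (w zero) * fromℤ (q zero)) + (c * rest - fromℤ (dot (w ∘ suc) (q ∘ suc))) ∣
      ≤⟨ ∣∣-+ _ _ ⟩
    ∣ c * a zero * fromℤ (q zero) - fromℕ (w zero) * fromℤ (q zero) ∣ + ∣ c * rest - fromℤ (dot (w ∘ suc) (q ∘ suc)) ∣
      ≤⟨ +-mono-≤ (∣-*fromℤ∣≤ (q zero) (near zero) (q≤ zero)) (dot-error c (a ∘ suc) (w ∘ suc) (q ∘ suc) X (near ∘ suc) (q≤ ∘ suc)) ⟩
    fromℕ X + fromℕ (k ℕ.* X)
      ≈⟨ fromℕ-+ X (k ℕ.* X) ⟨
    fromℕ (suc k ℕ.* X) ∎
    where
    open ≤-R
    rest : ℝ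
    rest = sum (λ j → a (suc j) * fromℤ (q (suc j)))
    lemma : ∀ c a q s w d → c * (a * q + s) - (w * q + d) ≈ (c * a * q - w * q) + (c * s - d)
    lemma = solve 6 (λ c a q s w d → c :* (a :* q :+ s) :- (w :* q :+ d) := (c :* a :* q :- w :* q) :+ (c :* s :- d)) refl

  InCell : ℕ → (Fin m → Fin n → ℕ) → Matrix → Set
  InCell R a A = ∀ i j → fromℕ (a i j) ≤ fromℕ R * A i j × fromℕ R * A i j < fromℕ (a i j) + 1#

  module Slice (γ : Vector ℝ m) where

    -- The factors of c₀ᵐ pay for the (5h)ⁿ large q, the (3R)ⁿ small q, and the 24ᵐ of window-bound.
    u c₀ : ℕ
    u = 4 ℕ.* 5 ℕ.^ n ℕ.* 3 ℕ.^ n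
    c₀ = u ℕ.* 24

    -- 1 ≤ T excludes q = 0, for which nearness says nothing about A.
    RecurrentSlice : ℕ → Pred Matrix 0ℓ
    RecurrentSlice T A = A ∈ [0,1⟩ᵐˣⁿ × 1 ℕ.≤ T × Recurrent A γ (c₀ ℕ.^ m) T

    module Refine (T R : ℕ) (1≤R : 1 ℕ.≤ R) where

      -- The summand R^(n+m) makes s large enough against the q of norm below R, and T brings h into
      -- the range of recurrence. g′ exceeds 2h and R, as `survivors-∋` asks, and also the rounding
      -- error n·2h + 1 of the linear forms.
      τ h s g′ : ℕ
      τ = R ℕ.^ (n ℕ.+ m) ℕ.+ T
      h = τ ℕ.^ m
      s = c₀ ℕ.* τ ℕ.^ n
      g′ = suc (n ℕ.* (2 ℕ.* h) ℕ.+ R)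

      1≤τ : 1 ℕ.≤ τ
      1≤τ = ℕP.≤-trans (ℕP.m^n>0 R {{ℕ.>-nonZero 1≤R}} (n ℕ.+ m)) (ℕP.m≤m+n (R ℕ.^ (n ℕ.+ m)) T)

      T≤h : T ℕ.≤ h
      T≤h = ℕP.≤-trans (ℕP.m≤n+m T (R ℕ.^ (n ℕ.+ m))) (n≤n^[1+d] τ m′)

      1≤h : 1 ℕ.≤ h
      1≤h = ℕP.≤-trans 1≤τ (n≤n^[1+d] τ m′)

      4≤u : 4 ℕ.≤ u
      4≤u = ℕP.≤-trans (ℕP.m≤m*n 4 (5 ℕ.^ n) {{ℕP.m^n≢0 5 n}}) (ℕP.m≤m*n (4 ℕ.* 5 ℕ.^ n) (3 ℕ.^ n) {{ℕP.m^n≢0 3 n}})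

      4≤s : 4 ℕ.≤ s
      4≤s = ℕP.≤-trans 4≤u (ℕP.≤-trans (ℕP.m≤m*n u 24) (ℕP.m≤m*n c₀ (τ ℕ.^ n) {{ℕ.>-nonZero (ℕP.≤-trans 1≤τ (n≤n^[1+d] τ n′))}}))

      s^m : s ℕ.^ m ≡ u ℕ.^ m ℕ.* 24 ℕ.^ m ℕ.* (τ ℕ.^ n) ℕ.^ m
      s^m = ≡.trans (^-distribʳ-* m c₀ (τ ℕ.^ n)) (≡.cong (ℕ._* (τ ℕ.^ n) ℕ.^ m) (^-distribʳ-* m u 24))

      h^n : h ℕ.^ n ≡ (τ ℕ.^ n) ℕ.^ m
      h^n = ≡.trans (ℕP.^-*-assoc τ m n) (≡.trans (≡.cong (τ ℕ.^_) (ℕP.*-comm m n)) (≡.sym (ℕP.^-*-assoc τ n m)))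

      s≤ : s ℕ.^ m ℕ.≤ c₀ ℕ.^ m ℕ.* h ℕ.^ n
      s≤ = ℕP.≤-reflexive (≡.trans (^-distribʳ-* m c₀ (τ ℕ.^ n)) (≡.cong (c₀ ℕ.^ m ℕ.*_) (≡.sym h^n)))

      big : 4 ℕ.* (5 ℕ.* h) ℕ.^ n ℕ.* 24 ℕ.^ m ℕ.≤ s ℕ.^ m
      big = begin
        4 ℕ.* (5 ℕ.* h) ℕ.^ n ℕ.* 24 ℕ.^ m ≡⟨ ≡.cong (λ x → 4 ℕ.* x ℕ.* 24 ℕ.^ m) (^-distribʳ-* n 5 h) ⟩
        4 ℕ.* (5 ℕ.^ n ℕ.* h ℕ.^ n) ℕ.* 24 ℕ.^ m ≡⟨ regroup (5 ℕ.^ n) (h ℕ.^ n) (24 ℕ.^ m) ⟩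
        4 ℕ.* 5 ℕ.^ n ℕ.* 24 ℕ.^ m ℕ.* h ℕ.^ n ≤⟨ ℕP.*-monoˡ-≤ (h ℕ.^ n) (ℕP.*-monoˡ-≤ (24 ℕ.^ m) (ℕP.≤-trans
                                                                     (ℕP.m≤m*n (4 ℕ.* 5 ℕ.^ n) (3 ℕ.^ n) {{ℕP.m^n≢0 3 n}}) (n≤n^[1+d] u m′))) ⟩
        u ℕ.^ m ℕ.* 24 ℕ.^ m ℕ.* h ℕ.^ n ≡⟨ ≡.trans (≡.cong (u ℕ.^ m ℕ.* 24 ℕ.^ m ℕ.*_) h^n) (≡.sym s^m) ⟩
        s ℕ.^ m ∎
        where
        open ℕP.≤-Reasoning
        regroup : ∀ a b c → 4 ℕ.* (a ℕ.* b) ℕ.* c ≡ 4 ℕ.* a ℕ.* c ℕ.* b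
        regroup = ℕ-Solver.solve-∀

      small : 4 ℕ.* (3 ℕ.* R) ℕ.^ n ℕ.* (24 ℕ.* R) ℕ.^ m ℕ.≤ s ℕ.^ m
      small = begin
        4 ℕ.* (3 ℕ.* R) ℕ.^ n ℕ.* (24 ℕ.* R) ℕ.^ m ≡⟨ ≡.cong₂ (λ x y → 4 ℕ.* x ℕ.* y) (^-distribʳ-* n 3 R) (^-distribʳ-* m 24 R) ⟩
        4 ℕ.* (3 ℕ.^ n ℕ.* R ℕ.^ n) ℕ.* (24 ℕ.^ m ℕ.* R ℕ.^ m) ≡⟨ regroup (3 ℕ.^ n) (R ℕ.^ n) (24 ℕ.^ m) (R ℕ.^ m) ⟩
        4 ℕ.* 3 ℕ.^ n ℕ.* 24 ℕ.^ m ℕ.* (R ℕ.^ n ℕ.* R ℕ.^ m) ≤⟨ ℕP.*-mono-≤ (ℕP.*-monoˡ-≤ (24 ℕ.^ m) (ℕP.≤-trans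
               (ℕP.*-monoˡ-≤ (3 ℕ.^ n) (ℕP.m≤m*n 4 (5 ℕ.^ n) {{ℕP.m^n≢0 5 n}})) (n≤n^[1+d] u m′))) R≤ ⟩
        u ℕ.^ m ℕ.* 24 ℕ.^ m ℕ.* (τ ℕ.^ n) ℕ.^ m ≡⟨ s^m ⟨
        s ℕ.^ m ∎
        where
        open ℕP.≤-Reasoning
        regroup : ∀ a b c d → 4 ℕ.* (a ℕ.* b) ℕ.* (c ℕ.* d) ≡ 4 ℕ.* a ℕ.* c ℕ.* (b ℕ.* d)
        regroup = ℕ-Solver.solve-∀
        R≤ : R ℕ.^ n ℕ.* R ℕ.^ m ℕ.≤ (τ ℕ.^ n) ℕ.^ m
        R≤ = ℕP.≤-trans (ℕP.≤-reflexive (≡.sym (ℕP.^-distribˡ-+-* R n m)))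
          (ℕP.≤-trans (ℕP.m≤m+n (R ℕ.^ (n ℕ.+ m)) T) (ℕP.≤-trans (n≤n^[1+d] τ n′) (n≤n^[1+d] (τ ℕ.^ n) m′)))

      instance
        R≢0 : NonZero R
        R≢0 = ℕ.>-nonZero 1≤R
        s≢0 : NonZero s
        s≢0 = ℕ.>-nonZero (ℕP.≤-trans (ℕ.s≤s ℕ.z≤n) 4≤s)

      open Survivors m n′ R s g′ hiding (‖_‖)

      b : Fin m → ℤ
      b i = proj₁ (floor (fromℕ M * γ i))

      children : (Fin m → Fin n → ℕ) → List (Fin m → Fin n → ℕ)
      children a = survivors a b h

      children-few : ∀ a → 2 ℕ.* length (children a) ℕ.≤ (g ℕ.^ n) ℕ.^ m
      children-few a = length-survivors a b h 4≤s 1≤h big small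

      -- Multiplied by M, the distance 1/s becomes R g′. Rounding M A to w costs at most 2h for each
      -- of the n entries of q, and rounding M γ costs 1; together these fit into the other half of
      -- D.
      close : ∀ A w q → InCell M w A → ‖ q ‖ℤ ℕ.≤ 2 ℕ.* h → ((p , _) : Near (A *ᵥ q -ᵥ γ) s) → ∀ i →
        ℤ.∣ dot (w i) (lookup q) ℤ.- b i ℤ.- + M ℤ.* p i ∣ ℕ.≤ D
      close A w q cell q≤ (p , hp) i = fromℕ-cancel-≤ (begin
        fromℕ ℤ.∣ d ℤ.- b i ℤ.- + M ℤ.* p i ∣ ≈⟨ ∣fromℤ∣ (d ℤ.- b i ℤ.- + M ℤ.* p i) ⟨
        ∣ fromℤ (d ℤ.- b i ℤ.- + M ℤ.* p i) ∣ ≈⟨ ∣∣-cong expand ⟩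
        ∣ c * (y - γ i - fromℤ (p i)) + (- (c * y - fromℤ d) + (c * γ i - fromℤ (b i))) ∣ ≤⟨ ≤-trans (∣∣-+ _ _) (+-monoʳ-≤ _ (∣∣-+ _ _)) ⟩
        ∣ c * (y - γ i - fromℤ (p i)) ∣ + (∣ - (c * y - fromℤ d) ∣ + ∣ c * γ i - fromℤ (b i) ∣) ≤⟨ +-mono-≤ main (+-mono-≤ error rounding) ⟩
        fromℕ (R ℕ.* g′) + (fromℕ (n ℕ.* (2 ℕ.* h)) + 1#) ≈⟨ +-congˡ (+-comm _ 1#) ⟩
        fromℕ (R ℕ.* g′) + fromℕ (suc (n ℕ.* (2 ℕ.* h))) ≈⟨ fromℕ-+ (R ℕ.* g′) (suc (n ℕ.* (2 ℕ.* h))) ⟨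
        fromℕ (R ℕ.* g′ ℕ.+ suc (n ℕ.* (2 ℕ.* h))) ≤⟨ fromℕ-mono (ℕP.+-monoʳ-≤ (R ℕ.* g′) small-error) ⟩
        fromℕ D ∎)
        where
        open ≤-R
        d : ℤ
        d = dot (w i) (lookup q)
        c y : ℝ
        c = fromℕ M
        y = (A *ᵥ q) i
        small-error : suc (n ℕ.* (2 ℕ.* h)) ℕ.≤ R ℕ.* g′ ℕ.+ 0
        small-error = ℕP.≤-trans (ℕP.≤-trans (ℕ.s≤s (ℕP.m≤m+n (n ℕ.* (2 ℕ.* h)) R)) (ℕP.m≤n*m g′ R))
          (ℕP.≤-reflexive (≡.sym (ℕP.+-identityʳ (R ℕ.* g′))))
        lemma : ∀ d b c p y g → d - b - c * p ≈ c * (y - g - p) + (- (c * y - d) + (c * g - b))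
        lemma = solve 6 (λ d b c p y g → d :- b :- c :* p := c :* (y :- g :- p) :+ (:- (c :* y :- d) :+ (c :* g :- b))) refl
        expand : fromℤ (d ℤ.- b i ℤ.- + M ℤ.* p i) ≈ c * (y - γ i - fromℤ (p i)) + (- (c * y - fromℤ d) + (c * γ i - fromℤ (b i)))
        expand = trans (trans (fromℤ-+ (d ℤ.- b i) (ℤ.- (+ M ℤ.* p i))) (+-cong
            (trans (fromℤ-+ d (ℤ.- b i)) (+-congˡ (fromℤ-neg (b i))))
            (trans (fromℤ-neg (+ M ℤ.* p i)) (-‿cong (fromℤ-* (+ M) (p i))))))
          (lemma (fromℤ d) (fromℤ (b i)) c (fromℤ (p i)) y (γ i))
        M≡ : M ≡ R ℕ.* g′ ℕ.* s
        M≡ = eq R s g′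
          where
          eq : ∀ R s g → R ℕ.* (s ℕ.* g) ≡ R ℕ.* g ℕ.* s
          eq = ℕ-Solver.solve-∀
        main : ∣ c * (y - γ i - fromℤ (p i)) ∣ ≤ fromℕ (R ℕ.* g′)
        main = begin
          ∣ c * (y - γ i - fromℤ (p i)) ∣ ≈⟨ ∣∣-scale (fromℕ-nonNeg M) (y - γ i - fromℤ (p i)) ⟩
          c * ∣ y - γ i - fromℤ (p i) ∣ ≈⟨ *-congʳ (trans (reflexive (≡.cong fromℕ M≡)) (fromℕ-* (R ℕ.* g′) s)) ⟩
          fromℕ (R ℕ.* g′) * fromℕ s * ∣ y - γ i - fromℤ (p i) ∣ ≈⟨ *-assoc _ _ _ ⟩
          fromℕ (R ℕ.* g′) * (fromℕ s * ∣ y - γ i - fromℤ (p i) ∣) ≤⟨ *-monoˡ-≤ (fromℕ-nonNeg (R ℕ.* g′)) (hp i) ⟩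
          fromℕ (R ℕ.* g′) * 1# ≈⟨ *-identityʳ _ ⟩
          fromℕ (R ℕ.* g′) ∎
        error : ∣ - (c * y - fromℤ d) ∣ ≤ fromℕ (n ℕ.* (2 ℕ.* h))
        error = ≤-respˡ (sym (∣∣-neg _)) (dot-error c (A i) (w i) (lookup q) (2 ℕ.* h)
          (λ j → floor-error (proj₁ (cell i j)) (proj₂ (cell i j))) (λ j → ℕP.≤-trans (∣lookup∣≤‖‖ℤ q j) q≤))
        rounding : ∣ c * γ i - fromℤ (b i) ∣ ≤ 1#
        rounding = let lo , hi = proj₂ (floor (c * γ i)) in floor-error lo hi

      children-∋ : ∀ {A a} → A ∈ RecurrentSlice T → InCell R a A → Any (λ w → InCell M w A) (children a)
      children-∋ {A} {a} (A∈ , 1≤T , rec) cell = Any.map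
          (λ e i j → ≡.subst (λ k → fromℕ k ≤ fromℕ M * A i j × fromℕ M * A i j < fromℕ k + 1#) (≡.sym (e i j)) (in-w i j))
          (survivors-∋ a b h w (lookup q) 2h≤g′ R≤g′ sub
            (≡.subst (1 ℕ.≤_) (≡.sym norm≡) (ℕP.≤-trans 1≤T T≤q)) (≡.subst (ℕ._≤ 2 ℕ.* h) (≡.sym norm≡) q≤)
            (λ i → proj₁ near i , close A w q in-w q≤ near i))
        where
        found = rec h s T≤h s≤
        q = proj₁ found
        T≤q = proj₁ (proj₂ found)
        q≤ = proj₁ (proj₂ (proj₂ found))
        near = proj₂ (proj₂ (proj₂ found))
        norm≡ : Survivors.‖_‖ m n′ R s g′ a b (lookup q) ≡ ‖ q ‖ℤ
        norm≡ = proj₂ (‖‖ℤ-attained q)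
        2h≤g′ : 2 ℕ.* h ℕ.≤ g′
        2h≤g′ = ℕP.m≤n⇒m≤1+n (ℕP.≤-trans (ℕP.m≤n*m (2 ℕ.* h) n) (ℕP.m≤m+n (n ℕ.* (2 ℕ.* h)) R))
        R≤g′ : R ℕ.≤ g′
        R≤g′ = ℕP.m≤n⇒m≤1+n (ℕP.m≤n+m R (n ℕ.* (2 ℕ.* h)))
        floors : ∀ i j → ∃[ k ] fromℕ k ≤ fromℕ M * A i j × fromℕ M * A i j < fromℕ k + 1#
        floors i j = ℕ-floor (*-nonNeg (fromℕ-nonNeg M) (proj₁ (A∈ i j)))
        w : Fin m → Fin n → ℕ
        w i j = proj₁ (floors i j)
        in-w : InCell M w A
        in-w i j = proj₂ (floors i j)
        rescale : ∀ i j → fromℕ g * (fromℕ R * A i j) ≈ fromℕ M * A i j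
        rescale i j = trans (sym (*-assoc _ _ _)) (*-congʳ (trans (*-comm (fromℕ g) (fromℕ R)) (sym (fromℕ-* R g))))
        0<g : 0# < fromℕ g
        0<g = fromℕ-pos (ℕP.*-mono-≤ {1} {s} (ℕP.≤-trans (ℕ.s≤s ℕ.z≤n) 4≤s) (ℕ.s≤s ℕ.z≤n))
        sub : ∀ i j → a i j ℕ.* g ℕ.≤ w i j × w i j ℕ.< a i j ℕ.* g ℕ.+ g
        sub i j = ℕP.≤-pred (fromℕ-cancel-< (≤-<-trans lo (<-≤-trans (proj₂ (in-w i j)) (≤-reflexive (+-comm _ 1#))))) ,
            fromℕ-cancel-< (≤-<-trans (proj₁ (in-w i j)) (<-≤-trans hi (≤-reflexive hi≈)))
          where
          lo : fromℕ (a i j ℕ.* g) ≤ fromℕ M * A i j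
          lo = ≤-respˡ (trans (*-comm (fromℕ g) (fromℕ (a i j))) (sym (fromℕ-* (a i j) g)))
            (≤-respʳ (rescale i j) (*-monoˡ-≤ (proj₁ 0<g) (proj₁ (cell i j))))
          hi : fromℕ M * A i j < fromℕ g * (fromℕ (a i j) + 1#)
          hi = ≤-<-trans (≤-reflexive (sym (rescale i j))) (*-monoˡ-< 0<g (proj₂ (cell i j)))
          hi≈ : fromℕ g * (fromℕ (a i j) + 1#) ≈ fromℕ (a i j ℕ.* g ℕ.+ g)
          hi≈ = trans (lemma (fromℕ g) (fromℕ (a i j))) (sym (trans (fromℕ-+ (a i j ℕ.* g) g) (+-congʳ (fromℕ-* (a i j) g))))
            where
            lemma : ∀ g a → g * (a + 1#) ≈ a * g + g
            lemma = solve 2 (λ g a → g :* (a :+ con (+ 1)) := a :* g :+ g) refl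

    -- Each refinement of the grid halves the total volume of the cells that are kept.
    abstract
      grids : ∀ T k → ∃[ R ] Σ (List (Fin m → Fin n → ℕ)) λ L → 1 ℕ.≤ R × 2 ℕ.^ k ℕ.* length L ℕ.≤ (R ℕ.^ n) ℕ.^ m ×
        (∀ A → A ∈ RecurrentSlice T → Any (λ a → InCell R a A) L)
      grids T zero = 1 , (λ _ _ → 0) ∷ [] , ℕP.≤-refl ,
        ℕP.≤-reflexive (≡.sym (≡.trans (≡.cong (ℕ._^ m) (ℕP.^-zeroˡ n)) (ℕP.^-zeroˡ m))) ,
        λ A (A∈ , _) → here λ i j → ≤-respʳ (one (A i j)) (proj₁ (A∈ i j)) ,
          ≤-<-trans (≤-reflexive (sym (one (A i j)))) (<-≤-trans (proj₂ (A∈ i j)) (≤-reflexive (sym (+-identityˡ 1#))))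
        where
        one : ∀ x → x ≈ fromℕ 1 * x
        one x = sym (trans (*-congʳ fromℕ-1) (*-identityˡ x))
      grids T (suc k) = refine (grids T k)
        where
        refine : (∃[ R ] Σ (List (Fin m → Fin n → ℕ)) λ L → 1 ℕ.≤ R × 2 ℕ.^ k ℕ.* length L ℕ.≤ (R ℕ.^ n) ℕ.^ m ×
            (∀ A → A ∈ RecurrentSlice T → Any (λ a → InCell R a A) L)) →
          ∃[ R ] Σ (List (Fin m → Fin n → ℕ)) λ L → 1 ℕ.≤ R × 2 ℕ.^ suc k ℕ.* length L ℕ.≤ (R ℕ.^ n) ℕ.^ m ×
            (∀ A → A ∈ RecurrentSlice T → Any (λ a → InCell R a A) L)
        refine (R , L , 1≤R , few , cover) = M , concatMap children L , ℕ.>-nonZero⁻¹ M {{M≢0}} , (begin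
            2 ℕ.^ suc k ℕ.* length (concatMap children L) ≡⟨ regroup (2 ℕ.^ k) (length (concatMap children L)) ⟩
            2 ℕ.^ k ℕ.* (2 ℕ.* length (concatMap children L)) ≤⟨ ℕP.*-monoʳ-≤ (2 ℕ.^ k) (*-length-concatMap-≤ 2 children L children-few) ⟩
            2 ℕ.^ k ℕ.* (length L ℕ.* (g ℕ.^ n) ℕ.^ m) ≡⟨ ℕP.*-assoc (2 ℕ.^ k) (length L) _ ⟨
            2 ℕ.^ k ℕ.* length L ℕ.* (g ℕ.^ n) ℕ.^ m ≤⟨ ℕP.*-monoˡ-≤ ((g ℕ.^ n) ℕ.^ m) few ⟩
            (R ℕ.^ n) ℕ.^ m ℕ.* (g ℕ.^ n) ℕ.^ m ≡⟨ ^-distribʳ-* m (R ℕ.^ n) (g ℕ.^ n) ⟨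
            (R ℕ.^ n ℕ.* g ℕ.^ n) ℕ.^ m ≡⟨ ≡.cong (ℕ._^ m) (^-distribʳ-* n R g) ⟨
            (M ℕ.^ n) ℕ.^ m ∎) ,
            λ A A∈ → concatMap-Any children (children-∋ A∈) (cover A A∈)
          where
          open ℕP.≤-Reasoning
          open Refine T R 1≤R
          open Survivors m n′ R s g′ using (M; g; M≢0)
          regroup : ∀ x y → 2 ℕ.* x ℕ.* y ≡ x ℕ.* (2 ℕ.* y)
          regroup = ℕ-Solver.solve-∀

    -- m · n computes to the successor of n′ + m′ · n, and `Negligible` takes the dimension in this
    -- shifted form.
    RecurrentSlice-Negligible : ∀ T → Negligible {n′ ℕ.+ m′ ℕ.* n} (λ x → (λ i j → x (combine i j)) ∈ RecurrentSlice T)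
    RecurrentSlice-Negligible T k = S , List.map centre L , 1≤S , (begin
        k ℕ.* (length (List.map centre L) ℕ.* 2 ℕ.^ (m ℕ.* n)) ≡⟨ ≡.cong (λ x → k ℕ.* (x ℕ.* 2 ℕ.^ (m ℕ.* n))) (length-map centre L) ⟩
        k ℕ.* (length L ℕ.* 2 ℕ.^ (m ℕ.* n)) ≤⟨ ℕP.*-monoˡ-≤ (length L ℕ.* 2 ℕ.^ (m ℕ.* n)) (n≤2^n k) ⟩
        2 ℕ.^ k ℕ.* (length L ℕ.* 2 ℕ.^ (m ℕ.* n)) ≡⟨ regroup (2 ℕ.^ k) (length L) (2 ℕ.^ (m ℕ.* n)) ⟩
        2 ℕ.^ k ℕ.* 2 ℕ.^ (m ℕ.* n) ℕ.* length L ≡⟨ ≡.cong (ℕ._* length L) (ℕP.^-distribˡ-+-* 2 k (m ℕ.* n)) ⟨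
        2 ℕ.^ (k ℕ.+ m ℕ.* n) ℕ.* length L ≤⟨ proj₁ (proj₂ (proj₂ (proj₂ grid))) ⟩
        (S ℕ.^ n) ℕ.^ m ≡⟨ ≡.trans (ℕP.^-*-assoc S n m) (≡.cong (S ℕ.^_) (ℕP.*-comm n m)) ⟩
        S ℕ.^ (m ℕ.* n) ∎) ,
        λ x x∈ → AnyP.map⁺ (Any.map (λ {a} → near x a) (proj₂ (proj₂ (proj₂ (proj₂ grid))) (λ i j → x (combine i j)) x∈))
      where
      open ℕP.≤-Reasoning
      -- The cubes are centred at the corners of the cells and have side 2/S instead of 1/S; the
      -- extra m n halvings pay for this. The remaining k give 2^k ≥ k.
      grid = grids T (k ℕ.+ m ℕ.* n)
      S : ℕ
      S = proj₁ grid
      L = proj₁ (proj₂ grid)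
      1≤S = proj₁ (proj₂ (proj₂ grid))
      regroup : ∀ a b c → a ℕ.* (b ℕ.* c) ≡ a ℕ.* c ℕ.* b
      regroup = ℕ-Solver.solve-∀
      abstract
        S⁻¹ : ∃[ x ] (fromℕ S * x ≈ 1# × 0# < x)
        S⁻¹ = recip (fromℕ-pos 1≤S)
      centre : (Fin m → Fin n → ℕ) → Vector ℝ (m ℕ.* n)
      centre a t = let i , j = remQuot {m} n t in fromℕ (a i j) * proj₁ S⁻¹
      near : ∀ x a → InCell S a (λ i j → x (combine i j)) → ∀ t → fromℕ S * ∣ x t - centre a t ∣ ≤ 1#
      near x a cell t = let i , j = remQuot {m} n t in
        ≡.subst (λ t′ → fromℕ S * ∣ x t′ - centre a t ∣ ≤ 1#) (FinP.combine-remQuot {m} n t)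
          (≤-respˡ (trans (∣∣-cong (scaled (x (combine i j)) (fromℕ (a i j)))) (∣∣-scale (fromℕ-nonNeg S) (x (combine i j) - centre a t)))
            (floor-error (proj₁ (cell i j)) (proj₂ (cell i j))))
        where
        scaled : ∀ y k → fromℕ S * y - k ≈ fromℕ S * (y - k * proj₁ S⁻¹)
        scaled y k = trans (+-congˡ (-‿cong (trans (sym (*-identityʳ k)) (*-congˡ (sym (proj₁ (proj₂ S⁻¹)))))))
            (lemma (fromℕ S) y k (proj₁ S⁻¹))
          where
          lemma : ∀ r y k i → r * y - k * (r * i) ≈ r * (y - k * i)
          lemma = solve 4 (λ r y k i → r :* y :- k :* (r :* i) := r :* (y :- k :* i)) refl

    Ω-slice-IsMeasure : IsMatrixMeasure (Ω^ γ) [ 0# ]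
    Ω-slice-IsMeasure = ⋃-Negligible-IsMeasure (λ T x → (λ i j → x (combine i j)) ∈ RecurrentSlice T)
      (λ x ω → let T , 1≤T , rec = Ω⇒Recurrent (λ i j → x (combine i j)) γ ω (c₀ ℕ.^ m) 1 in T , proj₁ (Ω-range ω) , 1≤T , rec)
      RecurrentSlice-Negligible

  -- The dichotomy between bad and well approximable matrices

  Empty-IsMeasure : ∀ {l} {E : Pred (Vector ℝ (suc l)) 0ℓ} → Empty E → Lebesgue.IsMeasure R E [ 0# ]
  Empty-IsMeasure {l} {E} empty = ⋃-Negligible-IsMeasure (λ _ → E) (λ x x∈ → 0 , x∈)
    (λ _ k → 1 , [] , ℕP.≤-refl , ℕP.≤-trans (ℕP.≤-reflexive (ℕP.*-zeroʳ k)) ℕ.z≤n , λ x x∈ → ⊥-elim (empty x x∈))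

  Bad⇒Empty : ∀ A → A ∈ Bad⁰ → Empty Ω₍ A ₎
  Bad⇒Empty A bad γ = ¬WellApproximable⇒∉Ω A γ (Bad⇒¬WellApproximable A bad)

  ¬Bad⇒WellApproximable : ∀ A → A ∈ [0,1⟩ᵐˣⁿ → ¬ A ∈ Bad⁰ → WellApproximable A
  ¬Bad⇒WellApproximable A A∈ ¬bad = by-contra λ ¬wa → ¬bad (¬WellApproximable⇒Bad A A∈ ¬wa)

  ⋃Ω≐∁Bad : ⋃ (∃ [0,1⟩ᵐ) (λ γ → Ω^ (proj₁ γ)) ≐ [0,1⟩ᵐˣⁿ ∖ Bad⁰
  ⋃Ω≐∁Bad = (λ { {A} ((γ , _) , ω) → proj₁ (Ω-range ω) , λ bad → Bad⇒Empty A bad γ ω }) ,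
    λ { {A} (A∈ , ¬bad) → let γ , γ∈ , ω = WellApproximable⇒Ω-nonempty A A∈ (¬Bad⇒WellApproximable A A∈ ¬bad) in (γ , γ∈) , ω }

  Empty⇔Bad : ∀ A → A ∈ [0,1⟩ᵐˣⁿ → Empty Ω₍ A ₎ ⇔ A ∈ Bad⁰
  Empty⇔Bad A A∈ = mk⇔
    (λ empty → by-contra λ ¬bad → let γ , _ , ω = WellApproximable⇒Ω-nonempty A A∈ (¬Bad⇒WellApproximable A A∈ ¬bad) in empty γ ω)
    (Bad⇒Empty A)

  fibre-IsMeasure : ∀ A → A ∈ [0,1⟩ᵐˣⁿ → Lebesgue.IsMeasure R Ω₍ A ₎ [ 0# ]
  fibre-IsMeasure A A∈ with em {A ∈ Bad⁰}
  ... | yes bad = Empty-IsMeasure (Bad⇒Empty A bad)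
  ... | no ¬bad = Ω-fibre-IsMeasure A (¬Bad⇒WellApproximable A A∈ ¬bad)

theorem1p3 : ExcludedMiddle 0ℓ → (R : RealNumbers) (m n : ℕ) .{{_ : NonZero m}} .{{_ : NonZero n}} →
    let open RealNumbers R
        open Lebesgue R
        open Approximation R m n
    in
    (⋃ (∃ [0,1⟩ᵐ) (λ γ → Ω^ (proj₁ γ)) ≐ [0,1⟩ᵐˣⁿ ∖ Bad⁰)
    × (∀ A → A ∈ [0,1⟩ᵐˣⁿ → Empty Ω₍ A ₎ ⇔ A ∈ Bad⁰)
    × (∀ γ → γ ∈ [0,1⟩ᵐ → IsMatrixMeasure (Ω^ γ) [ 0# ])
    × (∀ A → A ∈ [0,1⟩ᵐˣⁿ → IsMeasure Ω₍ A ₎ [ 0# ])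
theorem1p3 em R (suc m′) (suc n′) = ⋃Ω≐∁Bad , Empty⇔Bad , (λ γ _ → Slice.Ω-slice-IsMeasure γ) , fibre-IsMeasure
  where open Diophantine em R m′ n′
theorem1p3 _ _ zero _ {{m≢0}} = ⊥-elim-irr (ℕ.≢-nonZero⁻¹ 0 {{m≢0}} ≡.refl)
theorem1p3 _ _ (suc _) zero {{_}} {{n≢0}} = ⊥-elim-irr (ℕ.≢-nonZero⁻¹ 0 {{n≢0}} ≡.refl)
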